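{- Let $k, q$ be positive integers and let $H$ be a $k$-uniform hypergraph on $n$ vertices with skeletal degeneracy $d_1(H)=d$. Then the $q$-color Ramsey number of $H$ satisfies $r(H;q)\leq O_{k,d,q}(n)$; that is, there is a constant $C$ depending only on $k,d,q$ such that $r(H;q) \le Cn$.
   Context: The $q$-color Ramsey number $r(H;q)$ is the minimum positive integer $N$ such that every coloring of the edges of the complete $k$-uniform hypergraph $K_N^{(k)}$ with $q$ colors contains a monochromatic copy of $H$. The $1$-skeleton $H^{(1)}$ of a $k$-uniform hypergraph $H$ is the graph on $V(H)$ in which two vertices are adjacent iff they lie in a common edge of $H$; the skeletal degeneracy $d_1(H)$ is the degeneracy of $H^{(1)}$, i.e. the least $d$ such that every subgraph of $H^{(1)}$ has minimum degree at most $d$. -}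

module Defs where

open import Data.Nat using (ℕ; _≤_; _<_)
open import Data.Bool using (Bool; true; false; _∧_; _∨_; not)
open import Data.Fin using (Fin; zero; suc)
open import Data.Fin.Properties using () renaming (_≟_ to _≟ᶠ_)
open import Data.Fin.Subset using (Subset; _∈_; _∩_; ∣_∣; Nonempty)
open import Data.List using (List; [])
open import Data.List.Relation.Unary.All using (All)
open import Data.Vec using (Vec; lookup; tabulate)
open import Data.Product using (Σ; ∃; _×_; _,_)
open import Function.Definitions using (Injective)
open import Relation.Binary.PropositionalEquality using (_≡_)
open import Relation.Nullary using (¬_)
open import Relation.Nullary.Decidable using (⌊_⌋)

record Hypergraph (k n : ℕ) : Set where
  field
    edges   : List (Subset n)
    uniform : All (λ e → ∣ e ∣ ≡ k) edges
open Hypergraph public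

anyFin : ∀ {m} → (Fin m → Bool) → Bool
anyFin {ℕ.zero}  p = false
anyFin {ℕ.suc m} p = p zero ∨ anyFin (λ i → p (suc i))

anyList : ∀ {A : Set} → (A → Bool) → List A → Bool
anyList p []       = false
anyList p (x List.∷ xs) = p x ∨ anyList p xs

skelNbhd : ∀ {k n} → Hypergraph k n → Fin n → Subset n
skelNbhd H v = tabulate λ u →
  not ⌊ u ≟ᶠ v ⌋ ∧ anyList (λ e → lookup e u ∧ lookup e v) (edges H)

SkelDegenerate : ∀ {k n} → Hypergraph k n → ℕ → Set
SkelDegenerate {n = n} H d =
  (S : Subset n) → Nonempty S → ∃ λ v → v ∈ S × ∣ S ∩ skelNbhd H v ∣ ≤ d

SkelDegeneracy≡ : ∀ {k n} → Hypergraph k n → ℕ → Set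
SkelDegeneracy≡ H d = SkelDegenerate H d × (∀ d' → d' < d → ¬ SkelDegenerate H d')

image : ∀ {n N} → (Fin n → Fin N) → Subset n → Subset N
image f e = tabulate λ j → anyFin (λ i → lookup e i ∧ ⌊ f i ≟ᶠ j ⌋)

Colouring : ℕ → ℕ → ℕ → Set
Colouring k q N = (s : Subset N) → ∣ s ∣ ≡ k → Fin q

MonoCopy : ∀ {k n q N} → Hypergraph k n → Colouring k q N → Set
MonoCopy {k} {n} {q} {N} H c =
  Σ (Fin n → Fin N) λ f → Injective _≡_ _≡_ f × Σ (Fin q) λ i →
    All (λ e → (p : ∣ image f e ∣ ≡ k) → c (image f e) p ≡ i) (edges H)

Arrows : ∀ {k n} → ℕ → Hypergraph k n → ℕ → Set
Arrows {k} N H q = (c : Colouring k q N) → MonoCopy H c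

-- r(H;q) ≤ M  (r is the least positive N with K_N^(k) → (H)_q)
RamseyLE : ∀ {k n} → Hypergraph k n → ℕ → ℕ → Set
RamseyLE H q M = ∃ λ N → 1 ≤ N × N ≤ M × Arrows N H q

{-# OPTIONS --safe #-}

-- Lee's random greedy embedding, in the form adapted to hypergraphs by way of skeletal degeneracy.
--
-- Order the vertices of H by degeneracy, colour its skeleton properly with r = k + d colours, and let N = O(n). By
-- Ramsey's theorem a positive proportion of all tuples T = (T₁, …, T_r) of p-tuples of vertices of K_N are monochromatic
-- cliques, of one and the same colour for a suitable choice of T. Each vertex v of H of colour i is to be sent to a
-- vertex y that keeps all edges at v, completed by entries of T, monochromatic. How many such y there are depends on the
-- images Q of the at most d earlier neighbours of v; call that number D(Q). Before v is embedded, the same condition on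
-- the edges at v says exactly that all p entries of T_i are admissible as y, while D(Q) does not depend on T_i. So
-- averaging over T_i bounds the p-th moment of N / D(Q) over uniformly random Q by a constant.
--
-- Now embed the vertices in order, each one uniformly at random among the choices left. The earlier neighbours of v are
-- not uniformly distributed, but the density of their distribution is a product of at most d factors O((N / D)^3), the
-- cube being the price of the regions below. Weighing this density against (N / D)^s with s = p / 2 ≥ 3 d gives an
-- inequality X ≤ X / 2 + const for the largest of the s-th moments of N / D along the process, so these are bounded
-- too, and some run has ∑ (N / D)^s = O(n).
--
-- To make the embedding injective, split the vertices of K_N beforehand into regions such that the j-th one meets every
-- candidate set in at least a 4^-(j+1) fraction, and embed a vertex with N / D ≈ 2^j into region j. As only
-- O(n / 2^(js)) vertices use region j in this run, at least half of the choices are always free.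

module Submission where

open import Defs
open import Data.Bool using (Bool; true; false; _∧_; _∨_; if_then_else_; not)
open import Data.Bool.Properties using (∧-assoc; ∧-identityʳ)
open import Data.Empty using (⊥; ⊥-elim)
open import Data.Fin using (Fin; zero; suc)
import Data.Fin.Properties as Fin
open import Data.Fin.Properties using (_≟_)
open import Data.Fin.Subset using (Subset; ∣_∣; _∩_)
open import Data.List using (List; []; _∷_; length; map; concatMap; allFin; upTo; filterᵇ) renaming (_++_ to _++ᴸ_)
open import Data.List.Properties using (length-tabulate; map-tabulate; length-++; length-map)
open import Data.List.Membership.Propositional using (_∈_)
open import Data.List.Membership.Propositional.Properties using (∈-map⁺; ∈-concatMap⁺; ∈-allFin; ∈-++⁺ˡ; ∈-++⁺ʳ; ∈-upTo⁺)
import Data.List.Relation.Unary.All as ListAll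
import Data.List.Relation.Unary.Any as Any
open import Data.List.Relation.Unary.Any using (here; there)
open import Data.Maybe using (Maybe; just; nothing; fromMaybe; is-just)
import Data.Maybe as Maybe
import Data.Maybe.Properties as Maybe
open import Data.Nat hiding (_≟_)
open import Data.Nat.Properties hiding (_≟_)
open import Data.Nat.DivMod using (_/_; _%_; m≡m%n+[m/n]*n; m%n<n; m*[n/m]≡n)
open import Data.Nat.Divisibility using (∣-trans; m∣m*n; m≤n⇒m!∣n!)
open import Data.Nat.Tactic.RingSolver using (solve-∀)
open import Data.Product using (∃; ∃₂; Σ; _×_; _,_; proj₁; proj₂)
open import Data.Sum using (_⊎_; inj₁; inj₂)
open import Data.Unit using (⊤; tt)
open import Data.Vec using (Vec; []; _∷_; lookup; _[_]≔_; tabulate; replicate; zipWith)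
import Data.Vec as Vec
import Data.Vec.Properties as Vec
open import Data.Vec.Relation.Unary.All using (All; []; _∷_)
open import Relation.Binary.Definitions using (tri<; tri≈; tri>)
open import Relation.Binary.PropositionalEquality
open import Relation.Nullary using (¬_; Dec; yes; no)
open import Relation.Nullary.Decidable using (⌊_⌋)

-- Finite sums as expectations over uniform tuples; subsequences.

module Sums where

  private variable
    A B : Set
    n m k : ℕ

  ^-distribʳ-* : ∀ a b n → (a * b) ^ n ≡ a ^ n * b ^ n
  ^-distribʳ-* a b zero    = refl
  ^-distribʳ-* a b (suc n) rewrite ^-distribʳ-* a b n = lemma a b (a ^ n) (b ^ n)
    where
    lemma : ∀ a b c d → a * b * (c * d) ≡ a * c * (b * d)
    lemma = solve-∀

  ∑ : List A → (A → ℕ) → ℕ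
  ∑ []       f = 0
  ∑ (x ∷ xs) f = f x + ∑ xs f

  ⟦_⟧ : Bool → ℕ
  ⟦ b ⟧ = if b then 1 else 0

  ∑-mono : ∀ (xs : List A) {f g : A → ℕ} → (∀ x → f x ≤ g x) → ∑ xs f ≤ ∑ xs g
  ∑-mono []       h = z≤n
  ∑-mono (x ∷ xs) h = +-mono-≤ (h x) (∑-mono xs h)

  ∑-cong : ∀ (xs : List A) {f g : A → ℕ} → (∀ x → f x ≡ g x) → ∑ xs f ≡ ∑ xs g
  ∑-cong []       h = refl
  ∑-cong (x ∷ xs) h = cong₂ _+_ (h x) (∑-cong xs h)

  ∑-+ : ∀ (xs : List A) (f g : A → ℕ) → ∑ xs (λ x → f x + g x) ≡ ∑ xs f + ∑ xs g
  ∑-+ []       f g = refl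
  ∑-+ (x ∷ xs) f g rewrite ∑-+ xs f g = lemma (f x) (g x) (∑ xs f) (∑ xs g)
    where
    lemma : ∀ a b c d → (a + b) + (c + d) ≡ (a + c) + (b + d)
    lemma = solve-∀

  ∑-*ˡ : ∀ (xs : List A) (c : ℕ) (f : A → ℕ) → ∑ xs (λ x → c * f x) ≡ c * ∑ xs f
  ∑-*ˡ []       c f = sym (*-zeroʳ c)
  ∑-*ˡ (x ∷ xs) c f rewrite ∑-*ˡ xs c f = sym (*-distribˡ-+ c (f x) (∑ xs f))

  ∑-*ʳ : ∀ (xs : List A) (c : ℕ) (f : A → ℕ) → ∑ xs (λ x → f x * c) ≡ ∑ xs f * c
  ∑-*ʳ xs c f = trans (∑-cong xs (λ x → *-comm (f x) c)) (trans (∑-*ˡ xs c f) (*-comm c (∑ xs f)))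

  ∑-const : ∀ (xs : List A) (c : ℕ) → ∑ xs (λ _ → c) ≡ length xs * c
  ∑-const []       c = refl
  ∑-const (x ∷ xs) c = cong (c +_) (∑-const xs c)

  ∑-zero : ∀ (xs : List A) → ∑ xs (λ _ → 0) ≡ 0
  ∑-zero xs = trans (∑-const xs 0) (*-zeroʳ (length xs))

  ∑-swap : ∀ (xs : List A) (ys : List B) (f : A → B → ℕ) →
    ∑ xs (λ x → ∑ ys (f x)) ≡ ∑ ys (λ y → ∑ xs (λ x → f x y))
  ∑-swap []       ys f = sym (∑-zero ys)
  ∑-swap (x ∷ xs) ys f rewrite ∑-swap xs ys f = sym (∑-+ ys (f x) (λ y → ∑ xs (λ x → f x y)))

  ∑-++ : ∀ (xs ys : List A) (f : A → ℕ) → ∑ (xs ++ᴸ ys) f ≡ ∑ xs f + ∑ ys f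
  ∑-++ []       ys f = refl
  ∑-++ (x ∷ xs) ys f rewrite ∑-++ xs ys f = sym (+-assoc (f x) _ _)

  ∑-map : ∀ (g : A → B) (xs : List A) (f : B → ℕ) → ∑ (map g xs) f ≡ ∑ xs (λ x → f (g x))
  ∑-map g []       f = refl
  ∑-map g (x ∷ xs) f = cong (f (g x) +_) (∑-map g xs f)

  ∑-concatMap : ∀ (g : A → List B) (xs : List A) (f : B → ℕ) →
    ∑ (concatMap g xs) f ≡ ∑ xs (λ x → ∑ (g x) f)
  ∑-concatMap g []       f = refl
  ∑-concatMap g (x ∷ xs) f = trans (∑-++ (g x) (concatMap g xs) f) (cong (∑ (g x) f +_) (∑-concatMap g xs f))

  ∑-< : ∀ (xs : List A) {f g : A → ℕ} → ∑ xs f < ∑ xs g → ∃ λ x → f x < g x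
  ∑-< [] ()
  ∑-< (x ∷ xs) {f} {g} lt with <-≤-connex (f x) (g x)
  ... | inj₁ fx<gx = x , fx<gx
  ... | inj₂ gx≤fx = ∑-< xs (+-cancelˡ-< (f x) _ _ (<-≤-trans lt (+-monoˡ-≤ (∑ xs g) gx≤fx)))

  term≤∑ : ∀ {xs : List A} {x} (f : A → ℕ) → x ∈ xs → f x ≤ ∑ xs f
  term≤∑ f (here refl) = m≤m+n _ _
  term≤∑ f (there x∈)  = ≤-trans (term≤∑ f x∈) (m≤n+m _ _)

  length-∑ : ∀ (xs : List A) → length xs ≡ ∑ xs (λ _ → 1)
  length-∑ xs = sym (trans (∑-const xs 1) (*-identityʳ _))

  -- Expectations over a uniformly random tuple are handled as sums over this list, with the
  -- denominator `length xs ^ n` multiplied out.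
  vecs : List A → ∀ n → List (Vec A n)
  vecs xs zero    = [] ∷ []
  vecs xs (suc n) = concatMap (λ h → map (_∷ h) xs) (vecs xs n)

  ∑-vecs-suc : ∀ (xs : List A) n (F : Vec A (suc n) → ℕ) →
    ∑ (vecs xs (suc n)) F ≡ ∑ (vecs xs n) (λ h → ∑ xs (λ y → F (y ∷ h)))
  ∑-vecs-suc xs n F = trans (∑-concatMap _ (vecs xs n) F) (∑-cong (vecs xs n) (λ h → ∑-map (_∷ h) xs F))

  length-vecs : ∀ (xs : List A) n → length (vecs xs n) ≡ length xs ^ n
  length-vecs xs zero    = refl
  length-vecs xs (suc n) = begin
    length (vecs xs (suc n))                      ≡⟨ length-∑ (vecs xs (suc n)) ⟩
    ∑ (vecs xs (suc n)) (λ _ → 1)                 ≡⟨ ∑-vecs-suc xs n _ ⟩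
    ∑ (vecs xs n) (λ _ → ∑ xs (λ _ → 1))          ≡⟨ ∑-const (vecs xs n) _ ⟩
    length (vecs xs n) * ∑ xs (λ _ → 1)           ≡⟨ cong₂ _*_ (length-vecs xs n) (sym (length-∑ xs)) ⟩
    length xs ^ n * length xs                     ≡⟨ *-comm (length xs ^ n) (length xs) ⟩
    length xs ^ suc n ∎
    where open ≡-Reasoning

  ∈-vecs : ∀ {xs : List A} → (∀ x → x ∈ xs) → (v : Vec A n) → v ∈ vecs xs n
  ∈-vecs all []      = here refl
  ∈-vecs all (x ∷ v) = ∈-concatMap⁺ _ (Any.map (λ { refl → ∈-map⁺ (_∷ v) (all x) }) (∈-vecs all v))

  allVec : (A → Bool) → Vec A n → Bool
  allVec f []      = true
  allVec f (x ∷ v) = f x ∧ allVec f v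

  ⟦∧⟧ : ∀ a b → ⟦ a ∧ b ⟧ ≡ ⟦ a ⟧ * ⟦ b ⟧
  ⟦∧⟧ false b = refl
  ⟦∧⟧ true  b = sym (*-identityˡ ⟦ b ⟧)

  ⟦⟧≤1 : ∀ b → ⟦ b ⟧ ≤ 1
  ⟦⟧≤1 false = z≤n
  ⟦⟧≤1 true  = ≤-refl

  -- Independence of the entries of a random tuple. This is what produces the p-th powers of
  -- candidate degrees.
  ∑-allVec : ∀ (xs : List A) (f : A → Bool) n →
    ∑ (vecs xs n) (λ v → ⟦ allVec f v ⟧) ≡ ∑ xs (λ x → ⟦ f x ⟧) ^ n
  ∑-allVec xs f zero    = refl
  ∑-allVec xs f (suc n) = begin
    ∑ (vecs xs (suc n)) (λ v → ⟦ allVec f v ⟧)                       ≡⟨ ∑-vecs-suc xs n _ ⟩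
    ∑ (vecs xs n) (λ h → ∑ xs (λ y → ⟦ f y ∧ allVec f h ⟧))
      ≡⟨ ∑-cong (vecs xs n) (λ h → trans (∑-cong xs (λ y → ⟦∧⟧ (f y) _)) (∑-*ʳ xs _ _)) ⟩
    ∑ (vecs xs n) (λ h → ∑ xs (λ y → ⟦ f y ⟧) * ⟦ allVec f h ⟧)      ≡⟨ ∑-*ˡ (vecs xs n) (∑ xs (λ y → ⟦ f y ⟧)) _ ⟩
    ∑ xs (λ y → ⟦ f y ⟧) * ∑ (vecs xs n) (λ h → ⟦ allVec f h ⟧)      ≡⟨ cong (∑ xs (λ y → ⟦ f y ⟧) *_) (∑-allVec xs f n) ⟩
    ∑ xs (λ x → ⟦ f x ⟧) ^ suc n ∎
    where open ≡-Reasoning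

  -- Resampling one coordinate keeps a uniform tuple uniform: on the right every tuple arises
  -- `length xs` times.
  ∑-update : ∀ (xs : List A) n (i : Fin n) (F : Vec A n → ℕ) →
    length xs * ∑ (vecs xs n) F ≡ ∑ (vecs xs n) (λ T → ∑ xs (λ c → F (T [ i ]≔ c)))
  ∑-update xs (suc n) zero F = begin
    length xs * ∑ (vecs xs (suc n)) F                              ≡⟨ cong (length xs *_) (∑-vecs-suc xs n F) ⟩
    length xs * ∑ (vecs xs n) (λ h → ∑ xs (λ c → F (c ∷ h)))       ≡⟨ ∑-*ˡ (vecs xs n) (length xs) _ ⟨
    ∑ (vecs xs n) (λ h → length xs * ∑ xs (λ c → F (c ∷ h)))       ≡⟨ ∑-cong (vecs xs n) (λ h → ∑-const xs _) ⟨
    ∑ (vecs xs n) (λ h → ∑ xs (λ _ → ∑ xs (λ c → F (c ∷ h))))      ≡⟨ ∑-vecs-suc xs n _ ⟨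
    ∑ (vecs xs (suc n)) (λ T → ∑ xs (λ c → F (T [ zero ]≔ c))) ∎
    where open ≡-Reasoning
  ∑-update xs (suc n) (suc i) F = begin
    length xs * ∑ (vecs xs (suc n)) F                              ≡⟨ cong (length xs *_) (∑-vecs-suc xs n F) ⟩
    length xs * ∑ (vecs xs n) (λ h → ∑ xs (λ y → F (y ∷ h)))       ≡⟨ ∑-update xs n i _ ⟩
    ∑ (vecs xs n) (λ h → ∑ xs (λ c → ∑ xs (λ y → F (y ∷ h [ i ]≔ c))))
      ≡⟨ ∑-cong (vecs xs n) (λ h → ∑-swap xs xs _) ⟩
    ∑ (vecs xs n) (λ h → ∑ xs (λ y → ∑ xs (λ c → F (y ∷ h [ i ]≔ c)))) ≡⟨ ∑-vecs-suc xs n _ ⟨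
    ∑ (vecs xs (suc n)) (λ T → ∑ xs (λ c → F (T [ suc i ]≔ c))) ∎
    where open ≡-Reasoning

  cut : ∀ p {m} → Vec A (p + m) → Vec A p × Vec A m
  cut zero    x       = [] , x
  cut (suc p) (y ∷ x) = y ∷ proj₁ (cut p x) , proj₂ (cut p x)

  chunks : ∀ r p → Vec A (r * p) → Vec (Vec A p) r
  chunks zero    p x = []
  chunks (suc r) p x = proj₁ (cut p x) ∷ chunks r p (proj₂ (cut p x))

  ∑-cut : ∀ (xs : List A) p {m} (F : Vec A p → Vec A m → ℕ) →
    ∑ (vecs xs (p + m)) (λ x → F (proj₁ (cut p x)) (proj₂ (cut p x))) ≡
    ∑ (vecs xs m) (λ h → ∑ (vecs xs p) (λ c → F c h))
  ∑-cut xs zero    {m} F = ∑-cong (vecs xs m) (λ h → sym (+-identityʳ _))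
  ∑-cut xs (suc p) {m} F = begin
    ∑ (vecs xs (suc p + m)) (λ x → F (proj₁ (cut (suc p) x)) (proj₂ (cut (suc p) x))) ≡⟨ ∑-vecs-suc xs (p + m) _ ⟩
    ∑ (vecs xs (p + m)) (λ x → ∑ xs (λ y → F (y ∷ proj₁ (cut p x)) (proj₂ (cut p x))))
      ≡⟨ ∑-cut xs p (λ c h → ∑ xs (λ y → F (y ∷ c) h)) ⟩
    ∑ (vecs xs m) (λ h → ∑ (vecs xs p) (λ c → ∑ xs (λ y → F (y ∷ c) h)))
      ≡⟨ ∑-cong (vecs xs m) (λ h → ∑-vecs-suc xs p (λ c → F c h)) ⟨
    ∑ (vecs xs m) (λ h → ∑ (vecs xs (suc p)) (λ c → F c h)) ∎
    where open ≡-Reasoning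

  -- Cutting is a bijection from tuples of length `r * p` onto `r`-tuples of blocks of length `p`.
  ∑-chunks : ∀ (xs : List A) r p (F : Vec (Vec A p) r → ℕ) →
    ∑ (vecs xs (r * p)) (λ x → F (chunks r p x)) ≡ ∑ (vecs (vecs xs p) r) F
  ∑-chunks xs zero    p F = refl
  ∑-chunks xs (suc r) p F = begin
    ∑ (vecs xs (p + r * p)) (λ x → F (chunks (suc r) p x))
      ≡⟨ ∑-cut xs p (λ c h → F (c ∷ chunks r p h)) ⟩
    ∑ (vecs xs (r * p)) (λ h → ∑ (vecs xs p) (λ c → F (c ∷ chunks r p h)))
      ≡⟨ ∑-chunks xs r p (λ T → ∑ (vecs xs p) (λ c → F (c ∷ T))) ⟩
    ∑ (vecs (vecs xs p) r) (λ T → ∑ (vecs xs p) (λ c → F (c ∷ T)))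
      ≡⟨ ∑-vecs-suc (vecs xs p) r F ⟨
    ∑ (vecs (vecs xs p) (suc r)) F ∎
    where open ≡-Reasoning

  -- An `m`-element set of positions among `n`, as an inductive family so that taking subsequences
  -- and composing selections are structural recursions.
  data Sel : ℕ → ℕ → Set where
    done : Sel 0 0
    keep : ∀ {n m} → Sel n m → Sel (suc n) (suc m)
    drop : ∀ {n m} → Sel n m → Sel (suc n) m

  select : Sel n m → Vec A n → Vec A m
  select done     []      = []
  select (keep σ) (x ∷ v) = x ∷ select σ v
  select (drop σ) (x ∷ v) = select σ v

  _∙_ : Sel m k → Sel n m → Sel n k
  done   ∙ done   = done
  keep τ ∙ keep σ = keep (τ ∙ σ)
  drop τ ∙ keep σ = drop (τ ∙ σ)
  τ      ∙ drop σ = drop (τ ∙ σ)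

  select-∙ : (τ : Sel m k) (σ : Sel n m) (v : Vec A n) → select (τ ∙ σ) v ≡ select τ (select σ v)
  select-∙ done     done     []      = refl
  select-∙ (keep τ) (keep σ) (x ∷ v) = cong (x ∷_) (select-∙ τ σ v)
  select-∙ (drop τ) (keep σ) (x ∷ v) = select-∙ τ σ v
  select-∙ done     (drop σ) (x ∷ v) = select-∙ done σ v
  select-∙ (keep τ) (drop σ) (x ∷ v) = select-∙ (keep τ) σ v
  select-∙ (drop τ) (drop σ) (x ∷ v) = select-∙ (drop τ) σ v

  idSel : ∀ n → Sel n n
  idSel zero    = done
  idSel (suc n) = keep (idSel n)

  noneSel : ∀ n → Sel n 0
  noneSel zero    = done
  noneSel (suc n) = drop (noneSel n)

  select-map : {f : A → B} (σ : Sel n m) (v : Vec A n) → select σ (Vec.map f v) ≡ Vec.map f (select σ v)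
  select-map done     []      = refl
  select-map (keep σ) (x ∷ v) = cong (_ ∷_) (select-map σ v)
  select-map (drop σ) (x ∷ v) = select-map σ v

  -- The marginal of a uniform tuple on selected positions is uniform; the denominators are
  -- cross-multiplied.
  ∑-select : ∀ (xs : List A) (σ : Sel n m) (F : Vec A m → ℕ) →
    length xs ^ m * ∑ (vecs xs n) (λ z → F (select σ z)) ≡ length xs ^ n * ∑ (vecs xs m) F
  ∑-select xs done F = refl
  ∑-select {n = suc n} {m = suc m} xs (keep σ) F = begin
    N ^ suc m * ∑ (vecs xs (suc n)) (λ z → F (select (keep σ) z))     ≡⟨ cong (N ^ suc m *_) (∑-vecs-suc xs n _) ⟩
    N * N ^ m * ∑ (vecs xs n) (λ h → G (select σ h))                  ≡⟨ *-assoc N (N ^ m) _ ⟩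
    N * (N ^ m * ∑ (vecs xs n) (λ h → G (select σ h)))                ≡⟨ cong (N *_) (∑-select xs σ G) ⟩
    N * (N ^ n * ∑ (vecs xs m) G)                                     ≡⟨ *-assoc N (N ^ n) _ ⟨
    N ^ suc n * ∑ (vecs xs m) G                                       ≡⟨ cong (N ^ suc n *_) (∑-vecs-suc xs m F) ⟨
    N ^ suc n * ∑ (vecs xs (suc m)) F ∎
    where
    open ≡-Reasoning
    N : ℕ
    N = length xs
    G : Vec _ m → ℕ
    G h = ∑ xs (λ y → F (y ∷ h))
  ∑-select {n = suc n} {m = m} xs (drop σ) F = begin
    N ^ m * ∑ (vecs xs (suc n)) (λ z → F (select (drop σ) z))         ≡⟨ cong (N ^ m *_) (∑-vecs-suc xs n _) ⟩
    N ^ m * ∑ (vecs xs n) (λ h → ∑ xs (λ _ → F (select σ h)))         ≡⟨ cong (N ^ m *_) (trans (∑-cong (vecs xs n) (λ h → ∑-const xs _)) (∑-*ˡ (vecs xs n) N _)) ⟩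
    N ^ m * (N * ∑ (vecs xs n) (λ h → F (select σ h)))                ≡⟨ swap (N ^ m) N _ ⟩
    N * (N ^ m * ∑ (vecs xs n) (λ h → F (select σ h)))                ≡⟨ cong (N *_) (∑-select xs σ F) ⟩
    N * (N ^ n * ∑ (vecs xs m) F)                                     ≡⟨ *-assoc N (N ^ n) _ ⟨
    N ^ suc n * ∑ (vecs xs m) F ∎
    where
    open ≡-Reasoning
    N : ℕ
    N = length xs
    swap : ∀ a b c → a * (b * c) ≡ b * (a * c)
    swap = solve-∀

  allSel : ∀ n m → List (Sel n m)
  allSel zero    zero    = done ∷ []
  allSel zero    (suc m) = []
  allSel (suc n) zero    = map drop (allSel n zero)
  allSel (suc n) (suc m) = map keep (allSel n m) ++ᴸ map drop (allSel n (suc m))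

  ∈-allSel : (σ : Sel n m) → σ ∈ allSel n m
  ∈-allSel done                   = here refl
  ∈-allSel (keep σ)               = ∈-++⁺ˡ (∈-map⁺ keep (∈-allSel σ))
  ∈-allSel {m = zero}  (drop σ)   = ∈-map⁺ drop (∈-allSel σ)
  ∈-allSel {m = suc m} (drop σ)   = ∈-++⁺ʳ _ (∈-map⁺ drop (∈-allSel σ))

open Sums

-- Ramsey's theorem for colourings of tuples.

module Ramsey where

  private variable
    A : Set
    n m k q r p : ℕ

  select-none : (v : Vec A n) → select (noneSel n) v ≡ []
  select-none []      = refl
  select-none (x ∷ v) = select-none v

  -- Each entry uses up one of `a` places for the colour zero or one of `b` places for the other
  -- colours, so one kind is complete after `a + b` entries at the latest.
  splitZero : ∀ a b {n} → n ≡ a + b → (cs : Vec (Fin (suc q)) n) →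
    (∃ λ (σ : Sel n a) → select σ cs ≡ replicate a zero) ⊎
    (∃₂ λ (σ : Sel n b) cs' → select σ cs ≡ Vec.map suc cs')
  splitZero zero    b       eq cs = inj₁ (noneSel _ , select-none cs)
  splitZero (suc a) zero    eq cs = inj₂ (noneSel _ , [] , select-none cs)
  splitZero (suc a) (suc b) eq (zero ∷ cs) with splitZero a (suc b) (suc-injective eq) cs
  ... | inj₁ (σ , e)       = inj₁ (keep σ , cong (zero ∷_) e)
  ... | inj₂ (σ , cs' , e) = inj₂ (drop σ , cs' , e)
  splitZero (suc a) (suc b) eq (suc c ∷ cs)
    with splitZero (suc a) b (suc-injective (trans eq (+-suc (suc a) b))) cs
  ... | inj₁ (σ , e)       = inj₁ (drop σ , e)
  ... | inj₂ (σ , cs' , e) = inj₂ (keep σ , c ∷ cs' , cong (suc c ∷_) e)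

  pigeonhole : ∀ q m → ∃ λ M → (cs : Vec (Fin q) M) →
    ∃₂ λ (σ : Sel M m) c → select σ cs ≡ replicate m c
  -- With no colours, length 1 makes the claim vacuous; length 0 would not.
  pigeonhole zero    m = 1 , λ { (() ∷ _) }
  pigeonhole (suc q) m = m + M , found
    where
    M : ℕ
    M = proj₁ (pigeonhole q m)
    found : (cs : Vec (Fin (suc q)) (m + M)) → ∃₂ λ (σ : Sel (m + M) m) c → select σ cs ≡ replicate m c
    found cs with splitZero m M refl cs
    ... | inj₁ (σ , e) = σ , zero , e
    ... | inj₂ (σ , cs' , e) with proj₂ (pigeonhole q m) cs'
    ...   | τ , c , e' = τ ∙ σ , suc c , (begin
      select (τ ∙ σ) cs              ≡⟨ select-∙ τ σ cs ⟩
      select τ (select σ cs)         ≡⟨ cong (select τ) e ⟩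
      select τ (Vec.map suc cs')     ≡⟨ select-map τ cs' ⟩
      Vec.map suc (select τ cs')     ≡⟨ cong (Vec.map suc) e' ⟩
      Vec.map suc (replicate m c)    ≡⟨ Vec.map-replicate suc c m ⟩
      replicate m (suc c) ∎)
      where
      open ≡-Reasoning

  -- Sequences are coloured instead of sets, and entries may repeat, so that the notion applies to
  -- every tuple drawn at random.
  Mono : (Vec A k → Fin q) → Fin q → Vec A m → Set
  Mono {k = k} {m = m} C c z = (σ : Sel m k) → C (select σ z) ≡ c

  Mono-select : {C : Vec A k → Fin q} {c : Fin q} (σ : Sel n m) {z : Vec A n} → Mono C c z → Mono C c (select σ z)
  Mono-select {C = C} σ {z} mono τ = trans (cong C (sym (select-∙ τ σ z))) (mono (τ ∙ σ))

  -- The colour of a (k+1)-subsequence depends only on its first entry, the i-th colour being that of the i-th entry.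
  data EndHomogeneous (C : Vec A (suc k) → Fin q) : ∀ {m} → Vec A m → Vec (Fin q) m → Set where
    []  : EndHomogeneous C [] []
    _∷_ : ∀ {m a c} {T : Vec A m} {cs} → Mono (λ v → C (a ∷ v)) c T →
          EndHomogeneous C T cs → EndHomogeneous C (a ∷ T) (c ∷ cs)

  EndHomogeneous-select : {C : Vec A (suc k) → Fin q} (σ : Sel n m) {T : Vec A n} {cs : Vec (Fin q) n} →
    EndHomogeneous C T cs → EndHomogeneous C (select σ T) (select σ cs)
  EndHomogeneous-select done     []       = []
  EndHomogeneous-select {C = C} (keep σ) (_∷_ {a = a} h hs) =
    Mono-select {C = λ v → C (a ∷ v)} σ h ∷ EndHomogeneous-select σ hs
  EndHomogeneous-select (drop σ) (h ∷ hs) = EndHomogeneous-select σ hs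

  EndHomogeneous-mono : {C : Vec A (suc k) → Fin q} {T : Vec A m} (c : Fin q) →
    EndHomogeneous C T (replicate m c) → Mono C c T
  EndHomogeneous-mono c (h ∷ hs) (keep σ) = h σ
  EndHomogeneous-mono c (h ∷ hs) (drop σ) = EndHomogeneous-mono c hs σ

  -- `R` is fixed before the type `A`, so a single length serves for all sizes of the vertex set.
  RamseyFor : ℕ → ℕ → ℕ → ℕ → Set₁
  RamseyFor k q m R = ∀ {A : Set} (C : Vec A k → Fin q) (z : Vec A R) →
    ∃₂ λ (σ : Sel R m) c → Mono C c (select σ z)

  -- The Erdős-Rado step: keep the first entry, use Ramsey's theorem for `k` to make the colour of
  -- all tuples beginning with it constant on a long subsequence of the rest, and continue inside
  -- that subsequence.
  endHomogeneous : ∀ k q → (∀ m → ∃ λ R → RamseyFor k q m R) → ∀ M → ∃ λ R →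
    ∀ {A : Set} (C : Vec A (suc k) → Fin q) (z : Vec A R) →
    ∃₂ λ (σ : Sel R M) cs → EndHomogeneous C (select σ z) cs
  endHomogeneous k q ramsey zero    = 0 , λ { C [] → done , [] , [] }
  endHomogeneous k q ramsey (suc M) = suc R , step
    where
    R' : ℕ
    R' = proj₁ (endHomogeneous k q ramsey M)
    R : ℕ
    R = proj₁ (ramsey R')
    step : ∀ {A : Set} (C : Vec A (suc k) → Fin q) (z : Vec A (suc R)) →
      ∃₂ λ (σ : Sel (suc R) (suc M)) cs → EndHomogeneous C (select σ z) cs
    step C (a ∷ z) with proj₂ (ramsey R') (λ v → C (a ∷ v)) z
    ... | σ , c , mono with proj₂ (endHomogeneous k q ramsey M) C (select σ z)
    ...   | τ , cs , hom = keep (τ ∙ σ) , c ∷ cs ,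
      subst (λ T → EndHomogeneous C (a ∷ T) (c ∷ cs)) (sym (select-∙ τ σ z))
        (Mono-select {C = λ v → C (a ∷ v)} τ mono ∷ hom)

  -- Induction on the uniformity: in an end-homogeneous subsequence, the pigeonhole principle makes
  -- the colours attached to the first entries agree.
  ramsey : ∀ k q m → ∃ λ R → RamseyFor k q m R
  ramsey zero q m = m , λ C z → idSel m , C [] , λ σ → cong C (empty (select σ (select (idSel m) z)))
    where
    empty : (v : Vec A 0) → v ≡ []
    empty [] = refl
  ramsey (suc k) q m = R , found
    where
    M : ℕ
    M = proj₁ (pigeonhole q m)
    R : ℕ
    R = proj₁ (endHomogeneous k q (ramsey k q) M)
    found : RamseyFor (suc k) q m R
    found C z with proj₂ (endHomogeneous k q (ramsey k q) M) C z
    ... | σ , cs , hom with proj₂ (pigeonhole q m) cs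
    ...   | τ , c , e = τ ∙ σ , c ,
      subst (Mono C c) (sym (select-∙ τ σ z))
        (EndHomogeneous-mono c (subst (EndHomogeneous C _) e (EndHomogeneous-select τ hom)))

  transversal : Vec (Vec A p) r → Vec (Fin p) r → Vec A r
  transversal = zipWith lookup

  -- The blocks follow one another in `x`, so one entry from each forms a subsequence. Hence
  -- transversals of a monochromatic tuple are monochromatic.
  transversal-Sel : ∀ r p (x : Vec A (r * p)) (τ : Vec (Fin p) r) →
    ∃ λ (σ : Sel (r * p) r) → select σ x ≡ transversal (chunks r p x) τ
  transversal-Sel zero    p [] [] = done , refl
  transversal-Sel (suc r) p x  (a ∷ τ) with transversal-Sel r p (proj₂ (cut p x)) τ
  ... | σ , e = pick p a σ , trans (select-pick p a σ x) (cong (_ ∷_) e)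
    where
    skip : ∀ p → Sel n m → Sel (p + n) m
    skip zero    σ = σ
    skip (suc p) σ = drop (skip p σ)
    select-skip : ∀ p (σ : Sel n m) (x : Vec A (p + n)) → select (skip p σ) x ≡ select σ (proj₂ (cut p x))
    select-skip zero    σ x       = refl
    select-skip (suc p) σ (y ∷ x) = select-skip p σ x
    pick : ∀ p → Fin p → Sel n m → Sel (p + n) (suc m)
    pick (suc p) zero    σ = keep (skip p σ)
    pick (suc p) (suc a) σ = drop (pick p a σ)
    select-pick : ∀ p a (σ : Sel n m) (x : Vec A (p + n)) →
      select (pick p a σ) x ≡ lookup (proj₁ (cut p x)) a ∷ select σ (proj₂ (cut p x))
    select-pick (suc p) zero    σ (y ∷ x) = cong (y ∷_) (select-skip p σ x)
    select-pick (suc p) (suc a) σ (y ∷ x) = select-pick p a σ x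

  Mono-transversal : {C : Vec A k → Fin q} {c : Fin q} {x : Vec A (r * p)} → Mono C c x →
    ∀ τ → Mono C c (transversal (chunks r p x) τ)
  Mono-transversal {r = r} {p = p} {C = C} {c} {x} mono τ with transversal-Sel r p x τ
  ... | σ , e = subst (Mono C c) e (Mono-select {C = C} σ mono)

open Ramsey

-- Dependent random choice of the tuple T.

module RandomChoice where

  private variable
    A : Set
    n m k q r p : ℕ

  allOf : List A → (A → Bool) → Bool
  allOf []       f = true
  allOf (x ∷ xs) f = f x ∧ allOf xs f

  allOf-∈ : ∀ {xs : List A} {f x} → allOf xs f ≡ true → x ∈ xs → f x ≡ true
  allOf-∈ {xs = x ∷ xs} {f} e x∈ with f x in eq
  allOf-∈ e (here refl) | true = eq
  allOf-∈ e (there x∈)  | true = allOf-∈ e x∈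

  allOf-intro : ∀ (xs : List A) {f} → (∀ {x} → x ∈ xs → f x ≡ true) → allOf xs f ≡ true
  allOf-intro []       h = refl
  allOf-intro (x ∷ xs) h rewrite h (here refl) = allOf-intro xs (λ x∈ → h (there x∈))

  allOf-cong : ∀ (xs : List A) {f g} → (∀ x → f x ≡ g x) → allOf xs f ≡ allOf xs g
  allOf-cong []       h = refl
  allOf-cong (x ∷ xs) h = cong₂ _∧_ (h x) (allOf-cong xs h)

  allVec-cong : ∀ {f g : A → Bool} → (∀ x → f x ≡ g x) → (v : Vec A n) → allVec f v ≡ allVec g v
  allVec-cong h []      = refl
  allVec-cong h (x ∷ v) = cong₂ _∧_ (h x) (allVec-cong h v)

  allVec-lookup : ∀ {f : A → Bool} (v : Vec A n) → (∀ a → f (lookup v a) ≡ true) → allVec f v ≡ true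
  allVec-lookup []      h = refl
  allVec-lookup (x ∷ v) h rewrite h zero = allVec-lookup v (λ a → h (suc a))

  sublists : List A → List (List A)
  sublists []       = [] ∷ []
  sublists (x ∷ xs) = map (x ∷_) (sublists xs) ++ᴸ sublists xs

  filterᵇ∈sublists : ∀ (f : A → Bool) xs → filterᵇ f xs ∈ sublists xs
  filterᵇ∈sublists f []       = here refl
  filterᵇ∈sublists f (x ∷ xs) with f x
  ... | true  = ∈-++⁺ˡ (∈-map⁺ (x ∷_) (filterᵇ∈sublists f xs))
  ... | false = ∈-++⁺ʳ (map (x ∷_) (sublists xs)) (filterᵇ∈sublists f xs)

  -- The shape of the constraints on one vertex to be embedded into part `part`: it has `size` neighbours that are
  -- already embedded, and each link says which of them, if any, occupies which part in one common edge.
  record Pattern (r : ℕ) : Set where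
    constructor pat
    field
      size  : ℕ
      part  : Fin r
      links : List (Vec (Maybe (Fin size)) r)
  open Pattern public

  allLinks : ∀ r s → List (Vec (Maybe (Fin s)) r)
  allLinks r s = vecs (nothing ∷ map just (allFin s)) r

  ∈-allLinks : ∀ {s} (m : Vec (Maybe (Fin s)) r) → m ∈ allLinks r s
  ∈-allLinks = ∈-vecs λ { nothing → here refl ; (just i) → there (∈-map⁺ just (∈-allFin i)) }

  -- The length of this list depends on `r` and `d` alone, so a union bound over patterns costs only
  -- a constant.
  patterns : ∀ r d → List (Pattern r)
  patterns r d = concatMap (λ s → concatMap (λ i → map (pat s i) (sublists (allLinks r s))) (allFin r)) (upTo (suc d))

  ∈-patterns : ∀ {s d} → s ≤ d → (i : Fin r) (f : Vec (Maybe (Fin s)) r → Bool) →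
    pat s i (filterᵇ f (allLinks r s)) ∈ patterns r d
  ∈-patterns {r = r} {s} s≤d i f =
    ∈-concatMap⁺ _ (Any.map (λ { refl →
      ∈-concatMap⁺ _ (Any.map (λ { refl → ∈-map⁺ (pat s i) (filterᵇ∈sublists f (allLinks r s)) }) (∈-allFin i)) })
      (∈-upTo⁺ (s≤s s≤d)))

  fill : Vec (Maybe A) r → Vec A r → Vec A r
  fill = zipWith (λ mv x → fromMaybe x mv)

  fill-update : ∀ (m : Vec (Maybe A) r) x i (a y : A) → fill m (x [ i ]≔ a) [ i ]≔ y ≡ fill m x [ i ]≔ y
  fill-update (m ∷ ms) (x ∷ xs) zero    a y = refl
  fill-update (m ∷ ms) (x ∷ xs) (suc i) a y = cong (_ ∷_) (fill-update ms xs i a y)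

  transversal-update : ∀ (T : Vec (Vec A p) r) τ i c →
    transversal (T [ i ]≔ c) τ ≡ transversal T τ [ i ]≔ lookup c (lookup τ i)
  transversal-update (x ∷ T) (a ∷ τ) zero    c = refl
  transversal-update (x ∷ T) (a ∷ τ) (suc i) c = cong (_ ∷_) (transversal-update T τ i c)

  module Candidates {V : Set} (G : Vec V r → Bool) {p : ℕ} (T : Vec (Vec V p) r) (P : Pattern r) where

    -- Each link stands for an edge: embedded neighbours occupy their parts, the other parts run
    -- through all entries of `T`, and `y` is written over `part P`.
    candidate : Vec V (size P) → V → Bool
    candidate Q y = allOf (links P) λ m → allOf (vecs (allFin p) r) λ τ →
      G (fill (Vec.map (Maybe.map (lookup Q)) m) (transversal T τ) [ part P ]≔ y)

    live : Vec V (size P) → Bool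
    live Q = allVec (candidate Q) (lookup T (part P))

    degree : List V → Vec V (size P) → ℕ
    degree xs Q = ∑ xs (λ y → ⟦ candidate Q y ⟧)

  open Candidates

  -- The entry of `part P` is overwritten by `y` in every test, so that block of `T` has no
  -- influence.
  candidate-update : ∀ {V : Set} (G : Vec V r → Bool) (T : Vec (Vec V p) r) P Q c y →
    candidate G (T [ part P ]≔ c) P Q y ≡ candidate G T P Q y
  candidate-update {r = r} {p = p} G T P Q c y = allOf-cong (links P) λ m → allOf-cong (vecs (allFin p) r) λ τ →
    cong G (trans (cong (λ x → fill (Vec.map (Maybe.map (lookup Q)) m) x [ part P ]≔ y) (transversal-update T τ (part P) c))
                  (fill-update (Vec.map (Maybe.map (lookup Q)) m) (transversal T τ) (part P) _ y))

  ∑⟦⟧≤length : ∀ (xs : List A) (f : A → Bool) → ∑ xs (λ x → ⟦ f x ⟧) ≤ length xs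
  ∑⟦⟧≤length xs f = subst (∑ xs (λ x → ⟦ f x ⟧) ≤_) (sym (length-∑ xs)) (∑-mono xs (λ x → ⟦⟧≤1 (f x)))

  -- `w D` plays the role of N / D; the bound allows for rounding up by a factor 2.
  module _ {V : Set} (xs : List V) (N≥1 : 1 ≤ length xs)
           (w : ℕ → ℕ) (w-bound : ∀ D → D ≤ length xs → w D * D ≤ 2 * length xs) where

    private
      N : ℕ
      N = length xs

    -- The part-i block of T is live exactly when it lies in the candidate set, which does not depend on that block:
    -- averaging over the block turns liveness into the p-th power of the candidate degree.
    ∑-live : (G : Vec V r → Bool) (P : Pattern r) (Q : Vec V (size P)) →
      ∑ (vecs (vecs xs p) r) (λ T → ⟦ live G T P Q ⟧ * w (degree G T P xs Q) ^ p) ≤ 2 ^ p * N ^ (r * p)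
    ∑-live {r = r} {p = p} G P Q = *-cancelˡ-≤ (N ^ p) {{m^n≢0 N p {{>-nonZero N≥1}}}} (begin
      N ^ p * ∑ Ts F                                     ≡⟨ cong (_* ∑ Ts F) (length-vecs xs p) ⟨
      length (vecs xs p) * ∑ Ts F                        ≡⟨ ∑-update (vecs xs p) r (part P) F ⟩
      ∑ Ts (λ T → ∑ (vecs xs p) (λ c → F (T [ part P ]≔ c))) ≤⟨ ∑-mono Ts averaged ⟩
      ∑ Ts (λ T → 2 ^ p * N ^ p)                         ≡⟨ ∑-const Ts _ ⟩
      length Ts * (2 ^ p * N ^ p)                        ≡⟨ cong (_* (2 ^ p * N ^ p)) length-Ts ⟩
      N ^ (r * p) * (2 ^ p * N ^ p)                      ≡⟨ lemma (N ^ (r * p)) (2 ^ p) (N ^ p) ⟩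
      N ^ p * (2 ^ p * N ^ (r * p)) ∎)
      where
      open ≤-Reasoning
      Ts : List (Vec (Vec V p) r)
      Ts = vecs (vecs xs p) r
      F : Vec (Vec V p) r → ℕ
      F T = ⟦ live G T P Q ⟧ * w (degree G T P xs Q) ^ p
      lemma : ∀ a b c → a * (b * c) ≡ c * (b * a)
      lemma = solve-∀
      length-Ts : length Ts ≡ N ^ (r * p)
      length-Ts = trans (length-vecs (vecs xs p) r) (trans (cong (_^ r) (length-vecs xs p))
        (trans (^-*-assoc N p r) (cong (N ^_) (*-comm p r))))
      F-update : ∀ T c → F (T [ part P ]≔ c) ≡ ⟦ allVec (candidate G T P Q) c ⟧ * w (degree G T P xs Q) ^ p
      F-update T c = cong₂ (λ b D → ⟦ b ⟧ * w D ^ p)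
        (trans (cong (allVec (candidate G (T [ part P ]≔ c) P Q)) (Vec.lookup∘update (part P) T c))
               (allVec-cong (candidate-update G T P Q c) c))
        (∑-cong xs (λ y → cong ⟦_⟧ (candidate-update G T P Q c y)))
      averaged : ∀ T → ∑ (vecs xs p) (λ c → F (T [ part P ]≔ c)) ≤ 2 ^ p * N ^ p
      averaged T = begin
        ∑ (vecs xs p) (λ c → F (T [ part P ]≔ c))                       ≡⟨ ∑-cong (vecs xs p) (F-update T) ⟩
        ∑ (vecs xs p) (λ c → ⟦ allVec (candidate G T P Q) c ⟧ * w D ^ p) ≡⟨ ∑-*ʳ (vecs xs p) (w D ^ p) _ ⟩
        ∑ (vecs xs p) (λ c → ⟦ allVec (candidate G T P Q) c ⟧) * w D ^ p ≡⟨ cong (_* w D ^ p) (∑-allVec xs (candidate G T P Q) p) ⟩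
        D ^ p * w D ^ p                                                 ≡⟨ *-comm (D ^ p) (w D ^ p) ⟩
        w D ^ p * D ^ p                                                 ≡⟨ ^-distribʳ-* (w D) D p ⟨
        (w D * D) ^ p                                                   ≤⟨ ^-monoˡ-≤ p (w-bound D (∑⟦⟧≤length xs _)) ⟩
        (2 * N) ^ p                                                     ≡⟨ ^-distribʳ-* 2 N p ⟩
        2 ^ p * N ^ p ∎
        where
        D : ℕ
        D = degree G T P xs Q

    moment : (G : Vec V r → Bool) (T : Vec (Vec V p) r) (P : Pattern r) → ℕ
    moment {p = p} G T P = ∑ (vecs xs (size P)) (λ Q → ⟦ live G T P Q ⟧ * w (degree G T P xs Q) ^ p)

    large : ℕ → (G : Vec V r → Bool) (T : Vec (Vec V p) r) (P : Pattern r) → Bool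
    large M G T P = ⌊ M * N ^ size P <? moment G T P ⌋

    -- Markov's inequality. Exchanging the sums over `T` and `Q` reduces the total of all moments to
    -- `∑-live`, and each large `T` contributes more than `M * N ^ size P` to that total.
    large-rare : ∀ M (G : Vec V r → Bool) (P : Pattern r) →
      M * ∑ (vecs (vecs xs p) r) (λ T → ⟦ large M G T P ⟧) ≤ 2 ^ p * N ^ (r * p)
    large-rare {r = r} {p = p} M G P = *-cancelˡ-≤ (N ^ size P) {{m^n≢0 N (size P) {{>-nonZero N≥1}}}} (begin
      N ^ size P * (M * ∑ Ts (λ T → ⟦ large M G T P ⟧)) ≡⟨ *-assoc (N ^ size P) M _ ⟨
      N ^ size P * M * ∑ Ts (λ T → ⟦ large M G T P ⟧)   ≡⟨ ∑-*ˡ Ts (N ^ size P * M) _ ⟨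
      ∑ Ts (λ T → N ^ size P * M * ⟦ large M G T P ⟧)   ≤⟨ ∑-mono Ts markov ⟩
      ∑ Ts (λ T → moment G T P)                         ≡⟨ ∑-swap Ts (vecs xs (size P)) _ ⟩
      ∑ (vecs xs (size P)) (λ Q → ∑ Ts (λ T → ⟦ live G T P Q ⟧ * w (degree G T P xs Q) ^ p))
                                                        ≤⟨ ∑-mono (vecs xs (size P)) (∑-live G P) ⟩
      ∑ (vecs xs (size P)) (λ _ → 2 ^ p * N ^ (r * p))  ≡⟨ ∑-const (vecs xs (size P)) _ ⟩
      length (vecs xs (size P)) * (2 ^ p * N ^ (r * p)) ≡⟨ cong (_* (2 ^ p * N ^ (r * p))) (length-vecs xs (size P)) ⟩
      N ^ size P * (2 ^ p * N ^ (r * p)) ∎)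
      where
      open ≤-Reasoning
      Ts : List (Vec (Vec V p) r)
      Ts = vecs (vecs xs p) r
      markov : ∀ T → N ^ size P * M * ⟦ large M G T P ⟧ ≤ moment G T P
      markov T with M * N ^ size P <? moment G T P
      ... | yes lt = ≤-trans (≤-reflexive (trans (*-identityʳ _) (*-comm (N ^ size P) M))) (<⇒≤ lt)
      ... | no  _  = ≤-trans (≤-reflexive (*-zeroʳ (N ^ size P * M))) z≤n

  ⟦<?⟧<1 : ∀ a b → ⟦ ⌊ a <? b ⌋ ⟧ < 1 → b ≤ a
  ⟦<?⟧<1 a b lt with a <? b
  ⟦<?⟧<1 a b (s≤s ()) | yes _
  ... | no a≮b = ≮⇒≥ a≮b

  monoᵇ : (C : Vec A k → Fin q) → Fin q → Vec A m → Bool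
  monoᵇ {k = k} {m = m} C c z = allOf (allSel m k) λ σ → ⌊ C (select σ z) Fin.≟ c ⌋

  ⌊⌋-true : ∀ {P : Set} (d : Dec P) → ⌊ d ⌋ ≡ true → P
  ⌊⌋-true (yes p) _ = p

  true-⌊⌋ : ∀ {P : Set} (d : Dec P) → P → ⌊ d ⌋ ≡ true
  true-⌊⌋ (yes _) p = refl
  true-⌊⌋ (no ¬p) p with () ← ¬p p

  monoᵇ-sound : {C : Vec A k → Fin q} {c : Fin q} {z : Vec A m} → monoᵇ C c z ≡ true → Mono C c z
  monoᵇ-sound {C = C} {c} {z} e σ = ⌊⌋-true (C (select σ z) Fin.≟ c) (allOf-∈ e (∈-allSel σ))

  monoᵇ-complete : {C : Vec A k → Fin q} {c : Fin q} {z : Vec A m} → Mono C c z → monoᵇ C c z ≡ true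
  monoᵇ-complete {k = k} {m = m} {C = C} {c} {z} mono =
    allOf-intro (allSel m k) {λ σ → ⌊ C (select σ z) Fin.≟ c ⌋} (λ {σ} _ → true-⌊⌋ (C (select σ z) Fin.≟ c) (mono σ))

  -- `M-large` is the condition for a union bound over all triples of subsequence, colour and
  -- pattern, each of which fails with probability at most 2 ^ p / M.
  module DependentRandomChoice
    (k q d r p R M : ℕ) (ramseyR : RamseyFor k q (r * p) R)
    (M-large : length (allSel R (r * p)) * (q * (length (patterns r d) * 2 ^ p)) < M)
    {V : Set} (xs : List V) (N≥1 : 1 ≤ length xs)
    (w : ℕ → ℕ) (w-bound : ∀ D → D ≤ length xs → w D * D ≤ 2 * length xs)
    (C : Vec V k → Fin q) where

    private
      N ℓ : ℕ
      N = length xs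
      ℓ = r * p

    bad : Fin q → Pattern r → Vec (Vec V p) r → ℕ
    bad c P T = ⟦ large xs N≥1 w w-bound M (monoᵇ C c) T P ⟧

    -- All subsequences and colours are counted, since Ramsey's theorem names the relevant ones only
    -- after `z` is fixed.
    bads : Vec V R → ℕ
    bads z = ∑ (allSel R ℓ) λ σ → ∑ (allFin q) λ c → ∑ (patterns r d) λ P → bad c P (chunks r p (select σ z))

    -- The blocks cut from a fixed subsequence of a uniform tuple are uniform, so `large-rare`
    -- applies to them.
    bad-rare : ∀ σ c P → N ^ ℓ * (M * ∑ (vecs xs R) (λ z → bad c P (chunks r p (select σ z)))) ≤ N ^ ℓ * (N ^ R * 2 ^ p)
    bad-rare σ c P = begin
      N ^ ℓ * (M * ∑ (vecs xs R) (λ z → bad c P (chunks r p (select σ z)))) ≡⟨ swap (N ^ ℓ) M _ ⟩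
      M * (N ^ ℓ * ∑ (vecs xs R) (λ z → bad c P (chunks r p (select σ z)))) ≡⟨ cong (M *_) (∑-select xs σ (λ x → bad c P (chunks r p x))) ⟩
      M * (N ^ R * ∑ (vecs xs ℓ) (λ x → bad c P (chunks r p x)))            ≡⟨ cong (λ t → M * (N ^ R * t)) (∑-chunks xs r p (bad c P)) ⟩
      M * (N ^ R * ∑ (vecs (vecs xs p) r) (bad c P))                        ≡⟨ swap M (N ^ R) _ ⟩
      N ^ R * (M * ∑ (vecs (vecs xs p) r) (bad c P))                        ≤⟨ *-monoʳ-≤ (N ^ R) (large-rare xs N≥1 w w-bound M (monoᵇ C c) P) ⟩
      N ^ R * (2 ^ p * N ^ ℓ)                                               ≡⟨ rot (N ^ R) (2 ^ p) (N ^ ℓ) ⟩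
      N ^ ℓ * (N ^ R * 2 ^ p) ∎
      where
      open ≤-Reasoning
      swap : ∀ a b c → a * (b * c) ≡ b * (a * c)
      swap = solve-∀
      rot : ∀ a b c → a * (b * c) ≡ c * (a * b)
      rot = solve-∀

    bads-few : M * ∑ (vecs xs R) bads < M * N ^ R
    bads-few = begin-strict
      M * ∑ (vecs xs R) bads
        ≡⟨ cong (M *_) (trans (∑-swap (vecs xs R) (allSel R ℓ) _) (∑-cong (allSel R ℓ) λ σ →
             trans (∑-swap (vecs xs R) (allFin q) _) (∑-cong (allFin q) λ c → ∑-swap (vecs xs R) (patterns r d) _))) ⟩
      M * ∑ (allSel R ℓ) (λ σ → ∑ (allFin q) λ c → ∑ (patterns r d) λ P → occ σ c P)
        ≡⟨ trans (sym (∑-*ˡ (allSel R ℓ) M _)) (∑-cong (allSel R ℓ) λ σ →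
             trans (sym (∑-*ˡ (allFin q) M _)) (∑-cong (allFin q) λ c → sym (∑-*ˡ (patterns r d) M _))) ⟩
      ∑ (allSel R ℓ) (λ σ → ∑ (allFin q) λ c → ∑ (patterns r d) λ P → M * occ σ c P)
        ≤⟨ (∑-mono (allSel R ℓ) λ σ → ∑-mono (allFin q) λ c → ∑-mono (patterns r d) λ P →
             *-cancelˡ-≤ (N ^ ℓ) {{m^n≢0 N ℓ {{>-nonZero N≥1}}}} (bad-rare σ c P)) ⟩
      ∑ (allSel R ℓ) (λ σ → ∑ (allFin q) λ c → ∑ (patterns r d) λ P → N ^ R * 2 ^ p)
        ≡⟨ trans (∑-const (allSel R ℓ) _) (cong (length (allSel R ℓ) *_)
             (trans (∑-const (allFin q) _) (cong₂ _*_ (length-tabulate {n = q} (λ i → i)) (∑-const (patterns r d) _)))) ⟩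
      length (allSel R ℓ) * (q * (length (patterns r d) * (N ^ R * 2 ^ p)))
        ≡⟨ lemma (length (allSel R ℓ)) q (length (patterns r d)) (N ^ R) (2 ^ p) ⟩
      (length (allSel R ℓ) * (q * (length (patterns r d) * 2 ^ p))) * N ^ R
        <⟨ *-monoˡ-< (N ^ R) {{m^n≢0 N R {{>-nonZero N≥1}}}} M-large ⟩
      M * N ^ R ∎
      where
      open ≤-Reasoning
      occ : Sel R ℓ → Fin q → Pattern r → ℕ
      occ σ c P = ∑ (vecs xs R) (λ z → bad c P (chunks r p (select σ z)))
      lemma : ∀ a b c e f → a * (b * (c * (e * f))) ≡ a * (b * (c * f)) * e
      lemma = solve-∀

    good : ∃ λ z → bads z < 1
    good = ∑-< (vecs xs R) (subst (∑ (vecs xs R) bads <_)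
      (trans (sym (length-vecs xs R)) (length-∑ (vecs xs R))) (*-cancelˡ-< M _ _ bads-few))

    not-large : ∀ {c P T} → bad c P T < 1 →
      moment xs N≥1 w w-bound (monoᵇ C c) T P ≤ M * N ^ size P
    not-large lt = ⟦<?⟧<1 _ _ lt

    -- Ramsey's theorem is applied to a tuple without bad triples: whichever subsequence and colour
    -- it returns, the moments are already under control.
    goodTuple : ∃₂ λ c (T : Vec (Vec V p) r) → (∀ τ → monoᵇ C c (transversal T τ) ≡ true) ×
      (∀ {P} → P ∈ patterns r d → moment xs N≥1 w w-bound (monoᵇ C c) T P ≤ M * N ^ size P)
    goodTuple = c , T , (λ τ → monoᵇ-complete {C = C} {c} {transversal T τ} (Mono-transversal {r = r} {p = p} {C = C} mono τ)) , small
      where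
      z : Vec V R
      z = proj₁ good
      σ : Sel R ℓ
      σ = proj₁ (ramseyR C z)
      c : Fin q
      c = proj₁ (proj₂ (ramseyR C z))
      mono : Mono C c (select σ z)
      mono = proj₂ (proj₂ (ramseyR C z))
      T : Vec (Vec V p) r
      T = chunks r p (select σ z)
      small : ∀ {P} → P ∈ patterns r d → moment xs N≥1 w w-bound (monoᵇ C c) T P ≤ M * N ^ size P
      small {P} P∈ = not-large {c} {P} {T} (begin-strict
        bad c P T                                               ≤⟨ term≤∑ (λ P → bad c P T) P∈ ⟩
        ∑ (patterns r d) (λ P → bad c P T)
          ≤⟨ term≤∑ (λ c → ∑ (patterns r d) λ P → bad c P T) (∈-allFin c) ⟩
        ∑ (allFin q) (λ c → ∑ (patterns r d) λ P → bad c P T)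
          ≤⟨ term≤∑ (λ σ → ∑ (allFin q) λ c → ∑ (patterns r d) λ P → bad c P (chunks r p (select σ z))) (∈-allSel σ) ⟩
        bads z                                                  <⟨ proj₂ good ⟩
        1 ∎)
        where open ≤-Reasoning

open RandomChoice

-- Moments along the random greedy process.

module Greedy where

  ^-⊔-≤ : ∀ a b s → (a ⊔ b) ^ s ≤ a ^ s + b ^ s
  ^-⊔-≤ a b s with ⊔-sel a b
  ... | inj₁ e rewrite e = m≤m+n _ _
  ... | inj₂ e rewrite e = m≤n+m _ _

  n≡0⊎n>0 : ∀ n → n ≡ 0 ⊎ 0 < n
  n≡0⊎n>0 zero    = inj₁ refl
  n≡0⊎n>0 (suc n) = inj₂ (s≤s z≤n)

  private variable
    X A : Set
    t b : ℕ

  -- The unnormalised probability that the process produces a given history.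
  Π-weight : (∀ {t} → Vec X t → X → Vec A t → A → ℕ) → Vec X t → Vec A t → ℕ
  Π-weight ω []      []      = 1
  Π-weight ω (v ∷ o) (y ∷ h) = Π-weight ω o h * ω o v h y

  -- One vertex after the other is embedded at random: ω o v h y / L is the probability that v goes to y when the
  -- vertices o (latest first) have been embedded to h. The constraints on v involve only the earlier vertices selected
  -- by B o v, and N / w o v is roughly the number of choices left for v.
  module RandomGreedy
    {X A : Set} (xs : List A)
    (OK : ∀ {t} → Vec X t → Set) (OK-tail : ∀ {t v} {o : Vec X t} → OK (v ∷ o) → OK o)
    (β : ∀ {t} → Vec X t → X → ℕ) (B : ∀ {t} (o : Vec X t) v → Sel t (β o v))
    (w : ∀ {t} (o : Vec X t) v → Vec A (β o v) → ℕ)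
    (val : ∀ {t} (o : Vec X t) v → Vec A (β o v) → Bool)
    (ω : ∀ {t} → Vec X t → X → Vec A t → A → ℕ)
    (L c d s M : ℕ) (L≥1 : 1 ≤ L) (c≥1 : 1 ≤ c) (M≥1 : 1 ≤ M) (N≥1 : 1 ≤ length xs) (3d≤s : 3 * d ≤ s)
    (β≤d : ∀ {t v} {o : Vec X t} → OK (v ∷ o) → β o v ≤ d)
    (∑ω≤L : ∀ {t} (o : Vec X t) v h → ∑ xs (ω o v h) ≤ L)
    (ω-bound : ∀ {t} (o : Vec X t) v h y → length xs * ω o v h y ≤ L * (c * w o v (select (B o v) h) ^ 3))
    (alive : ∀ {t v} {o : Vec X t} {h} → OK (v ∷ o) → 0 < Π-weight ω o h →
      val o v (select (B o v) h) ≡ true × ∑ xs (ω o v h) ≡ L)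
    (moments : ∀ {t v} {o : Vec X t} → OK (v ∷ o) →
      ∑ (vecs xs (β o v)) (λ Q → ⟦ val o v Q ⟧ * w o v Q ^ (s + s)) ≤ M * length xs ^ β o v)
    where

    N : ℕ
    N = length xs

    W : ∀ {t} (o : Vec X t) → X → Vec A t → ℕ
    W o v h = w o v (select (B o v) h)

    Ω : Vec X t → Vec A t → ℕ
    Ω = Π-weight ω

    -- The probability is factored so that the selected steps can be bounded pointwise while the
    -- remaining ones are summed out.
    Ω-off Ω-on : Vec X t → Sel t b → Vec A t → ℕ
    Ω-off []      done     []      = 1
    Ω-off (v ∷ o) (keep σ) (y ∷ h) = Ω-off o σ h
    Ω-off (v ∷ o) (drop σ) (y ∷ h) = Ω-off o σ h * ω o v h y
    Ω-on  []      done     []      = 1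
    Ω-on  (v ∷ o) (keep σ) (y ∷ h) = Ω-on o σ h * ω o v h y
    Ω-on  (v ∷ o) (drop σ) (y ∷ h) = Ω-on o σ h

    Ω-split : ∀ (o : Vec X t) (σ : Sel t b) h → Ω o h ≡ Ω-off o σ h * Ω-on o σ h
    Ω-split []      done     []      = refl
    Ω-split (v ∷ o) (keep σ) (y ∷ h) = trans (cong (_* ω o v h y) (Ω-split o σ h)) (*-assoc (Ω-off o σ h) _ _)
    Ω-split (v ∷ o) (drop σ) (y ∷ h) =
      trans (cong (_* ω o v h y) (Ω-split o σ h)) (lemma (Ω-off o σ h) (Ω-on o σ h) (ω o v h y))
      where
      lemma : ∀ a b c → a * b * c ≡ a * c * b
      lemma = solve-∀

    -- The latest vertex is summed out first: a dropped step contributes at most `L`, and a kept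
    -- one, whose factor is absent, is summed uniformly. What remains is a uniform sum over the
    -- selected images.
    ∑-Ω-off : ∀ (o : Vec X t) (σ : Sel t b) (F : Vec A b → ℕ) →
      L ^ b * ∑ (vecs xs t) (λ h → Ω-off o σ h * F (select σ h)) ≤ L ^ t * ∑ (vecs xs b) F
    ∑-Ω-off [] done F = ≤-reflexive (cong (_+ 0) (cong (_+ 0) (*-identityˡ (F []))))
    ∑-Ω-off {suc t} {suc b} (v ∷ o) (keep σ) F = begin
      L * L ^ b * ∑ (vecs xs (suc t)) (λ h → Ω-off (v ∷ o) (keep σ) h * F (select (keep σ) h))
        ≡⟨ cong (L * L ^ b *_) (trans (∑-vecs-suc xs t _) (∑-cong (vecs xs t) (λ h → ∑-*ˡ xs (Ω-off o σ h) _))) ⟩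
      L * L ^ b * ∑ (vecs xs t) (λ h → Ω-off o σ h * ∑ xs (λ y → F (y ∷ select σ h)))
        ≡⟨ *-assoc L (L ^ b) _ ⟩
      L * (L ^ b * ∑ (vecs xs t) (λ h → Ω-off o σ h * ∑ xs (λ y → F (y ∷ select σ h))))
        ≤⟨ *-monoʳ-≤ L (∑-Ω-off o σ (λ Q → ∑ xs (λ y → F (y ∷ Q)))) ⟩
      L * (L ^ t * ∑ (vecs xs b) (λ Q → ∑ xs (λ y → F (y ∷ Q))))
        ≡⟨ *-assoc L (L ^ t) _ ⟨
      L * L ^ t * ∑ (vecs xs b) (λ Q → ∑ xs (λ y → F (y ∷ Q)))
        ≡⟨ cong (L * L ^ t *_) (∑-vecs-suc xs b F) ⟨
      L * L ^ t * ∑ (vecs xs (suc b)) F ∎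
      where open ≤-Reasoning
    ∑-Ω-off {suc t} {b} (v ∷ o) (drop σ) F = begin
      L ^ b * ∑ (vecs xs (suc t)) (λ h → Ω-off (v ∷ o) (drop σ) h * F (select (drop σ) h))
        ≡⟨ cong (L ^ b *_) (∑-vecs-suc xs t _) ⟩
      L ^ b * ∑ (vecs xs t) (λ h → ∑ xs (λ y → Ω-off o σ h * ω o v h y * F (select σ h)))
        ≤⟨ *-monoʳ-≤ (L ^ b) (∑-mono (vecs xs t) averaged) ⟩
      L ^ b * ∑ (vecs xs t) (λ h → L * (Ω-off o σ h * F (select σ h)))
        ≡⟨ cong (L ^ b *_) (∑-*ˡ (vecs xs t) L _) ⟩
      L ^ b * (L * ∑ (vecs xs t) (λ h → Ω-off o σ h * F (select σ h)))
        ≡⟨ swap (L ^ b) L _ ⟩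
      L * (L ^ b * ∑ (vecs xs t) (λ h → Ω-off o σ h * F (select σ h)))
        ≤⟨ *-monoʳ-≤ L (∑-Ω-off o σ F) ⟩
      L * (L ^ t * ∑ (vecs xs b) F)
        ≡⟨ *-assoc L (L ^ t) _ ⟨
      L * L ^ t * ∑ (vecs xs b) F ∎
      where
      open ≤-Reasoning
      swap : ∀ a b c → a * (b * c) ≡ b * (a * c)
      swap = solve-∀
      rot : ∀ a b c → a * b * c ≡ a * c * b
      rot = solve-∀
      averaged : ∀ h → ∑ xs (λ y → Ω-off o σ h * ω o v h y * F (select σ h)) ≤ L * (Ω-off o σ h * F (select σ h))
      averaged h = begin
        ∑ xs (λ y → Ω-off o σ h * ω o v h y * F (select σ h)) ≡⟨ ∑-cong xs (λ y → rot (Ω-off o σ h) (ω o v h y) (F (select σ h))) ⟩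
        ∑ xs (λ y → Ω-off o σ h * F (select σ h) * ω o v h y) ≡⟨ ∑-*ˡ xs (Ω-off o σ h * F (select σ h)) _ ⟩
        Ω-off o σ h * F (select σ h) * ∑ xs (ω o v h)         ≤⟨ *-monoʳ-≤ (Ω-off o σ h * F (select σ h)) (∑ω≤L o v h) ⟩
        Ω-off o σ h * F (select σ h) * L                      ≡⟨ *-comm _ L ⟩
        L * (Ω-off o σ h * F (select σ h)) ∎

    -- The maximum starts at 1, so that its powers do not decrease as the exponent is raised to `s`.
    maxW : Vec X t → Sel t b → Vec A t → ℕ
    maxW []      done     []      = 1
    maxW (v ∷ o) (keep σ) (y ∷ h) = maxW o σ h ⊔ W o v h
    maxW (v ∷ o) (drop σ) (y ∷ h) = maxW o σ h

    maxW≥1 : ∀ (o : Vec X t) (σ : Sel t b) h → 1 ≤ maxW o σ h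
    maxW≥1 []      done     []      = ≤-refl
    maxW≥1 (v ∷ o) (keep σ) (y ∷ h) = ≤-trans (maxW≥1 o σ h) (m≤m⊔n _ _)
    maxW≥1 (v ∷ o) (drop σ) (y ∷ h) = maxW≥1 o σ h

    -- The density of the selected steps against the uniform distribution: multiply `ω-bound` over
    -- them and replace each weight by the maximum.
    Ω-on-bound : ∀ (o : Vec X t) (σ : Sel t b) h → N ^ b * Ω-on o σ h ≤ L ^ b * (c * maxW o σ h ^ 3) ^ b
    Ω-on-bound [] done [] = ≤-refl
    Ω-on-bound {b = suc b} (v ∷ o) (keep σ) (y ∷ h) = begin
      N * N ^ b * (Ω-on o σ h * ω o v h y)         ≡⟨ regroup N (N ^ b) (Ω-on o σ h) (ω o v h y) ⟩
      N * ω o v h y * (N ^ b * Ω-on o σ h)         ≤⟨ *-mono-≤ (ω-bound o v h y) (Ω-on-bound o σ h) ⟩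
      L * (c * W o v h ^ 3) * (L ^ b * (c * mx ^ 3) ^ b)
        ≤⟨ *-mono-≤ (*-monoʳ-≤ L (*-monoʳ-≤ c (^-monoˡ-≤ 3 (m≤n⊔m mx (W o v h)))))
                    (*-monoʳ-≤ (L ^ b) (^-monoˡ-≤ b (*-monoʳ-≤ c (^-monoˡ-≤ 3 (m≤m⊔n mx (W o v h)))))) ⟩
      L * (c * mx' ^ 3) * (L ^ b * (c * mx' ^ 3) ^ b) ≡⟨ regroup' L (c * mx' ^ 3) (L ^ b) ((c * mx' ^ 3) ^ b) ⟩
      L * L ^ b * (c * mx' ^ 3 * (c * mx' ^ 3) ^ b) ∎
      where
      open ≤-Reasoning
      mx mx' : ℕ
      mx  = maxW o σ h
      mx' = mx ⊔ W o v h
      regroup : ∀ a b c d → a * b * (c * d) ≡ a * d * (b * c)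
      regroup = solve-∀
      regroup' : ∀ a b c d → a * b * (c * d) ≡ a * c * (b * d)
      regroup' = solve-∀
    Ω-on-bound (v ∷ o) (drop σ) (y ∷ h) = Ω-on-bound o σ h

    -- Tuned so that the two cases of `Ω-pointwise` contribute K / 2 each: `κ * suc d` is half of
    -- `Λ`, and `Λ * M` is half of `K`.
    κ Λ K : ℕ
    κ = c ^ d
    Λ = 2 * (κ * suc d)
    K = 2 * (Λ * M)

    Ω-on-bound′ : ∀ (o : Vec X t) (σ : Sel t b) h → b ≤ d → N ^ b * Ω-on o σ h ≤ L ^ b * (κ * maxW o σ h ^ s)
    Ω-on-bound′ {b = b} o σ h b≤d = ≤-trans (Ω-on-bound o σ h) (*-monoʳ-≤ (L ^ b) (begin
      (c * mx ^ 3) ^ b     ≤⟨ ^-monoʳ-≤ (c * mx ^ 3) {{>-nonZero (*-mono-≤ c≥1 (1≤^ 3))}} b≤d ⟩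
      (c * mx ^ 3) ^ d     ≡⟨ ^-distribʳ-* c (mx ^ 3) d ⟩
      κ * (mx ^ 3) ^ d     ≡⟨ cong (κ *_) (^-*-assoc mx 3 d) ⟩
      κ * mx ^ (3 * d)     ≤⟨ *-monoʳ-≤ κ (^-monoʳ-≤ mx {{>-nonZero (maxW≥1 o σ h)}} 3d≤s) ⟩
      κ * mx ^ s ∎))
      where
      open ≤-Reasoning
      mx : ℕ
      mx = maxW o σ h
      1≤^ : ∀ n → 1 ≤ mx ^ n
      1≤^ n = m^n>0 mx {{>-nonZero (maxW≥1 o σ h)}} n

    -- Either w^s is dominated by the weights of the earlier neighbours, or the probability of the history is dominated
    -- by w^s itself, which turns w^s into w^2s under the uniform distribution of the earlier neighbours.
    Ω-pointwise : ∀ {v} {o : Vec X t} → OK (v ∷ o) → ∀ h →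
      Λ * (Ω o h * W o v h ^ s) * N ^ β o v ≤
        N ^ β o v * (κ * (Ω o h * maxW o (B o v) h ^ s)) +
        Λ * Λ * (L ^ β o v * (Ω-off o (B o v) h * (⟦ val o v (select (B o v) h) ⟧ * W o v h ^ (s + s))))
    Ω-pointwise {v = v} {o} ok h with n≡0⊎n>0 (Ω o h)
    ... | inj₁ eq = ≤-trans (≤-reflexive (trans (cong (λ z → Λ * (z * W o v h ^ s) * N ^ β o v) eq) (cong (_* N ^ β o v) (*-zeroʳ Λ)))) z≤n
    ... | inj₂ pos with ≤-total (Λ * W o v h ^ s) (κ * maxW o (B o v) h ^ s)
    ...   | inj₁ le = ≤-trans (begin
      Λ * (n * W o v h ^ s) * N ^ e            ≡⟨ lemma₁ Λ n (W o v h ^ s) (N ^ e) ⟩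
      N ^ e * (n * (Λ * W o v h ^ s))          ≤⟨ *-monoʳ-≤ (N ^ e) (*-monoʳ-≤ n le) ⟩
      N ^ e * (n * (κ * maxW o (B o v) h ^ s)) ≡⟨ lemma₂ (N ^ e) n κ (maxW o (B o v) h ^ s) ⟩
      N ^ e * (κ * (n * maxW o (B o v) h ^ s)) ∎) (m≤m+n _ _)
      where
      open ≤-Reasoning
      e n : ℕ
      e = β o v
      n = Ω o h
      lemma₁ : ∀ a b c d → a * (b * c) * d ≡ d * (b * (a * c))
      lemma₁ = solve-∀
      lemma₂ : ∀ a b c d → a * (b * (c * d)) ≡ a * (c * (b * d))
      lemma₂ = solve-∀
    ...   | inj₂ ge = ≤-trans (begin
      Λ * (Ω o h * Ws) * N ^ e                     ≡⟨ cong (λ z → Λ * (z * Ws) * N ^ e) ((Ω-split o (B o v) h)) ⟩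
      Λ * (off * on * Ws) * N ^ e                  ≡⟨ lemma₁ Λ off on Ws (N ^ e) ⟩
      Λ * Ws * off * (N ^ e * on)                  ≤⟨ *-monoʳ-≤ (Λ * Ws * off) (≤-trans (Ω-on-bound′ o (B o v) h (β≤d ok)) (*-monoʳ-≤ (L ^ e) ge)) ⟩
      Λ * Ws * off * (L ^ e * (Λ * Ws))            ≡⟨ lemma₂ Λ Ws off (L ^ e) ⟩
      Λ * Λ * (L ^ e * (off * (1 * (Ws * Ws))))    ≡⟨ cong (λ z → Λ * Λ * (L ^ e * (off * (⟦ proj₁ z ⟧ * proj₂ z)))) (cong₂ _,_ (sym live) (sym (^-distribˡ-+-* (W o v h) s s))) ⟩
      Λ * Λ * (L ^ e * (off * (⟦ val o v (select (B o v) h) ⟧ * W o v h ^ (s + s)))) ∎) (m≤n+m _ _)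
      where
      open ≤-Reasoning
      e off on Ws : ℕ
      e   = β o v
      off = Ω-off o (B o v) h
      on  = Ω-on o (B o v) h
      Ws  = W o v h ^ s
      live : val o v (select (B o v) h) ≡ true
      live = proj₁ (alive ok pos)
      lemma₁ : ∀ a b c d e → a * (b * c * d) * e ≡ a * d * b * (e * c)
      lemma₁ = solve-∀
      lemma₂ : ∀ a b c d → a * b * c * (d * (a * b)) ≡ a * a * (d * (c * (1 * (b * b))))
      lemma₂ = solve-∀

    Λ≥1 : 1 ≤ Λ
    Λ≥1 = *-mono-≤ {1} {2} (s≤s z≤n) (*-mono-≤ (m^n>0 c {{>-nonZero c≥1}} d) (s≤s z≤n))

    K≥1 : 1 ≤ K
    K≥1 = *-mono-≤ {1} {2} (s≤s z≤n) (*-mono-≤ Λ≥1 M≥1)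

    -- The two bounds are proved by a joint induction on `t`. The moment of a new vertex is reduced
    -- to that of the maximum over its at most `d` earlier neighbours, and a maximum is at most the
    -- sum of its terms. With the initial 1 there are `suc b` of these.
    ∑ΩW : ∀ {v} {o : Vec X t} → OK (v ∷ o) → ∑ (vecs xs t) (λ h → Ω o h * W o v h ^ s) ≤ K * L ^ t
    ∑Ω-maxW : ∀ {o : Vec X t} → OK o → (σ : Sel t b) →
      ∑ (vecs xs t) (λ h → Ω o h * maxW o σ h ^ s) ≤ suc b * K * L ^ t

    ∑ΩW {t} {v} {o} ok = *-cancelˡ-≤ Λ {{>-nonZero Λ≥1}} (*-cancelʳ-≤ _ _ (N ^ e) {{m^n≢0 N e {{>-nonZero N≥1}}}} (begin
      Λ * ∑ hs (λ h → Ω o h * W o v h ^ s) * N ^ e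
        ≡⟨ trans (∑-*ʳ hs (N ^ e) _) (cong (_* N ^ e) (∑-*ˡ hs Λ _)) ⟨
      ∑ hs (λ h → Λ * (Ω o h * W o v h ^ s) * N ^ e)
        ≤⟨ ∑-mono hs (Ω-pointwise ok) ⟩
      ∑ hs (λ h → N ^ e * (κ * (Ω o h * maxW o σ h ^ s)) + Λ * Λ * (L ^ e * (Ω-off o σ h * F (select σ h))))
        ≡⟨ trans (∑-+ hs _ _) (cong₂ _+_
             (trans (∑-*ˡ hs (N ^ e) _) (cong (N ^ e *_) (∑-*ˡ hs κ _)))
             (trans (∑-*ˡ hs (Λ * Λ) _) (cong (Λ * Λ *_) (∑-*ˡ hs (L ^ e) _)))) ⟩
      N ^ e * (κ * ∑ hs (λ h → Ω o h * maxW o σ h ^ s)) + Λ * Λ * (L ^ e * ∑ hs (λ h → Ω-off o σ h * F (select σ h)))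
        ≤⟨ +-mono-≤ (*-monoʳ-≤ (N ^ e) (*-monoʳ-≤ κ (≤-trans (∑Ω-maxW (OK-tail ok) σ)
                       (*-monoˡ-≤ (L ^ t) (*-monoˡ-≤ K (s≤s (β≤d ok)))))))
                    (*-monoʳ-≤ (Λ * Λ) (≤-trans (∑-Ω-off o σ F) (*-monoʳ-≤ (L ^ t) (moments ok)))) ⟩
      N ^ e * (κ * (suc d * K * L ^ t)) + Λ * Λ * (L ^ t * (M * N ^ e))
        ≡⟨ lemma κ (suc d) M (L ^ t) (N ^ e) ⟩
      Λ * (K * L ^ t) * N ^ e ∎))
      where
      open ≤-Reasoning
      hs : List (Vec A t)
      hs = vecs xs t
      e : ℕ
      e = β o v
      σ : Sel t e
      σ = B o v
      F : Vec A e → ℕ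
      F Q = ⟦ val o v Q ⟧ * w o v Q ^ (s + s)
      lemma : ∀ κ d M l n → n * (κ * (d * (2 * ((2 * (κ * d)) * M)) * l)) + (2 * (κ * d)) * (2 * (κ * d)) * (l * (M * n)) ≡
        (2 * (κ * d)) * ((2 * ((2 * (κ * d)) * M)) * l) * n
      lemma = solve-∀

    ∑Ω-maxW {o = []} ok done = subst₂ _≤_ (sym lhs) (sym rhs) K≥1
      where
      lhs : 1 * 1 ^ s + 0 ≡ 1
      lhs = trans (+-identityʳ _) (trans (*-identityˡ _) (^-zeroˡ s))
      rhs : 1 * K * 1 ≡ K
      rhs = trans (*-identityʳ _) (*-identityˡ K)
    ∑Ω-maxW {suc t} {suc b} {v ∷ o} ok (keep σ) = begin
      ∑ (vecs xs (suc t)) (λ h → Ω (v ∷ o) h * maxW (v ∷ o) (keep σ) h ^ s)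
        ≡⟨ ∑-vecs-suc xs t _ ⟩
      ∑ hs (λ h → ∑ xs (λ y → Ω o h * ω o v h y * (maxW o σ h ⊔ W o v h) ^ s))
        ≤⟨ ∑-mono hs averaged ⟩
      ∑ hs (λ h → L * (Ω o h * maxW o σ h ^ s) + L * (Ω o h * W o v h ^ s))
        ≡⟨ trans (∑-+ hs _ _) (cong₂ _+_ (∑-*ˡ hs L _) (∑-*ˡ hs L _)) ⟩
      L * ∑ hs (λ h → Ω o h * maxW o σ h ^ s) + L * ∑ hs (λ h → Ω o h * W o v h ^ s)
        ≤⟨ +-mono-≤ (*-monoʳ-≤ L (∑Ω-maxW (OK-tail ok) σ)) (*-monoʳ-≤ L (∑ΩW ok)) ⟩
      L * (suc b * K * L ^ t) + L * (K * L ^ t)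
        ≡⟨ lemma L b K (L ^ t) ⟩
      suc (suc b) * K * (L * L ^ t) ∎
      where
      open ≤-Reasoning
      hs : List (Vec A t)
      hs = vecs xs t
      lemma : ∀ L b K l → L * ((1 + b) * K * l) + L * (K * l) ≡ (2 + b) * K * (L * l)
      lemma = solve-∀
      regroup : ∀ a l m w → a * (m + w) * l ≡ l * (a * m) + l * (a * w)
      regroup = solve-∀
      rot : ∀ a b c → a * b * c ≡ a * c * b
      rot = solve-∀
      averaged : ∀ h → ∑ xs (λ y → Ω o h * ω o v h y * (maxW o σ h ⊔ W o v h) ^ s) ≤
        L * (Ω o h * maxW o σ h ^ s) + L * (Ω o h * W o v h ^ s)
      averaged h = begin
        ∑ xs (λ y → Ω o h * ω o v h y * mx' ^ s)  ≡⟨ ∑-cong xs (λ y → rot (Ω o h) (ω o v h y) (mx' ^ s)) ⟩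
        ∑ xs (λ y → Ω o h * mx' ^ s * ω o v h y)  ≡⟨ ∑-*ˡ xs (Ω o h * mx' ^ s) _ ⟩
        Ω o h * mx' ^ s * ∑ xs (ω o v h)          ≤⟨ *-mono-≤ (*-monoʳ-≤ (Ω o h) (^-⊔-≤ (maxW o σ h) (W o v h) s)) (∑ω≤L o v h) ⟩
        Ω o h * (maxW o σ h ^ s + W o v h ^ s) * L ≡⟨ regroup (Ω o h) L (maxW o σ h ^ s) (W o v h ^ s) ⟩
        L * (Ω o h * maxW o σ h ^ s) + L * (Ω o h * W o v h ^ s) ∎
        where
        mx' : ℕ
        mx' = maxW o σ h ⊔ W o v h
    ∑Ω-maxW {suc t} {b} {v ∷ o} ok (drop σ) = begin
      ∑ (vecs xs (suc t)) (λ h → Ω (v ∷ o) h * maxW (v ∷ o) (drop σ) h ^ s)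
        ≡⟨ ∑-vecs-suc xs t _ ⟩
      ∑ hs (λ h → ∑ xs (λ y → Ω o h * ω o v h y * maxW o σ h ^ s))
        ≤⟨ ∑-mono hs averaged ⟩
      ∑ hs (λ h → L * (Ω o h * maxW o σ h ^ s))
        ≡⟨ ∑-*ˡ hs L _ ⟩
      L * ∑ hs (λ h → Ω o h * maxW o σ h ^ s)
        ≤⟨ *-monoʳ-≤ L (∑Ω-maxW (OK-tail ok) σ) ⟩
      L * (suc b * K * L ^ t)
        ≡⟨ lemma L (suc b * K) (L ^ t) ⟩
      suc b * K * (L * L ^ t) ∎
      where
      open ≤-Reasoning
      hs : List (Vec A t)
      hs = vecs xs t
      lemma : ∀ a b c → a * (b * c) ≡ b * (a * c)
      lemma = solve-∀
      rot : ∀ a b c → a * b * c ≡ a * c * b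
      rot = solve-∀
      averaged : ∀ h → ∑ xs (λ y → Ω o h * ω o v h y * maxW o σ h ^ s) ≤ L * (Ω o h * maxW o σ h ^ s)
      averaged h = begin
        ∑ xs (λ y → Ω o h * ω o v h y * maxW o σ h ^ s) ≡⟨ ∑-cong xs (λ y → rot (Ω o h) (ω o v h y) (maxW o σ h ^ s)) ⟩
        ∑ xs (λ y → Ω o h * maxW o σ h ^ s * ω o v h y) ≡⟨ ∑-*ˡ xs (Ω o h * maxW o σ h ^ s) _ ⟩
        Ω o h * maxW o σ h ^ s * ∑ xs (ω o v h)         ≤⟨ *-monoʳ-≤ (Ω o h * maxW o σ h ^ s) (∑ω≤L o v h) ⟩
        Ω o h * maxW o σ h ^ s * L                      ≡⟨ *-comm _ L ⟩
        L * (Ω o h * maxW o σ h ^ s) ∎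

    totalW : Vec X t → Vec A t → ℕ
    totalW []      []      = 0
    totalW (v ∷ o) (y ∷ h) = totalW o h + W o v h ^ s

    -- By `alive` a history of positive weight passes on exactly the weight `L`; the other histories
    -- count zero on both sides.
    ∑Ω : ∀ {o : Vec X t} → OK o → ∑ (vecs xs t) (Ω o) ≡ L ^ t
    ∑Ω {o = []} ok = refl
    ∑Ω {suc t} {v ∷ o} ok = begin
      ∑ (vecs xs (suc t)) (Ω (v ∷ o))                    ≡⟨ ∑-vecs-suc xs t _ ⟩
      ∑ (vecs xs t) (λ h → ∑ xs (λ y → Ω o h * ω o v h y)) ≡⟨ ∑-cong (vecs xs t) (λ h → trans (∑-*ˡ xs (Ω o h) _) (full h)) ⟩
      ∑ (vecs xs t) (λ h → L * Ω o h)                    ≡⟨ ∑-*ˡ (vecs xs t) L _ ⟩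
      L * ∑ (vecs xs t) (Ω o)                            ≡⟨ cong (L *_) (∑Ω (OK-tail ok)) ⟩
      L * L ^ t ∎
      where
      open ≡-Reasoning
      full : ∀ h → Ω o h * ∑ xs (ω o v h) ≡ L * Ω o h
      full h with Ω o h in eq
      ... | zero  = sym (*-zeroʳ L)
      ... | suc a = trans (cong (suc a *_) (proj₂ (alive ok (subst (0 <_) (sym eq) (s≤s z≤n))))) (*-comm (suc a) L)

    ∑Ω-totalW : ∀ {o : Vec X t} → OK o → ∑ (vecs xs t) (λ h → Ω o h * totalW o h) ≤ t * K * L ^ t
    ∑Ω-totalW {o = []} ok = ≤-refl
    ∑Ω-totalW {suc t} {v ∷ o} ok = begin
      ∑ (vecs xs (suc t)) (λ h → Ω (v ∷ o) h * totalW (v ∷ o) h)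
        ≡⟨ ∑-vecs-suc xs t _ ⟩
      ∑ hs (λ h → ∑ xs (λ y → Ω o h * ω o v h y * Z h))
        ≤⟨ ∑-mono hs averaged ⟩
      ∑ hs (λ h → L * (Ω o h * totalW o h) + L * (Ω o h * W o v h ^ s))
        ≡⟨ trans (∑-+ hs _ _) (cong₂ _+_ (∑-*ˡ hs L _) (∑-*ˡ hs L _)) ⟩
      L * ∑ hs (λ h → Ω o h * totalW o h) + L * ∑ hs (λ h → Ω o h * W o v h ^ s)
        ≤⟨ +-mono-≤ (*-monoʳ-≤ L (∑Ω-totalW (OK-tail ok))) (*-monoʳ-≤ L (∑ΩW ok)) ⟩
      L * (t * K * L ^ t) + L * (K * L ^ t)
        ≡⟨ lemma L t K (L ^ t) ⟩
      suc t * K * (L * L ^ t) ∎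
      where
      open ≤-Reasoning
      hs : List (Vec A t)
      hs = vecs xs t
      Z : Vec A t → ℕ
      Z h = totalW o h + W o v h ^ s
      lemma : ∀ L b K l → L * (b * K * l) + L * (K * l) ≡ (1 + b) * K * (L * l)
      lemma = solve-∀
      rot : ∀ a b c → a * b * c ≡ a * c * b
      rot = solve-∀
      regroup : ∀ a l m w → a * (m + w) * l ≡ l * (a * m) + l * (a * w)
      regroup = solve-∀
      averaged : ∀ h → ∑ xs (λ y → Ω o h * ω o v h y * Z h) ≤ L * (Ω o h * totalW o h) + L * (Ω o h * W o v h ^ s)
      averaged h = begin
        ∑ xs (λ y → Ω o h * ω o v h y * Z h) ≡⟨ ∑-cong xs (λ y → rot (Ω o h) (ω o v h y) (Z h)) ⟩
        ∑ xs (λ y → Ω o h * Z h * ω o v h y) ≡⟨ ∑-*ˡ xs (Ω o h * Z h) _ ⟩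
        Ω o h * Z h * ∑ xs (ω o v h)         ≤⟨ *-monoʳ-≤ (Ω o h * Z h) (∑ω≤L o v h) ⟩
        Ω o h * Z h * L                      ≡⟨ regroup (Ω o h) L (totalW o h) (W o v h ^ s) ⟩
        L * (Ω o h * totalW o h) + L * (Ω o h * W o v h ^ s) ∎

    -- First moment method. Comparison with `suc (t * K)` makes the inequality strict, which yields
    -- both positive weight and the bound `t * K`.
    typicalRun : ∀ {o : Vec X t} → OK o → ∃ λ h → 0 < Ω o h × totalW o h ≤ t * K
    typicalRun {t} {o} ok = h , positive , s≤s⁻¹ (*-cancelˡ-< (Ω o h) _ _ Ωh<)
      where
      budget : ∑ (vecs xs t) (λ h → Ω o h * totalW o h) < ∑ (vecs xs t) (λ h → Ω o h * suc (t * K))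
      budget = begin-strict
        ∑ (vecs xs t) (λ h → Ω o h * totalW o h)    ≤⟨ ∑Ω-totalW ok ⟩
        t * K * L ^ t                               <⟨ *-monoˡ-< (L ^ t) {{m^n≢0 L t {{>-nonZero L≥1}}}} (n<1+n (t * K)) ⟩
        suc (t * K) * L ^ t                         ≡⟨ *-comm (suc (t * K)) (L ^ t) ⟩
        L ^ t * suc (t * K)                         ≡⟨ cong (_* suc (t * K)) (∑Ω ok) ⟨
        ∑ (vecs xs t) (Ω o) * suc (t * K)           ≡⟨ ∑-*ʳ (vecs xs t) (suc (t * K)) _ ⟨
        ∑ (vecs xs t) (λ h → Ω o h * suc (t * K)) ∎
        where open ≤-Reasoning
      h : Vec A t
      h = proj₁ (∑-< (vecs xs t) budget)
      Ωh< : Ω o h * totalW o h < Ω o h * suc (t * K)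
      Ωh< = proj₂ (∑-< (vecs xs t) budget)
      positive : 0 < Ω o h
      positive with Ω o h | Ωh<
      ... | zero  | ()
      ... | suc _ | _ = s≤s z≤n

open Greedy

-- Splitting the target vertices into regions.

module Halving where

  private variable
    I : Set
    N : ℕ

  ∑-allFin-suc : ∀ N (f : Fin (suc N) → ℕ) → ∑ (allFin (suc N)) f ≡ f zero + ∑ (allFin N) (λ x → f (suc x))
  ∑-allFin-suc N f = cong (f zero +_) (trans (cong (λ l → ∑ l f) (sym (map-tabulate (λ x → x) suc))) (∑-map suc (allFin N) f))

  card : (Fin N → Bool) → ℕ
  card {N} S = ∑ (allFin N) (λ x → ⟦ S x ⟧)

  card-suc : (S : Fin (suc N) → Bool) → card S ≡ ⟦ S zero ⟧ + card (λ x → S (suc x))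
  card-suc {N} S = ∑-allFin-suc N _

  card-cong : {S T : Fin N → Bool} → (∀ x → S x ≡ T x) → card S ≡ card T
  card-cong {N} e = ∑-cong (allFin N) (λ x → cong ⟦_⟧ (e x))

  ∏ : ∀ N → (Fin N → ℕ) → ℕ
  ∏ zero    f = 1
  ∏ (suc N) f = f zero * ∏ N (λ x → f (suc x))

  -- The method of conditional expectations for a uniformly random χ.
  derandomise : ∀ N (is : List I) (wt : I → ℕ) (a : I → Fin N → Bool → ℕ) →
    (∀ i x → a i x true + a i x false ≡ 4) →
    ∃ λ (χ : Fin N → Bool) → ∑ is (λ i → wt i * ∏ N (λ x → a i x (χ x))) ≤ 2 ^ N * ∑ is wt
  derandomise zero is wt a avg = (λ ()) , ≤-reflexive (trans (∑-*ʳ is 1 wt) (*-comm _ 1))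
  derandomise {I = I} (suc N) is wt a avg = choose (≤-total (T true) (2 * ∑ is wt))
    where
    T : Bool → ℕ
    T b = ∑ is (λ i → wt i * a i zero b)
    T-sum : T true + T false ≡ 2 * ∑ is wt + 2 * ∑ is wt
    T-sum = begin
      T true + T false                                    ≡⟨ ∑-+ is _ _ ⟨
      ∑ is (λ i → wt i * a i zero true + wt i * a i zero false)
        ≡⟨ ∑-cong is (λ i → trans (sym (*-distribˡ-+ (wt i) _ _)) (cong (wt i *_) (avg i zero))) ⟩
      ∑ is (λ i → wt i * 4)                               ≡⟨ ∑-*ʳ is 4 wt ⟩
      ∑ is wt * 4                                         ≡⟨ lemma (∑ is wt) ⟩
      2 * ∑ is wt + 2 * ∑ is wt ∎
      where
      open ≡-Reasoning
      lemma : ∀ s → s * 4 ≡ 2 * s + 2 * s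
      lemma = solve-∀
    Result : Set
    Result = ∃ λ (χ : Fin (suc N) → Bool) → ∑ is (λ i → wt i * ∏ (suc N) (λ x → a i x (χ x))) ≤ 2 ^ suc N * ∑ is wt
    extend : ∀ b → T b ≤ 2 * ∑ is wt → Result
    extend b le with derandomise N is (λ i → wt i * a i zero b) (λ i x → a i (suc x)) (λ i x → avg i (suc x))
    ... | χ , bound = χ′ , (begin
      ∑ is (λ i → wt i * (a i zero b * ∏ N (λ x → a i (suc x) (χ x)))) ≡⟨ ∑-cong is (λ i → *-assoc (wt i) _ _) ⟨
      ∑ is (λ i → wt i * a i zero b * ∏ N (λ x → a i (suc x) (χ x)))   ≤⟨ bound ⟩
      2 ^ N * T b                                                      ≤⟨ *-monoʳ-≤ (2 ^ N) le ⟩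
      2 ^ N * (2 * ∑ is wt)                                            ≡⟨ lemma (2 ^ N) (∑ is wt) ⟩
      2 ^ suc N * ∑ is wt ∎)
      where
      open ≤-Reasoning
      χ′ : Fin (suc N) → Bool
      χ′ zero    = b
      χ′ (suc x) = χ x
      lemma : ∀ p s → p * (2 * s) ≡ 2 * p * s
      lemma = solve-∀
    choose : T true ≤ 2 * ∑ is wt ⊎ 2 * ∑ is wt ≤ T true → Result
    choose (inj₁ le) = extend true le
    choose (inj₂ ge) = extend false (+-cancelˡ-≤ (2 * ∑ is wt) _ _ (≤-trans (+-monoˡ-≤ (T false) ge) (≤-reflexive T-sum)))

  is? : Bool → Bool → Bool
  is? true  c = c
  is? false c = not c

  -- Twice the factor of an exponential moment: 1/2 for an element of the set on side `b`, 3/2 for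
  -- one on the wrong side, 1 outside the set. The mean is 2 in each case.
  penalty : Bool → Bool → Bool → ℕ
  penalty b s c = if s then (if is? b c then 1 else 3) else 2

  penalty-avg : ∀ b s → penalty b s true + penalty b s false ≡ 4
  penalty-avg true  true  = refl
  penalty-avg false true  = refl
  penalty-avg b     false = refl

  ∏-penalty : ∀ N b (S χ : Fin N → Bool) →
    ∏ N (λ x → penalty b (S x) (χ x)) * (2 ^ card (λ x → S x ∧ is? b (χ x)) * 2 ^ card (λ x → S x ∧ not (is? b (χ x)))) ≡
    2 ^ N * 3 ^ card (λ x → S x ∧ not (is? b (χ x)))
  ∏-penalty zero    b S χ = refl
  ∏-penalty (suc N) b S χ = step
    where
    S′ χ′ : Fin N → Bool
    S′ x = S (suc x)
    χ′ x = χ (suc x)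
    p u v v₀ : ℕ
    p  = ∏ N (λ x → penalty b (S′ x) (χ′ x))
    u  = 2 ^ card (λ x → S′ x ∧ is? b (χ′ x))
    v₀ = card (λ x → S′ x ∧ not (is? b (χ′ x)))
    v  = 2 ^ v₀
    lemma : ∀ p a b → 2 * p * (a * b) ≡ 2 * (p * (a * b))
    lemma = solve-∀
    lemma₁ : ∀ p a b → 1 * p * (2 * a * b) ≡ 2 * (p * (a * b))
    lemma₁ = solve-∀
    lemma₃ : ∀ p a b → 3 * p * (a * (2 * b)) ≡ 6 * (p * (a * b))
    lemma₃ = solve-∀
    lemma′ : ∀ p a → 6 * (p * a) ≡ 2 * p * (3 * a)
    lemma′ = solve-∀
    step : ∏ (suc N) (λ x → penalty b (S x) (χ x)) *
      (2 ^ card (λ x → S x ∧ is? b (χ x)) * 2 ^ card (λ x → S x ∧ not (is? b (χ x)))) ≡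
      2 ^ suc N * 3 ^ card (λ x → S x ∧ not (is? b (χ x)))
    step rewrite card-suc (λ x → S x ∧ is? b (χ x)) | card-suc (λ x → S x ∧ not (is? b (χ x)))
      with S zero | is? b (χ zero) | ∏-penalty N b S′ χ′
    ... | false | _     | ih = trans (lemma p u v) (trans (cong (2 *_) ih) (sym (*-assoc 2 (2 ^ N) _)))
    ... | true  | true  | ih = trans (lemma₁ p u v) (trans (cong (2 *_) ih) (sym (*-assoc 2 (2 ^ N) _)))
    ... | true  | false | ih = trans (lemma₃ p u v) (trans (cong (6 *_) ih) (lemma′ (2 ^ N) (3 ^ v₀)))

  -- If 3 u < v, then the sixth power of the hypothesis, 8 ≤ 9 and 6 (u + v) ≤ 8 v give 2^(9v) ≤
  -- 3^(6v) ≤ Y^6 2^(8v). So 2^v ≤ Y^6, although v ≥ M₀.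
  balanced : ∀ Y M₀ u v → 3 ^ v ≤ Y * (2 ^ u * 2 ^ v) → Y ^ 6 < 2 ^ M₀ → 2 * M₀ ≤ u + v → u + v ≤ 4 * u
  balanced Y M₀ u v le Y-small big with u + v ≤? 4 * u
  ... | yes p = p
  ... | no  p = ⊥-elim (<-irrefl refl (<-≤-trans Y-small (≤-trans (^-monoʳ-≤ 2 M₀≤v) 2^v≤Y⁶)))
    where
    open ≤-Reasoning
    3u≤v : 3 * u ≤ v
    3u≤v = <⇒≤ (+-cancelˡ-< u (3 * u) v (≰⇒> p))
    u≤v : u ≤ v
    u≤v = ≤-trans (m≤m+n u _) 3u≤v
    M₀≤v : M₀ ≤ v
    M₀≤v = *-cancelˡ-≤ 2 (≤-trans big (≤-trans (+-monoˡ-≤ v u≤v) (≤-reflexive (cong (v +_) (sym (+-identityʳ v))))))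
    lemma : ∀ v → (3 * v) * 3 ≡ 8 * v + v
    lemma = solve-∀
    2^v≤Y⁶ : 2 ^ v ≤ Y ^ 6
    2^v≤Y⁶ = *-cancelˡ-≤ (2 ^ (8 * v)) {{m^n≢0 2 (8 * v)}} (begin
      2 ^ (8 * v) * 2 ^ v               ≡⟨ ^-distribˡ-+-* 2 (8 * v) v ⟨
      2 ^ (8 * v + v)                   ≡⟨ cong (2 ^_) (lemma v) ⟨
      2 ^ (3 * v * 3)                   ≡⟨ ^-*-assoc 2 (3 * v) 3 ⟨
      (2 ^ (3 * v)) ^ 3                 ≡⟨ cong (_^ 3) (^-*-assoc 2 3 v) ⟨
      (8 ^ v) ^ 3                       ≤⟨ ^-monoˡ-≤ 3 (^-monoˡ-≤ v (n≤1+n 8)) ⟩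
      (9 ^ v) ^ 3                       ≡⟨ cong (_^ 3) (trans (^-*-assoc 3 2 v) (trans (cong (3 ^_) (*-comm 2 v)) (sym (^-*-assoc 3 v 2)))) ⟩
      ((3 ^ v) ^ 2) ^ 3                 ≡⟨ ^-*-assoc (3 ^ v) 2 3 ⟩
      (3 ^ v) ^ 6                       ≤⟨ ^-monoˡ-≤ 6 le ⟩
      (Y * (2 ^ u * 2 ^ v)) ^ 6         ≡⟨ cong (λ z → (Y * z) ^ 6) (^-distribˡ-+-* 2 u v) ⟨
      (Y * 2 ^ (u + v)) ^ 6             ≡⟨ ^-distribʳ-* Y (2 ^ (u + v)) 6 ⟩
      Y ^ 6 * (2 ^ (u + v)) ^ 6         ≡⟨ cong (Y ^ 6 *_) (^-*-assoc 2 (u + v) 6) ⟩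
      Y ^ 6 * 2 ^ ((u + v) * 6)         ≤⟨ *-monoʳ-≤ (Y ^ 6) (^-monoʳ-≤ 2 exponents) ⟩
      Y ^ 6 * 2 ^ (8 * v)               ≡⟨ *-comm (Y ^ 6) _ ⟩
      2 ^ (8 * v) * Y ^ 6 ∎)
      where
      split : ∀ u v → (u + v) * 6 ≡ 2 * (3 * u) + 6 * v
      split = solve-∀
      join : ∀ v → 2 * v + 6 * v ≡ 8 * v
      join = solve-∀
      exponents : (u + v) * 6 ≤ 8 * v
      exponents = begin
        (u + v) * 6         ≡⟨ split u v ⟩
        2 * (3 * u) + 6 * v ≤⟨ +-monoˡ-≤ (6 * v) (*-monoʳ-≤ 2 3u≤v) ⟩
        2 * v + 6 * v       ≡⟨ join v ⟩
        8 * v ∎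

  -- A derandomised Chernoff bound. Each set enters once for either side, whence the factor 2 beside
  -- `length is`; the total penalty bounds every single one.
  halve : ∀ (is : List I) (S : I → Fin N → Bool) M₀ → (2 * length is) ^ 6 < 2 ^ M₀ →
    ∃ λ (χ : Fin N → Bool) → ∀ b {i} → i ∈ is → 2 * M₀ ≤ card (S i) → card (S i) ≤ 4 * card (λ x → S i x ∧ is? b (χ x))
  halve {I} {N} is S M₀ Y-small = χ , even
    where
    Y : ℕ
    Y = 2 * length is
    tag : Bool → I → Bool × I
    tag b i = b , i
    js : List (Bool × I)
    js = map (tag true) is ++ᴸ map (tag false) is
    length-js : ∑ js (λ _ → 1) ≡ Y
    length-js = trans (sym (length-∑ js)) (trans (length-++ (map (tag true) is))
      (cong₂ _+_ (length-map (tag true) is) (trans (length-map (tag false) is) (sym (+-identityʳ _)))))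
    a : Bool × I → Fin N → Bool → ℕ
    a (b , i) x c = penalty b (S i x) c
    choice : ∃ λ (χ : Fin N → Bool) → ∑ js (λ j → 1 * ∏ N (λ x → a j x (χ x))) ≤ 2 ^ N * ∑ js (λ _ → 1)
    choice = derandomise N js (λ _ → 1) a (λ { (b , i) x → penalty-avg b (S i x) })
    χ : Fin N → Bool
    χ = proj₁ choice
    ∈-js : ∀ b {i} → i ∈ is → (b , i) ∈ js
    ∈-js true  i∈ = ∈-++⁺ˡ (∈-map⁺ (tag true) i∈)
    ∈-js false i∈ = ∈-++⁺ʳ _ (∈-map⁺ (tag false) i∈)
    split : ∀ b s c → ⟦ s ⟧ ≡ ⟦ s ∧ is? b c ⟧ + ⟦ s ∧ not (is? b c) ⟧
    split b false c = refl
    split b true  c with is? b c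
    ... | true  = refl
    ... | false = refl
    even : ∀ b {i} → i ∈ is → 2 * M₀ ≤ card (S i) → card (S i) ≤ 4 * card (λ x → S i x ∧ is? b (χ x))
    even b {i} i∈ big = subst (_≤ 4 * u) (sym total) (balanced Y M₀ u v 3^v≤ Y-small (subst (2 * M₀ ≤_) total big))
      where
      u v Π : ℕ
      u = card (λ x → S i x ∧ is? b (χ x))
      v = card (λ x → S i x ∧ not (is? b (χ x)))
      Π = ∏ N (λ x → a (b , i) x (χ x))
      total : card (S i) ≡ u + v
      total = trans (∑-cong (allFin N) (λ x → split b (S i x) (χ x))) (∑-+ (allFin N) _ _)
      open ≤-Reasoning
      3^v≤ : 3 ^ v ≤ Y * (2 ^ u * 2 ^ v)
      3^v≤ = *-cancelˡ-≤ (2 ^ N) {{m^n≢0 2 N}} (begin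
        2 ^ N * 3 ^ v                 ≡⟨ ∏-penalty N b (S i) χ ⟨
        Π * (2 ^ u * 2 ^ v)           ≤⟨ *-monoˡ-≤ (2 ^ u * 2 ^ v) (begin
          Π                                                ≡⟨ *-identityˡ Π ⟨
          1 * Π                                            ≤⟨ term≤∑ (λ j → 1 * ∏ N (λ x → a j x (χ x))) (∈-js b i∈) ⟩
          ∑ js (λ j → 1 * ∏ N (λ x → a j x (χ x)))         ≤⟨ proj₂ choice ⟩
          2 ^ N * ∑ js (λ _ → 1)                           ≡⟨ cong (2 ^ N *_) length-js ⟩
          2 ^ N * Y ∎) ⟩
        2 ^ N * Y * (2 ^ u * 2 ^ v)   ≡⟨ *-assoc (2 ^ N) Y _ ⟩
        2 ^ N * (Y * (2 ^ u * 2 ^ v)) ∎)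

  -- Region j is cut off from what the first j regions left over by a partition halving every large set of the family.
  module Regions (is : List I) (S : I → Fin N → Bool) (M₀ : ℕ) (Y-small : (2 * length is) ^ 6 < 2 ^ M₀) where

    cutting : (Fin N → Bool) → Fin N → Bool
    cutting Z = proj₁ (halve is (λ i x → S i x ∧ Z x) M₀ Y-small)

    rest : ℕ → Fin N → Bool
    rest zero    x = true
    rest (suc j) x = rest j x ∧ not (cutting (rest j) x)

    region : ℕ → Fin N → Bool
    region j x = rest j x ∧ cutting (rest j) x

    rest-≤ : ∀ {j j′} x → j ≤ j′ → rest j′ x ≡ true → rest j x ≡ true
    rest-≤ {zero}  x j≤ e = refl
    rest-≤ {suc j} {suc j′} x j≤ e with m≤n⇒m<n∨m≡n j≤
    ... | inj₂ refl = e
    ... | inj₁ (s≤s j<) with rest j′ x in eq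
    ...   | true = rest-≤ {suc j} {j′} x j< eq

    region-disjoint-< : ∀ {j j′} x → j < j′ → region j x ≡ true → region j′ x ≡ true → ⊥
    region-disjoint-< {j} {j′} x j< e e′ with rest j′ x in eq
    ... | true with rest j x | cutting (rest j) x | rest-≤ {suc j} {j′} x j< eq
    ...   | true  | true  | ()
    ...   | true  | false | _ with () ← e
    ...   | false | _     | _ with () ← e

    region-disjoint : ∀ {j j′} x → region j x ≡ true → region j′ x ≡ true → j ≡ j′
    region-disjoint {j} {j′} x e e′ with <-cmp j j′
    ... | tri< j< _ _ = ⊥-elim (region-disjoint-< x j< e e′)
    ... | tri≈ _ j≡ _ = j≡
    ... | tri> _ _ j> = ⊥-elim (region-disjoint-< x j> e′ e)

    halved : ∀ b {i} j → i ∈ is → 2 * M₀ ≤ card (λ x → S i x ∧ rest j x) →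
      card (λ x → S i x ∧ rest j x) ≤ 4 * card (λ x → (S i x ∧ rest j x) ∧ is? b (cutting (rest j) x))
    halved b j = proj₂ (halve is (λ i x → S i x ∧ rest j x) M₀ Y-small) b

    -- Every cut leaves at least a quarter of a set that still has `2 * M₀` elements. The initial
    -- size guarantees that this threshold survives `j` cuts, which is why the two statements are
    -- proved together.
    rest-large : ∀ {i} j → i ∈ is → 4 ^ j * (2 * M₀) ≤ card (S i) → card (S i) ≤ 4 ^ j * card (λ x → S i x ∧ rest j x)
    rest-still-large : ∀ {i} j → i ∈ is → 4 ^ j * (2 * M₀) ≤ card (S i) → 2 * M₀ ≤ card (λ x → S i x ∧ rest j x)

    rest-still-large j i∈ big = *-cancelˡ-≤ (4 ^ j) {{m^n≢0 4 j}} (≤-trans big (rest-large j i∈ big))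

    rest-large {i} zero i∈ big = ≤-reflexive (trans (card-cong (λ x → sym (∧-identityʳ (S i x)))) (sym (*-identityˡ _)))
    rest-large {i} (suc j) i∈ big = begin
      card (S i)                                   ≤⟨ rest-large j i∈ big′ ⟩
      4 ^ j * card (λ x → S i x ∧ rest j x)        ≤⟨ *-monoʳ-≤ (4 ^ j) (halved false j i∈ (rest-still-large j i∈ big′)) ⟩
      4 ^ j * (4 * card (λ x → (S i x ∧ rest j x) ∧ not (cutting (rest j) x))) ≡⟨ lemma (4 ^ j) _ ⟩
      4 * 4 ^ j * card (λ x → (S i x ∧ rest j x) ∧ not (cutting (rest j) x))
        ≡⟨ cong (4 * 4 ^ j *_) (card-cong (λ x → ∧-assoc (S i x) (rest j x) _)) ⟩
      4 ^ suc j * card (λ x → S i x ∧ rest (suc j) x) ∎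
      where
      open ≤-Reasoning
      lemma : ∀ a b → a * (4 * b) ≡ 4 * a * b
      lemma = solve-∀
      big′ : 4 ^ j * (2 * M₀) ≤ card (S i)
      big′ = ≤-trans (*-monoˡ-≤ (2 * M₀) (^-monoʳ-≤ 4 (n≤1+n j))) big

    region-large : ∀ {i} j → i ∈ is → 4 ^ j * (2 * M₀) ≤ card (S i) →
      card (S i) ≤ 4 ^ suc j * card (λ x → S i x ∧ region j x)
    region-large {i} j i∈ big = begin
      card (S i)                                   ≤⟨ rest-large j i∈ big ⟩
      4 ^ j * card (λ x → S i x ∧ rest j x)        ≤⟨ *-monoʳ-≤ (4 ^ j) (halved true j i∈ (rest-still-large j i∈ big)) ⟩
      4 ^ j * (4 * card (λ x → (S i x ∧ rest j x) ∧ cutting (rest j) x)) ≡⟨ lemma (4 ^ j) _ ⟩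
      4 * 4 ^ j * card (λ x → (S i x ∧ rest j x) ∧ cutting (rest j) x)
        ≡⟨ cong (4 * 4 ^ j *_) (card-cong (λ x → ∧-assoc (S i x) (rest j x) _)) ⟩
      4 ^ suc j * card (λ x → S i x ∧ region j x) ∎
      where
      open ≤-Reasoning
      lemma : ∀ a b → a * (4 * b) ≡ 4 * a * b
      lemma = solve-∀

open Halving

-- Constraints imposed by partially embedded edges.

module Constraints where

  private variable
    A X V : Set
    n r t p : ℕ

  ∧-true : ∀ {a b} → a ∧ b ≡ true → a ≡ true × b ≡ true
  ∧-true {true} e = refl , e

  true-∧ : ∀ {a b} → a ≡ true → b ≡ true → a ∧ b ≡ true
  true-∧ refl e = e

  true-or-false : ∀ b → b ≡ true ⊎ b ≡ false
  true-or-false true  = inj₁ refl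
  true-or-false false = inj₂ refl

  anyList-∈ : ∀ {f : A → Bool} {xs x} → x ∈ xs → f x ≡ true → anyList f xs ≡ true
  anyList-∈ {f = f} (here refl) e rewrite e = refl
  anyList-∈ {f = f} {y ∷ xs} (there x∈) e with f y
  ... | true  = refl
  ... | false = anyList-∈ x∈ e

  anyList-witness : ∀ {f : A → Bool} xs → anyList f xs ≡ true → ∃ λ x → x ∈ xs × f x ≡ true
  anyList-witness {f = f} (x ∷ xs) e with f x in eq
  ... | true  = x , here refl , eq
  ... | false with anyList-witness xs e
  ...   | y , y∈ , fy = y , there y∈ , fy

  ∈-filterᵇ⁺ : ∀ {f : A → Bool} {xs x} → x ∈ xs → f x ≡ true → x ∈ filterᵇ f xs
  ∈-filterᵇ⁺ (here refl) e rewrite e = here refl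
  ∈-filterᵇ⁺ {f = f} {y ∷ xs} (there x∈) e with f y
  ... | true  = there (∈-filterᵇ⁺ x∈ e)
  ... | false = ∈-filterᵇ⁺ x∈ e

  ∈-filterᵇ⁻ : ∀ {f : A → Bool} xs {x} → x ∈ filterᵇ f xs → f x ≡ true
  ∈-filterᵇ⁻ {f = f} (y ∷ xs) x∈ with f y in eq
  ∈-filterᵇ⁻ (y ∷ xs) (here refl) | true  = eq
  ∈-filterᵇ⁻ (y ∷ xs) (there x∈)  | true  = ∈-filterᵇ⁻ xs x∈
  ∈-filterᵇ⁻ (y ∷ xs) x∈          | false = ∈-filterᵇ⁻ xs x∈

  lookup-ext : {u v : Vec A n} → (∀ i → lookup u i ≡ lookup v i) → u ≡ v
  lookup-ext {u = []}    {[]}    h = refl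
  lookup-ext {u = x ∷ u} {y ∷ v} h = cong₂ _∷_ (h zero) (lookup-ext (λ i → h (suc i)))

  count : (X → Bool) → Vec X t → ℕ
  count p []      = 0
  count p (x ∷ o) = if p x then suc (count p o) else count p o

  filterSel : (p : X → Bool) (o : Vec X t) → Sel t (count p o)
  filterSel p []      = done
  filterSel p (x ∷ o) with p x
  ... | true  = keep (filterSel p o)
  ... | false = drop (filterSel p o)

  slot : (p q : X → Bool) (o : Vec X t) → Maybe (Fin (count p o))
  slot p q []      = nothing
  slot p q (x ∷ o) with p x | q x
  ... | true  | true  = just zero
  ... | true  | false = Maybe.map suc (slot p q o)
  ... | false | _     = slot p q o

  found : (X → Bool) → Vec X t → Vec V t → Maybe V
  found q []      []      = nothing
  found q (x ∷ o) (y ∷ h) = if q x then just y else found q o h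

  -- As `q` implies `p`, the first vertex with `q` survives the selection by `p`; `slot` is its
  -- position there, so reading the selected images at `slot` recovers its image.
  slot-found : (p q : X → Bool) → (∀ x → q x ≡ true → p x ≡ true) → (o : Vec X t) (h : Vec V t) →
    Maybe.map (lookup (select (filterSel p o) h)) (slot p q o) ≡ found q o h
  slot-found p q sub []      []      = refl
  slot-found p q sub (x ∷ o) (y ∷ h) with p x | q x | sub x
  ... | true  | true  | _ = refl
  ... | true  | false | _ = trans (sym (Maybe.map-∘ (slot p q o))) (slot-found p q sub o h)
  ... | false | true  | s with () ← s refl
  ... | false | false | _ = slot-found p q sub o h

  transversal-lookup : ∀ (T : Vec (Vec A p) r) τ i a →
    transversal T (τ [ i ]≔ a) ≡ transversal T τ [ i ]≔ lookup (lookup T i) a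
  transversal-lookup (x ∷ T) (b ∷ τ) zero    a = refl
  transversal-lookup (x ∷ T) (b ∷ τ) (suc i) a = cong (_ ∷_) (transversal-lookup T τ i a)

  fill-nothing : ∀ (m : Vec (Maybe A) r) x i (y : A) → lookup m i ≡ nothing → fill m (x [ i ]≔ y) ≡ fill m x [ i ]≔ y
  fill-nothing (m ∷ ms) (x ∷ xs) zero    y refl = refl
  fill-nothing (m ∷ ms) (x ∷ xs) (suc i) y e    = cong (_ ∷_) (fill-nothing ms xs i y e)

  -- The vertices of H come with their colours, i.e. with the parts into which they are to be embedded.
  module Embedded {n r : ℕ} (es : List (Subset n)) where

    Vertex : Set
    Vertex = Fin n × Fin r

    adjacent : Fin n → Vertex → Bool
    adjacent v (u , _) = anyList (λ e → lookup e u ∧ lookup e v) es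

    record Extends (d : ℕ) (x : Vertex) (o : Vec Vertex t) : Set where
      constructor extends
      field
        few    : count (adjacent (proj₁ x)) o ≤ d
        proper : All (λ y → adjacent (proj₁ x) y ≡ true → proj₂ y ≢ proj₂ x) o
    open Extends public

    Ordered : ℕ → Vec Vertex t → Set
    Ordered d []      = ⊤
    Ordered d (x ∷ o) = Extends d x o × Ordered d o

    hits : Subset n → Fin r → Vertex → Bool
    hits e j (u , c) = lookup e u ∧ ⌊ c ≟ j ⌋

    -- Under a proper colouring an edge has at most one embedded vertex per part, so recording the
    -- first one found loses nothing.
    occupied : Subset n → Vec Vertex t → Vec V t → Vec (Maybe V) r
    occupied e o h = tabulate (λ j → found (hits e j) o h)

    link : Subset n → (o : Vec Vertex t) (v : Fin n) → Vec (Maybe (Fin (count (adjacent v) o))) r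
    link e o v = tabulate (λ j → slot (adjacent v) (hits e j) o)

    -- A test by which `allLinks` is filtered, instead of a direct list of the links of the edges:
    -- thus the pattern of any vertex with few earlier neighbours lies in the finite list
    -- `patterns`.
    isLink : (o : Vec Vertex t) (v : Fin n) → Vec (Maybe (Fin (count (adjacent v) o))) r → Bool
    isLink o v m = anyList (λ e → lookup e v ∧ ⌊ Vec.≡-dec (Maybe.≡-dec _≟_) (link e o v) m ⌋) es

    pattern-of : (o : Vec Vertex t) → Vertex → Pattern r
    pattern-of o (v , i) = pat (count (adjacent v) o) i (filterᵇ (isLink o v) (allLinks r (count (adjacent v) o)))

    neighbours : (o : Vec Vertex t) (x : Vertex) → Sel t (size (pattern-of o x))
    neighbours o (v , i) = filterSel (adjacent v) o

    link-occupied : ∀ {e} → e ∈ es → (o : Vec Vertex t) (x : Vertex) (h : Vec V t) → lookup e (proj₁ x) ≡ true →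
      Vec.map (Maybe.map (lookup (select (neighbours o x) h))) (link e o (proj₁ x)) ≡ occupied e o h
    link-occupied {e = e} e∈ o (v , i) h ev = trans (sym (Vec.tabulate-∘ _ _)) (Vec.tabulate-cong λ j →
      slot-found (adjacent v) (hits e j) (λ { (u , c) q → anyList-∈ e∈ (true-∧ (proj₁ (∧-true q)) ev) }) o h)

    -- An embedded vertex of `e` in the part of `x` would be a neighbour of `x` with the same
    -- colour.
    found-nothing : ∀ {e} → e ∈ es → (o : Vec Vertex t) (x : Vertex) (h : Vec V t) → lookup e (proj₁ x) ≡ true →
      All (λ y → adjacent (proj₁ x) y ≡ true → proj₂ y ≢ proj₂ x) o → found (hits e (proj₂ x)) o h ≡ nothing
    found-nothing e∈ [] x [] ev [] = refl
    found-nothing {e = e} e∈ ((u , c) ∷ o) (v , i) (y ∷ h) ev (c≢ ∷ rest) with lookup e u in eq | c ≟ i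
    ... | false | _      = found-nothing e∈ o (v , i) h ev rest
    ... | true  | no _   = found-nothing e∈ o (v , i) h ev rest
    ... | true  | yes c≡ = ⊥-elim (c≢ (anyList-∈ e∈ (true-∧ eq ev)) c≡)

    lookup-fill : ∀ (m : Vec (Maybe V) r) x j → lookup (fill m x) j ≡ fromMaybe (lookup x j) (lookup m j)
    lookup-fill m x j = Vec.lookup-zipWith _ j m x

    lookup-occupied : ∀ e (o : Vec Vertex t) (h : Vec V t) x j →
      lookup (fill (occupied e o h) x) j ≡ fromMaybe (lookup x j) (found (hits e j) o h)
    lookup-occupied e o h x j = trans (lookup-fill (occupied e o h) x j)
      (cong (fromMaybe (lookup x j)) (Vec.lookup∘tabulate (λ j → found (hits e j) o h) j))

    fill-in : ∀ {e v} i (o : Vec Vertex t) (h : Vec V t) y x → lookup e v ≡ true →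
      fill (occupied e ((v , i) ∷ o) (y ∷ h)) x ≡ fill (occupied e o h) x [ i ]≔ y
    fill-in {e = e} {v} i o h y x ev = lookup-ext pointwise
      where
      pointwise : ∀ j → lookup (fill (occupied e ((v , i) ∷ o) (y ∷ h)) x) j ≡ lookup (fill (occupied e o h) x [ i ]≔ y) j
      pointwise j rewrite lookup-occupied e ((v , i) ∷ o) (y ∷ h) x j | ev with i ≟ j
      ... | yes refl = sym (Vec.lookup∘update i (fill (occupied e o h) x) y)
      ... | no i≢j   = sym (trans (Vec.lookup∘update′ (λ j≡i → i≢j (sym j≡i)) (fill (occupied e o h) x) y) (lookup-occupied e o h x j))

    fill-out : ∀ {e v} i (o : Vec Vertex t) (h : Vec V t) y x → lookup e v ≡ false →
      fill (occupied e ((v , i) ∷ o) (y ∷ h)) x ≡ fill (occupied e o h) x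
    fill-out {e = e} {v} i o h y x ev = lookup-ext pointwise
      where
      pointwise : ∀ j → lookup (fill (occupied e ((v , i) ∷ o) (y ∷ h)) x) j ≡ lookup (fill (occupied e o h) x) j
      pointwise j rewrite lookup-occupied e ((v , i) ∷ o) (y ∷ h) x j | ev = sym (lookup-occupied e o h x j)

    -- Every edge of H, its missing vertices being replaced by arbitrary entries of T, is sent into G.
    Valid : (G : Vec V r → Bool) → Vec (Vec V p) r → Vec Vertex t → Vec V t → Set
    Valid G T o h = ∀ {e} → e ∈ es → ∀ τ → G (fill (occupied e o h) (transversal T τ)) ≡ true

    module _ {V : Set} {p : ℕ} (G : Vec V r → Bool) (T : Vec (Vec V p) r) where
      open Candidates G T

      valid-[] : (∀ τ → G (transversal T τ) ≡ true) → Valid G T [] []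
      valid-[] complete {e} e∈ τ = subst (λ z → G z ≡ true)
        (sym (lookup-ext (λ j → lookup-occupied e [] [] (transversal T τ) j))) (complete τ)

      -- Edges avoiding the new vertex are unaffected; for an edge through it, the condition is one
      -- of those tested by `candidate`.
      valid-∷ : ∀ (o : Vec Vertex t) x (h : Vec V t) y → Valid G T o h →
        candidate (pattern-of o x) (select (neighbours o x) h) y ≡ true → Valid G T (x ∷ o) (y ∷ h)
      valid-∷ o (v , i) h y valid cand {e} e∈ τ with true-or-false (lookup e v)
      ... | inj₂ ev = subst (λ z → G z ≡ true) (sym (fill-out {e = e} {v} i o h y (transversal T τ) ev)) (valid e∈ τ)
      ... | inj₁ ev = subst (λ z → G z ≡ true) (begin
        fill (Vec.map (Maybe.map (lookup (select (neighbours o (v , i)) h))) (link e o v)) (transversal T τ) [ i ]≔ y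
          ≡⟨ cong (λ m → fill m (transversal T τ) [ i ]≔ y) (link-occupied e∈ o (v , i) h ev) ⟩
        fill (occupied e o h) (transversal T τ) [ i ]≔ y
          ≡⟨ fill-in {e = e} {v} i o h y (transversal T τ) ev ⟨
        fill (occupied e ((v , i) ∷ o) (y ∷ h)) (transversal T τ) ∎)
        (allOf-∈ {f = checks-of (link e o v)} (allOf-∈ {xs = links (pattern-of o (v , i))} {f = λ m → allOf (vecs (allFin p) r) (checks-of m)} cand
          (∈-filterᵇ⁺ {f = isLink o v} (∈-allLinks (link e o v)) linked)) (∈-vecs ∈-allFin τ))
        where
        open ≡-Reasoning
        checks-of : Vec (Maybe (Fin (count (adjacent v) o))) r → Vec (Fin p) r → Bool
        checks-of m τ = G (fill (Vec.map (Maybe.map (lookup (select (neighbours o (v , i)) h))) m) (transversal T τ) [ i ]≔ y)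
        linked : isLink o v (link e o v) ≡ true
        linked = anyList-∈ {f = λ e′ → lookup e′ v ∧ ⌊ Vec.≡-dec (Maybe.≡-dec _≟_) (link e′ o v) (link e o v) ⌋} e∈
          (true-∧ ev (true-⌊⌋ (Vec.≡-dec (Maybe.≡-dec _≟_) (link e o v) (link e o v)) refl))

      -- Before `x` is embedded, its part is vacant in every edge through it and hence filled from
      -- `T`. Validity at `τ` with entry `i` changed to `a` says that the `a`-th entry of that block
      -- passes the test.
      valid-live : ∀ {d} (o : Vec Vertex t) x (h : Vec V t) → Valid G T o h → Extends d x o →
        live (pattern-of o x) (select (neighbours o x) h) ≡ true
      valid-live o x@(v , i) h valid ext = allVec-lookup (lookup T i) λ a →
        allOf-intro (links (pattern-of o x)) λ {m} m∈ → allOf-intro (vecs (allFin p) r) λ {τ} _ → through a m τ (∈-filterᵇ⁻ (allLinks r _) m∈)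
        where
        through : ∀ a m τ → isLink o v m ≡ true →
          G (fill (Vec.map (Maybe.map (lookup (select (neighbours o x) h))) m) (transversal T τ) [ i ]≔ lookup (lookup T i) a) ≡ true
        through a m τ ism with anyList-witness es ism
        ... | e , e∈ , ok with ∧-true ok
        ...   | ev , dec with ⌊⌋-true (Vec.≡-dec (Maybe.≡-dec _≟_) (link e o v) m) dec
        ...     | refl = subst (λ z → G z ≡ true) (begin
          fill (occupied e o h) (transversal T (τ [ i ]≔ a))
            ≡⟨ cong (fill (occupied e o h)) (transversal-lookup T τ i a) ⟩
          fill (occupied e o h) (transversal T τ [ i ]≔ lookup (lookup T i) a)
            ≡⟨ fill-nothing (occupied e o h) (transversal T τ) i _
                 (trans (Vec.lookup∘tabulate _ i) (found-nothing e∈ o x h ev (proper ext))) ⟩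
          fill (occupied e o h) (transversal T τ) [ i ]≔ lookup (lookup T i) a
            ≡⟨ cong (λ m → fill m (transversal T τ) [ i ]≔ lookup (lookup T i) a) (link-occupied e∈ o x h ev) ⟨
          fill (Vec.map (Maybe.map (lookup (select (neighbours o x) h))) (link e o v)) (transversal T τ) [ i ]≔ lookup (lookup T i) a ∎)
          (valid e∈ (τ [ i ]≔ a))
          where open ≡-Reasoning

open Constraints

-- Injectivity of a typical run.

module Embeddings where

  private variable
    n r t p N : ℕ

  ∑-δ : ∀ N (z : Fin N) → ∑ (allFin N) (λ y → ⟦ ⌊ y ≟ z ⌋ ⟧) ≡ 1
  ∑-δ (suc N) zero    = trans (∑-allFin-suc N (λ y → ⟦ ⌊ y ≟ zero ⌋ ⟧)) (cong suc (∑-zero (allFin N)))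
  ∑-δ (suc N) (suc z) = trans (∑-allFin-suc N (λ y → ⟦ ⌊ y ≟ suc z ⌋ ⟧))
    (trans (∑-cong (allFin N) (λ y → cong ⟦_⟧ (same y))) (∑-δ N z))
    where
    same : ∀ y → ⌊ suc y ≟ suc z ⌋ ≡ ⌊ y ≟ z ⌋
    same y with y ≟ z
    ... | yes _ = refl
    ... | no _  = refl

  card-mono : {S T : Fin N → Bool} → (∀ x → S x ≡ true → T x ≡ true) → card S ≤ card T
  card-mono {N} {S} {T} sub = ∑-mono (allFin N) λ x → pointwise (S x) (T x) (sub x)
    where
    pointwise : ∀ a b → (a ≡ true → b ≡ true) → ⟦ a ⟧ ≤ ⟦ b ⟧
    pointwise false b h = z≤n
    pointwise true  b h rewrite h refl = ≤-refl

  card≥1 : {S : Fin N → Bool} (x : Fin N) → S x ≡ true → 1 ≤ card S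
  card≥1 {S = S} x e = subst (λ b → ⟦ b ⟧ ≤ card S) e (term≤∑ (λ x → ⟦ S x ⟧) (∈-allFin x))

  card-split : (S T : Fin N → Bool) → card S ≡ card (λ x → S x ∧ T x) + card (λ x → S x ∧ not (T x))
  card-split {N} S T = trans (∑-cong (allFin N) (λ x → lemma (S x) (T x))) (∑-+ (allFin N) _ _)
    where
    lemma : ∀ a b → ⟦ a ⟧ ≡ ⟦ a ∧ b ⟧ + ⟦ a ∧ not b ⟧
    lemma false b     = refl
    lemma true  true  = refl
    lemma true  false = refl

  used : Vec (Fin N) t → Fin N → Bool
  used []      y = false
  used (z ∷ h) y = ⌊ y ≟ z ⌋ ∨ used h y

  Distinct : Vec (Fin N) t → Set
  Distinct []      = ⊤
  Distinct (y ∷ h) = used h y ≡ false × Distinct h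

  countIn : (Fin N → Bool) → Vec (Fin N) t → ℕ
  countIn R []      = 0
  countIn R (y ∷ h) = ⟦ R y ⟧ + countIn R h

  card-used : ∀ (R : Fin N → Bool) (h : Vec (Fin N) t) → card (λ y → used h y ∧ R y) ≤ countIn R h
  card-used {N} R []      = ≤-reflexive (∑-zero (allFin N))
  card-used {N} R (z ∷ h) = begin
    card (λ y → used (z ∷ h) y ∧ R y)                               ≤⟨ ∑-mono (allFin N) pointwise ⟩
    ∑ (allFin N) (λ y → ⟦ ⌊ y ≟ z ⌋ ⟧ * ⟦ R z ⟧ + ⟦ used h y ∧ R y ⟧) ≡⟨ ∑-+ (allFin N) _ _ ⟩
    ∑ (allFin N) (λ y → ⟦ ⌊ y ≟ z ⌋ ⟧ * ⟦ R z ⟧) + card (λ y → used h y ∧ R y)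
      ≡⟨ cong (_+ card (λ y → used h y ∧ R y)) (trans (∑-*ʳ (allFin N) ⟦ R z ⟧ _) (trans (cong (_* ⟦ R z ⟧) (∑-δ N z)) (*-identityˡ _))) ⟩
    ⟦ R z ⟧ + card (λ y → used h y ∧ R y)                           ≤⟨ +-monoʳ-≤ ⟦ R z ⟧ (card-used R h) ⟩
    ⟦ R z ⟧ + countIn R h ∎
    where
    open ≤-Reasoning
    pointwise : ∀ y → ⟦ used (z ∷ h) y ∧ R y ⟧ ≤ ⟦ ⌊ y ≟ z ⌋ ⟧ * ⟦ R z ⟧ + ⟦ used h y ∧ R y ⟧
    pointwise y with y ≟ z
    ... | yes refl = ≤-trans (≤-reflexive (sym (*-identityˡ _))) (m≤m+n _ _)
    ... | no _     = ≤-refl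

  module Choices (region : Fin N → Bool) (j : ℕ) (S : Fin N → Bool) (h : Vec (Fin N) t) where

    inRegion : Fin N → Bool
    inRegion y = S y ∧ region y

    abstract
      spread : Bool
      spread = ⌊ card S ≤? 4 ^ suc j * card inRegion ⌋

      preferred : Fin N → Bool
      preferred y = if spread then inRegion y else S y

      fresh : Fin N → Bool
      fresh y = preferred y ∧ not (used h y)

      roomy : Bool
      roomy = ⌊ card preferred ≤? 2 * card fresh ⌋

      choices : Fin N → Bool
      choices y = if roomy then fresh y else preferred y

      choices⇒preferred : ∀ y → choices y ≡ true → preferred y ≡ true
      choices⇒preferred y e with roomy
      ... | true  = proj₁ (∧-true e)
      ... | false = e

      preferred⇒S : ∀ y → preferred y ≡ true → S y ≡ true
      preferred⇒S y e with spread
      ... | true  = proj₁ (∧-true e)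
      ... | false = e

      choices⇒S : ∀ y → choices y ≡ true → S y ≡ true
      choices⇒S y e = preferred⇒S y (choices⇒preferred y e)

      card-S≤preferred : card S ≤ 4 ^ suc j * card preferred
      card-S≤preferred with card S ≤? 4 ^ suc j * card inRegion
      ... | yes le = le
      ... | no _   = ≤-trans (≤-reflexive (sym (*-identityˡ _))) (*-monoˡ-≤ (card S) (m^n>0 4 (suc j)))

      card-preferred≤choices : card preferred ≤ 2 * card choices
      card-preferred≤choices with card preferred ≤? 2 * card fresh
      ... | yes le = le
      ... | no _   = m≤m+n _ _

      card-S≤choices : card S ≤ 4 ^ suc j * (2 * card choices)
      card-S≤choices = ≤-trans card-S≤preferred (*-monoʳ-≤ (4 ^ suc j) card-preferred≤choices)

      spread-choices : card S ≤ 4 ^ suc j * card inRegion → ∀ y → choices y ≡ true → region y ≡ true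
      spread-choices le y e with card S ≤? 4 ^ suc j * card inRegion | choices⇒preferred y e
      ... | yes _ | e′ = proj₂ (∧-true e′)
      ... | no ¬p | _  = ⊥-elim (¬p le)

      spread-used : card S ≤ 4 ^ suc j * card inRegion → card (λ y → preferred y ∧ used h y) ≤ card (λ y → used h y ∧ region y)
      spread-used le = card-mono λ y e → true-∧ (proj₂ (∧-true e)) (preferred⇒region y (proj₁ (∧-true e)))
        where
        preferred⇒region : ∀ y → preferred y ≡ true → region y ≡ true
        preferred⇒region y e with card S ≤? 4 ^ suc j * card inRegion
        ... | yes _ = proj₂ (∧-true e)
        ... | no ¬p = ⊥-elim (¬p le)

      roomy-choices : 2 * card (λ y → preferred y ∧ used h y) ≤ card preferred → ∀ y → choices y ≡ true → used h y ≡ false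
      roomy-choices le y e with card preferred ≤? 2 * card fresh
      ... | yes _ = not-true (proj₂ (∧-true e))
        where
        not-true : ∀ {b} → not b ≡ true → b ≡ false
        not-true {false} _ = refl
      ... | no ¬p = ⊥-elim (¬p (+-cancelˡ-≤ (2 * a) _ _ (begin
        2 * a + card preferred       ≤⟨ +-monoˡ-≤ (card preferred) le ⟩
        card preferred + card preferred ≡⟨ cong (card preferred +_) (+-identityʳ _) ⟨
        2 * card preferred           ≡⟨ cong (2 *_) (card-split preferred (used h)) ⟩
        2 * (a + card fresh)         ≡⟨ *-distribˡ-+ 2 a (card fresh) ⟩
        2 * a + 2 * card fresh ∎)))
        where
        open ≤-Reasoning
        a : ℕ
        a = card (λ y → preferred y ∧ used h y)

  4^j≡2^j*2^j : ∀ j → 4 ^ j ≡ 2 ^ j * 2 ^ j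
  4^j≡2^j*2^j = ^-distribʳ-* 2 2

  ^2-cancel-≤ : ∀ a b → a * a ≤ b * b → a ≤ b
  ^2-cancel-≤ a b le with a ≤? b
  ... | yes a≤b = a≤b
  ... | no  a≰b = ⊥-elim (<-irrefl refl (<-≤-trans (*-mono-< (≰⇒> a≰b) (≰⇒> a≰b)) le))

  probability-bound : ∀ N W D c i L → N ≤ W * D → D ≤ 8 * (W * W) * c → c * i ≡ L → N * (1 * i) ≤ L * (8 * W ^ 3)
  probability-bound N W D c i L N≤ D≤ refl = begin
    N * (1 * i)                  ≤⟨ *-monoˡ-≤ (1 * i) N≤ ⟩
    W * D * (1 * i)              ≤⟨ *-monoˡ-≤ (1 * i) (*-monoʳ-≤ W D≤) ⟩
    W * (8 * (W * W) * c) * (1 * i) ≡⟨ lemma W c i ⟩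
    c * i * (8 * W ^ 3) ∎
    where
    open ≤-Reasoning
    lemma : ∀ W c i → W * (8 * (W * W) * c) * (1 * i) ≡ c * i * (8 * (W * (W * (W * 1))))
    lemma = solve-∀

  -- From s ≥ 3 follows 8 ρ W³ ≤ N ≤ W D ≤ 4 W³ c, so at most half of the `c` preferred vertices are
  -- taken.
  room-bound : ∀ N W D c F ρ s → 1 ≤ W → 3 ≤ s → ρ * W ^ s * 8 ≤ N → N ≤ W * D → D ≤ 4 * F * c → F ≡ W * W → 2 * ρ ≤ c
  room-bound N W D c F ρ s W≥1 3≤s few N≤ D≤ refl =
    *-cancelˡ-≤ (4 * (W * W * W)) {{>-nonZero (*-mono-≤ {1} {4} (s≤s z≤n) (*-mono-≤ (*-mono-≤ W≥1 W≥1) W≥1))}} (begin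
      4 * (W * W * W) * (2 * ρ)    ≡⟨ lemma₁ W ρ ⟩
      ρ * W ^ 3 * 8                ≤⟨ *-monoˡ-≤ 8 (*-monoʳ-≤ ρ (^-monoʳ-≤ W {{>-nonZero W≥1}} 3≤s)) ⟩
      ρ * W ^ s * 8                ≤⟨ few ⟩
      N                            ≤⟨ N≤ ⟩
      W * D                        ≤⟨ *-monoʳ-≤ W D≤ ⟩
      W * (4 * (W * W) * c)        ≡⟨ lemma₂ W c ⟩
      4 * (W * W * W) * c ∎)
    where
    open ≤-Reasoning
    lemma₁ : ∀ W ρ → 4 * (W * W * W) * (2 * ρ) ≡ ρ * (W * (W * (W * 1))) * 8
    lemma₁ = solve-∀
    lemma₂ : ∀ W c → W * (4 * (W * W) * c) ≡ 4 * (W * W * W) * c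
    lemma₂ = solve-∀

  -- `2 ^ level D` approximates N / D, and `inv m` is `L / m`, so that a uniform choice among `m`
  -- vertices has integral weights with sum `L`.
  module Embedding
    {n r d s N M M₀ : ℕ} (es : List (Subset n)) (G : Vec (Fin N) r → Bool) (T : Vec (Vec (Fin N) (s + s)) r)
    (complete : ∀ τ → G (transversal T τ) ≡ true)
    (level : ℕ → ℕ)
    (level-≥ : ∀ D → 1 ≤ D → N ≤ 2 ^ level D * D)
    (moments : ∀ {P} → P ∈ patterns r d →
      ∑ (vecs (allFin N) (size P)) (λ Q → ⟦ Candidates.live G T P Q ⟧ *
        (2 ^ level (Candidates.degree G T P (allFin N) Q)) ^ (s + s)) ≤ M * N ^ size P)
    (region : ℕ → Fin N → Bool)
    (region-disjoint : ∀ {j j′} x → region j x ≡ true → region j′ x ≡ true → j ≡ j′)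
    (region-large : ∀ {P} → P ∈ patterns r d → ∀ Q j →
      4 ^ j * (2 * M₀) ≤ card (Candidates.candidate G T P Q) →
      card (Candidates.candidate G T P Q) ≤ 4 ^ suc j * card (λ y → Candidates.candidate G T P Q y ∧ region j y))
    (L : ℕ) (L≥1 : 1 ≤ L) (inv : ℕ → ℕ) (inv-spec : ∀ m → 1 ≤ m → m ≤ N → m * inv m ≡ L)
    (inv-0 : inv 0 ≡ 0)
    (N≥1 : 1 ≤ N) (M≥1 : 1 ≤ M) (6≤s : 6 ≤ s) (3d≤s : 3 * d ≤ s)
    (M₀-small : (2 * M₀) * (2 * M₀) ≤ N)
    where

    open Embedded {n} {r} es
    open Candidates G T

    V : Set
    V = Fin N

    cand : Vec Vertex t → Vertex → Vec V t → V → Bool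
    cand o x h = candidate (pattern-of o x) (select (neighbours o x) h)

    lev : Vec Vertex t → Vertex → Vec V t → ℕ
    lev o x h = level (card (cand o x h))

    module Ch {t} (o : Vec Vertex t) x (h : Vec V t) = Choices (region (lev o x h)) (lev o x h) (cand o x h) h

    w : (o : Vec Vertex t) (x : Vertex) → Vec V (size (pattern-of o x)) → ℕ
    w o x Q = 2 ^ level (degree (pattern-of o x) (allFin N) Q)

    ω : Vec Vertex t → Vertex → Vec V t → V → ℕ
    ω o x h y = ⟦ Ch.choices o x h y ⟧ * inv (card (Ch.choices o x h))

    Ω : Vec Vertex t → Vec V t → ℕ
    Ω = Π-weight ω

    length-V : length (allFin N) ≡ N
    length-V = length-tabulate (λ x → x)

    card≤N : (S : V → Bool) → card S ≤ N
    card≤N S = subst (card S ≤_) length-V (∑⟦⟧≤length (allFin N) S)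

    ∑ω : ∀ (o : Vec Vertex t) x h → ∑ (allFin N) (ω o x h) ≡ card (Ch.choices o x h) * inv (card (Ch.choices o x h))
    ∑ω o x h = ∑-*ʳ (allFin N) (inv (card (Ch.choices o x h))) (λ y → ⟦ Ch.choices o x h y ⟧)

    card-inv≤L : ∀ m → m ≤ N → m * inv m ≤ L
    card-inv≤L zero    m≤N = z≤n
    card-inv≤L (suc m) m≤N = ≤-reflexive (inv-spec (suc m) (s≤s z≤n) m≤N)

    4^≤ : ∀ j c → 4 ^ suc j * (2 * c) ≡ 8 * (2 ^ j * 2 ^ j) * c
    4^≤ j c = trans (cong (λ z → 4 * z * (2 * c)) (4^j≡2^j*2^j j)) (lemma (2 ^ j * 2 ^ j) c)
      where
      lemma : ∀ a c → 4 * a * (2 * c) ≡ 8 * a * c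
      lemma = solve-∀

    degree≤choices : ∀ (o : Vec Vertex t) x h →
      card (cand o x h) ≤ 8 * (2 ^ lev o x h * 2 ^ lev o x h) * card (Ch.choices o x h)
    degree≤choices o x h = subst (card (cand o x h) ≤_) (4^≤ (lev o x h) _) (Ch.card-S≤choices o x h)

    choices≤degree : ∀ (o : Vec Vertex t) x h → card (Ch.choices o x h) ≤ card (cand o x h)
    choices≤degree o x h = card-mono (Ch.choices⇒S o x h)

    ω-bound : ∀ (o : Vec Vertex t) x h y → N * ω o x h y ≤ L * (8 * w o x (select (neighbours o x) h) ^ 3)
    ω-bound o x h y = bound (n≡0⊎n>0 c)
      where
      c : ℕ
      c = card (Ch.choices o x h)
      bound : c ≡ 0 ⊎ 0 < c → N * ω o x h y ≤ L * (8 * w o x (select (neighbours o x) h) ^ 3)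
      -- Without choices the weight is zero by `inv-0`.
      bound (inj₁ e)   = ≤-trans (≤-reflexive (trans (cong (λ z → N * (⟦ Ch.choices o x h y ⟧ * z)) (trans (cong inv e) inv-0))
        (trans (cong (N *_) (*-zeroʳ ⟦ Ch.choices o x h y ⟧)) (*-zeroʳ N)))) z≤n
      bound (inj₂ c≥1) = ≤-trans (*-monoʳ-≤ N (*-monoˡ-≤ (inv c) (⟦⟧≤1 (Ch.choices o x h y))))
        (probability-bound N (2 ^ lev o x h) (card (cand o x h)) c (inv c) L
          (level-≥ _ (≤-trans c≥1 (choices≤degree o x h))) (degree≤choices o x h) (inv-spec c c≥1 (card≤N _)))

    Ω-∷ : ∀ {o : Vec Vertex t} {x h y} → 0 < Ω (x ∷ o) (y ∷ h) → 0 < Ω o h × Ch.choices o x h y ≡ true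
    Ω-∷ {o = o} {x} {h} {y} pos with Ω o h | Ch.choices o x h y
    ... | suc _ | true  = s≤s z≤n , refl
    ... | suc a | false with () ← subst (0 <_) (*-zeroʳ a) pos

    Ω-valid : ∀ (o : Vec Vertex t) h → 0 < Ω o h → Valid G T o h
    Ω-valid []      []      pos = valid-[] G T complete
    Ω-valid (x ∷ o) (y ∷ h) pos with Ω-∷ {o = o} {x} {h} {y} pos
    ... | pos′ , chosen = valid-∷ G T o x h y (Ω-valid o h pos′) (Ch.choices⇒S o x h y chosen)

    pattern∈ : ∀ {o : Vec Vertex t} {x} → Extends d x o → pattern-of o x ∈ patterns r d
    pattern∈ {o = o} {v , i} ext = ∈-patterns (few ext) i (isLink o v)

    allVec-head : ∀ {m} (f : V → Bool) (v : Vec V m) → 1 ≤ m → allVec f v ≡ true → ∃ λ y → f y ≡ true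
    allVec-head f (y ∷ v) m≥1 e = y , proj₁ (∧-true e)

    -- The entries of the block of `x` in `T` are themselves candidates, and the block is nonempty;
    -- hence there are choices.
    alive : ∀ {o : Vec Vertex t} {x h} → Ordered d (x ∷ o) → 0 < Ω o h →
      live (pattern-of o x) (select (neighbours o x) h) ≡ true × ∑ (allFin N) (ω o x h) ≡ L
    alive {o = o} {x} {h} (ext , ok) pos = alive′ , trans (∑ω o x h) (inv-spec c c≥1 (card≤N _))
      where
      alive′ : live (pattern-of o x) (select (neighbours o x) h) ≡ true
      alive′ = valid-live G T o x h (Ω-valid o h pos) ext
      c : ℕ
      c = card (Ch.choices o x h)
      some : ∃ λ y → cand o x h y ≡ true
      some = allVec-head (cand o x h) (lookup T (proj₂ x)) (≤-trans (s≤s z≤n) (≤-trans 6≤s (m≤m+n s s))) alive′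
      c≥1 : 1 ≤ c
      c≥1 with n≡0⊎n>0 c
      ... | inj₂ p = p
      ... | inj₁ e = ⊥-elim (<-irrefl refl (≤-trans (card≥1 (proj₁ some) (proj₂ some))
        (≤-trans (degree≤choices o x h) (≤-reflexive (trans (cong (8 * (2 ^ lev o x h * 2 ^ lev o x h) *_) e) (*-zeroʳ (8 * (2 ^ lev o x h * 2 ^ lev o x h))))))))

    module RG = RandomGreedy {Vertex} {V} (allFin N) (Ordered d) proj₂ (λ o x → size (pattern-of o x)) neighbours
      w (λ o x → live (pattern-of o x)) ω L 8 d s M L≥1 (s≤s z≤n) M≥1 (subst (1 ≤_) (sym length-V) N≥1) 3d≤s
      (λ ok → few (proj₁ ok))
      (λ o x h → subst (_≤ L) (sym (∑ω o x h)) (card-inv≤L _ (card≤N _)))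
      (λ o x h y → subst (λ z → z * ω o x h y ≤ L * (8 * w o x (select (neighbours o x) h) ^ 3)) (sym length-V) (ω-bound o x h y))
      alive
      (λ {t} {v} {o} ok → subst (λ z → ∑ (vecs (allFin N) (size (pattern-of o v)))
        (λ Q → ⟦ live (pattern-of o v) Q ⟧ * w o v Q ^ (s + s)) ≤ M * z ^ size (pattern-of o v)) (sym length-V) (moments (pattern∈ (proj₁ ok))))

    open RG using (totalW)

    InRegions : Vec Vertex t → Vec V t → Set
    InRegions []      []      = ⊤
    InRegions (x ∷ o) (y ∷ h) = region (lev o x h) y ≡ true × InRegions o h

    -- Since regions are disjoint, a vertex landing in region `j` has level `j` and adds (2^j)^s to
    -- `totalW`.
    countIn-level : ∀ (o : Vec Vertex t) h j → InRegions o h → countIn (region j) h * (2 ^ j) ^ s ≤ totalW o h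
    countIn-level []      []      j _ = z≤n
    countIn-level (x ∷ o) (y ∷ h) j (y∈ , rest) = begin
      (⟦ region j y ⟧ + countIn (region j) h) * (2 ^ j) ^ s                ≡⟨ *-distribʳ-+ ((2 ^ j) ^ s) ⟦ region j y ⟧ _ ⟩
      ⟦ region j y ⟧ * (2 ^ j) ^ s + countIn (region j) h * (2 ^ j) ^ s    ≤⟨ +-mono-≤ head (countIn-level o h j rest) ⟩
      (2 ^ lev o x h) ^ s + totalW o h                                     ≡⟨ +-comm _ (totalW o h) ⟩
      totalW o h + (2 ^ lev o x h) ^ s ∎
      where
      open ≤-Reasoning
      head : ⟦ region j y ⟧ * (2 ^ j) ^ s ≤ (2 ^ lev o x h) ^ s
      head with region j y in eq
      ... | false = z≤n
      ... | true rewrite region-disjoint y eq y∈ = ≤-reflexive (*-identityˡ _)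

    module Step {t} (o : Vec Vertex t) x (h : Vec V t) (ext : Extends d x o) (W^s : (2 ^ lev o x h) ^ s ≤ N)
                (y : V) (chosen : Ch.choices o x h y ≡ true) where

      open Ch o x h

      W D : ℕ
      W = 2 ^ lev o x h
      D = card (cand o x h)

      W≥1 : 1 ≤ W
      W≥1 = m^n>0 2 (lev o x h)

      N≤WD : N ≤ W * D
      N≤WD = level-≥ D (card≥1 y (choices⇒S y chosen))

      -- Compare squares: W^6 and (2 M₀)² are both at most N. With N ≤ W D this gives D ≥ 4^j (2
      -- M₀), the size from which regions split a candidate set evenly.
      W³M₀≤N : W * (W * W * (2 * M₀)) ≤ N
      W³M₀≤N = ^2-cancel-≤ _ _ (begin
        W * (W * W * (2 * M₀)) * (W * (W * W * (2 * M₀)))  ≡⟨ lemma W (2 * M₀) ⟩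
        W ^ 6 * (2 * M₀ * (2 * M₀))                        ≤⟨ *-mono-≤ (≤-trans (^-monoʳ-≤ W {{>-nonZero W≥1}} 6≤s) W^s) M₀-small ⟩
        N * N ∎)
        where
        open ≤-Reasoning
        lemma : ∀ W m → W * (W * W * m) * (W * (W * W * m)) ≡ W * (W * (W * (W * (W * (W * 1))))) * (m * m)
        lemma = solve-∀

      evenly : card (cand o x h) ≤ 4 ^ suc (lev o x h) * card inRegion
      evenly = region-large (pattern∈ ext) (select (neighbours o x) h) (lev o x h)
        (subst (λ z → z * (2 * M₀) ≤ D) (sym (4^j≡2^j*2^j (lev o x h)))
          (*-cancelˡ-≤ W {{>-nonZero W≥1}} (≤-trans W³M₀≤N N≤WD)))

      landed : region (lev o x h) y ≡ true
      landed = spread-choices evenly y chosen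

      unused : countIn (region (lev o x h)) h * W ^ s * 8 ≤ N → used h y ≡ false
      unused few-used = roomy-choices (≤-trans (*-monoʳ-≤ 2 (≤-trans (spread-used evenly) (card-used (region (lev o x h)) h)))
        (room-bound N W D (card preferred) (4 ^ lev o x h) (countIn (region (lev o x h)) h) s W≥1 (≤-trans (s≤s (s≤s (s≤s z≤n))) 6≤s)
          few-used N≤WD card-S≤preferred (4^j≡2^j*2^j (lev o x h)))) y chosen

    -- `InRegions` is carried along because it bounds how much of the current region is already
    -- used.
    run-distinct : ∀ (o : Vec Vertex t) h → Ordered d o → 0 < Ω o h → totalW o h * 8 ≤ N → InRegions o h × Distinct h
    run-distinct []      []      ok pos small = tt , tt
    run-distinct (x ∷ o) (y ∷ h) (ext , ok) pos small = (landed , proj₁ ih) , (unused few-used , proj₂ ih)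
      where
      open ≤-Reasoning
      total-≤ : totalW o h * 8 ≤ N
      total-≤ = ≤-trans (*-monoˡ-≤ 8 (m≤m+n (totalW o h) _)) small
      W^s : (2 ^ lev o x h) ^ s ≤ N
      W^s = ≤-trans (≤-trans (m≤n+m _ (totalW o h)) (m≤m*n _ 8)) small
      ih : InRegions o h × Distinct h
      ih = run-distinct o h ok (proj₁ (Ω-∷ {o = o} {x} {h} {y} pos)) total-≤
      open Step o x h ext W^s y (proj₂ (Ω-∷ {o = o} {x} {h} {y} pos))
      few-used : countIn (region (lev o x h)) h * (2 ^ lev o x h) ^ s * 8 ≤ N
      few-used = ≤-trans (*-monoˡ-≤ 8 (countIn-level o h (lev o x h) (proj₁ ih))) total-≤

    embedding : ∀ (o : Vec Vertex t) → Ordered d o → t * RG.K * 8 ≤ N → ∃ λ h → Distinct h × Valid G T o h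
    embedding {t} o ok small = h , proj₂ (run-distinct o h ok pos (≤-trans (*-monoˡ-≤ 8 total) small)) , Ω-valid o h pos
      where
      h : Vec V t
      h = proj₁ (RG.typicalRun ok)
      pos : 0 < Ω o h
      pos = proj₁ (proj₂ (RG.typicalRun ok))
      total : totalW o h ≤ t * RG.K
      total = proj₂ (proj₂ (RG.typicalRun ok))

open Embeddings

-- Degeneracy ordering and proper colouring.

module Orders where

  private variable
    X : Set
    n r t : ℕ

  ∣∣≡card : (S : Subset n) → ∣ S ∣ ≡ card (lookup S)
  ∣∣≡card []          = refl
  ∣∣≡card (true  ∷ S) = trans (cong suc (∣∣≡card S)) (sym (card-suc (lookup (true ∷ S))))
  ∣∣≡card (false ∷ S) = trans (∣∣≡card S) (sym (card-suc (lookup (false ∷ S))))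

  card-witness : (S : Fin n → Bool) → 0 < card S → ∃ λ x → S x ≡ true
  card-witness {n} S pos with ∑-< (allFin n) (subst (_< card S) (sym (∑-zero (allFin n))) pos)
  ... | x , lt with S x in eq
  ...   | true = x , eq

  false-⌊⌋ : ∀ {P : Set} (P? : Dec P) → ¬ P → ⌊ P? ⌋ ≡ false
  false-⌊⌋ (yes p) ¬p = ⊥-elim (¬p p)
  false-⌊⌋ (no _)  ¬p = refl

  ⌊⌋-sym : (x y : Fin n) → ⌊ x ≟ y ⌋ ≡ ⌊ y ≟ x ⌋
  ⌊⌋-sym x y with x ≟ y | y ≟ x
  ... | yes _    | yes _   = refl
  ... | no _     | no _    = refl
  ... | yes refl | no y≢x  = ⊥-elim (y≢x refl)
  ... | no x≢y   | yes y≡x = ⊥-elim (x≢y (sym y≡x))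

  count-∷ : (p : X → Bool) (x : X) (o : Vec X t) → count p (x ∷ o) ≡ ⟦ p x ⟧ + count p o
  count-∷ p x o with p x
  ... | true  = refl
  ... | false = refl

  count≡0 : (p : X → Bool) (o : Vec X t) → count p o < 1 → All (λ x → p x ≡ false) o
  count≡0 p []      lt = []
  count≡0 p (x ∷ o) lt with p x in eq
  ... | false = eq ∷ count≡0 p o lt
  count≡0 p (x ∷ o) (s≤s ()) | true

  All-map : {P Q : X → Set} {o : Vec X t} → (∀ x → P x → Q x) → All P o → All Q o
  All-map f []       = []
  All-map f (p ∷ ps) = f _ p ∷ All-map f ps

  All-lookup : {P : X → Set} {o : Vec X t} → All P o → ∀ a → P (lookup o a)
  All-lookup (p ∷ ps) zero    = p
  All-lookup (p ∷ ps) (suc a) = All-lookup ps a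

  count-colours : (p : X → Bool) (c : X → Fin r) (o : Vec X t) →
    ∑ (allFin r) (λ i → count (λ x → p x ∧ ⌊ c x ≟ i ⌋) o) ≤ count p o
  count-colours {r = r} p c []      = ≤-reflexive (∑-zero (allFin r))
  count-colours {r = r} p c (x ∷ o) = begin
    ∑ (allFin r) (λ i → count (q i) (x ∷ o))                          ≡⟨ ∑-cong (allFin r) (λ i → count-∷ (q i) x o) ⟩
    ∑ (allFin r) (λ i → ⟦ q i x ⟧ + count (q i) o)                    ≡⟨ ∑-+ (allFin r) _ _ ⟩
    ∑ (allFin r) (λ i → ⟦ q i x ⟧) + ∑ (allFin r) (λ i → count (q i) o) ≤⟨ +-mono-≤ (≤-reflexive single) (count-colours p c o) ⟩
    ⟦ p x ⟧ + count p o                                               ≡⟨ count-∷ p x o ⟨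
    count p (x ∷ o) ∎
    where
    open ≤-Reasoning
    q : Fin r → _ → Bool
    q i x = p x ∧ ⌊ c x ≟ i ⌋
    single : ∑ (allFin r) (λ i → ⟦ q i x ⟧) ≡ ⟦ p x ⟧
    single = trans (∑-cong (allFin r) (λ i → trans (⟦∧⟧ (p x) _) (cong (λ b → ⟦ p x ⟧ * ⟦ b ⟧) (⌊⌋-sym (c x) i))))
      (trans (∑-*ˡ (allFin r) ⟦ p x ⟧ _) (trans (cong (⟦ p x ⟧ *_) (∑-δ r (c x))) (*-identityʳ _)))

  -- Fewer than `r` vertices are to be avoided, so some colour class contains none of them.
  free-colour : (p : X → Bool) (c : X → Fin r) (o : Vec X t) → count p o < r →
    ∃ λ i → All (λ x → p x ≡ true → c x ≢ i) o
  free-colour {r = r} p c o lt with ∑-< (allFin r) (<-≤-trans (≤-<-trans (count-colours p c o) lt)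
      (≤-reflexive (trans (sym (length-tabulate (λ x → x))) (length-∑ (allFin r)))))
  ... | i , few = i , All-map avoid (count≡0 _ o few)
    where
    avoid : ∀ x → p x ∧ ⌊ c x ≟ i ⌋ ≡ false → p x ≡ true → c x ≢ i
    avoid x e px cx with () ← trans (sym (true-∧ px (true-⌊⌋ (c x ≟ i) cx))) e

  remove-split : (S : Subset n) (v : Fin n) → lookup S v ≡ true → (p : Fin n → Bool) →
    card (λ u → lookup S u ∧ p u) ≡ ⟦ p v ⟧ + card (λ u → lookup (S [ v ]≔ false) u ∧ p u)
  remove-split {n} S v v∈ p = begin
    card (λ u → lookup S u ∧ p u)
      ≡⟨ ∑-cong (allFin n) pointwise ⟩
    ∑ (allFin n) (λ u → ⟦ ⌊ u ≟ v ⌋ ⟧ * ⟦ p v ⟧ + ⟦ lookup (S [ v ]≔ false) u ∧ p u ⟧)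
      ≡⟨ ∑-+ (allFin n) _ _ ⟩
    ∑ (allFin n) (λ u → ⟦ ⌊ u ≟ v ⌋ ⟧ * ⟦ p v ⟧) + card (λ u → lookup (S [ v ]≔ false) u ∧ p u)
      ≡⟨ cong (_+ card (λ u → lookup (S [ v ]≔ false) u ∧ p u))
           (trans (∑-*ʳ (allFin n) ⟦ p v ⟧ _) (trans (cong (_* ⟦ p v ⟧) (∑-δ n v)) (*-identityˡ _))) ⟩
    ⟦ p v ⟧ + card (λ u → lookup (S [ v ]≔ false) u ∧ p u) ∎
    where
    open ≡-Reasoning
    pointwise : ∀ u → ⟦ lookup S u ∧ p u ⟧ ≡ ⟦ ⌊ u ≟ v ⌋ ⟧ * ⟦ p v ⟧ + ⟦ lookup (S [ v ]≔ false) u ∧ p u ⟧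
    pointwise u with u ≟ v
    ... | yes refl rewrite v∈ | Vec.lookup∘update u S false =
      sym (trans (+-identityʳ _) (*-identityˡ ⟦ p u ⟧))
    ... | no u≢v rewrite Vec.lookup∘update′ u≢v S false = refl

  module _ {k n d : ℕ} (H : Hypergraph k n) (degenerate : SkelDegenerate H d) {r : ℕ} (d<r : d < r) where
    open Embedded {n} {r} (edges H)

    -- `counts` transfers cardinalities between the set `S` and its enumeration, so that a degree
    -- inside `S` becomes a number of earlier neighbours.
    record DegeneracyOrder (S : Subset n) (m : ℕ) : Set where
      field
        order   : Vec Vertex m
        ordered : Ordered d order
        counts  : ∀ (p : Fin n → Bool) → count (λ x → p (proj₁ x)) order ≡ card (λ u → lookup S u ∧ p u)
        covers  : ∀ v → lookup S v ≡ true → ∃ λ a → proj₁ (lookup order a) ≡ v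
        member  : ∀ a → lookup S (proj₁ (lookup order a)) ≡ true
        unique  : ∀ a b → proj₁ (lookup order a) ≡ proj₁ (lookup order b) → a ≡ b

    module Extend {m : ℕ} (S : Subset n) (v : Fin n) (v∈ : lookup S v ≡ true) (low : ∣ S ∩ skelNbhd H v ∣ ≤ d)
                  (rec : DegeneracyOrder (S [ v ]≔ false) m) where
      open DegeneracyOrder rec renaming (order to o; ordered to ordered-o)

      S′ : Subset n
      S′ = S [ v ]≔ false

      S′-v : lookup S′ v ≡ false
      S′-v = Vec.lookup∘update v S false

      S′-≢ : ∀ {u} → u ≢ v → lookup S′ u ≡ lookup S u
      S′-≢ u≢v = Vec.lookup∘update′ u≢v S false

      S′-∈ : ∀ {u} → lookup S′ u ≡ true → u ≢ v
      S′-∈ u∈ refl with () ← trans (sym u∈) S′-v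

      adj : Fin n → Bool
      adj u = anyList (λ e → lookup e u ∧ lookup e v) (edges H)

      -- The skeleton neighbourhood omits `v`, which `adj` may admit; membership in `S′` excludes
      -- that vertex.
      nbhd : ∀ u → lookup S′ u ∧ adj u ≡ true → lookup (S ∩ skelNbhd H v) u ≡ true
      nbhd u e = trans (Vec.lookup-zipWith _∧_ u S (skelNbhd H v)) (true-∧ {lookup S u}
        (trans (sym (S′-≢ u≢v)) u∈)
        (trans (Vec.lookup∘tabulate _ u) (true-∧ (cong not (false-⌊⌋ (u ≟ v) u≢v)) (proj₂ (∧-true {lookup S′ u} e)))))
        where
        u∈ : lookup S′ u ≡ true
        u∈ = proj₁ (∧-true {lookup S′ u} e)
        u≢v : u ≢ v
        u≢v = S′-∈ u∈

      few′ : count (adjacent v) o ≤ d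
      few′ = begin
        count (adjacent v) o                       ≡⟨ counts adj ⟩
        card (λ u → lookup S′ u ∧ adj u)           ≤⟨ card-mono {S = λ u → lookup S′ u ∧ adj u} {lookup (S ∩ skelNbhd H v)} nbhd ⟩
        card (lookup (S ∩ skelNbhd H v))           ≡⟨ ∣∣≡card (S ∩ skelNbhd H v) ⟨
        ∣ S ∩ skelNbhd H v ∣                       ≤⟨ low ⟩
        d ∎
        where open ≤-Reasoning

      colour : ∃ λ i → All (λ x → adjacent v x ≡ true → proj₂ x ≢ i) o
      colour = free-colour (adjacent v) proj₂ o (≤-<-trans few′ d<r)

      o′ : Vec Vertex (suc m)
      o′ = (v , proj₁ colour) ∷ o

      outside : ∀ a → proj₁ (lookup o a) ≢ v
      outside a = S′-∈ (member a)

      covers′ : ∀ u → lookup S u ≡ true → ∃ λ a → proj₁ (lookup o′ a) ≡ u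
      covers′ u u∈ = case (u ≟ v)
        where
        case : Dec (u ≡ v) → ∃ λ a → proj₁ (lookup o′ a) ≡ u
        case (yes u≡v) = zero , sym u≡v
        case (no u≢v)  = suc (proj₁ ih) , proj₂ ih
          where
          ih : ∃ λ a → proj₁ (lookup o a) ≡ u
          ih = covers u (trans (S′-≢ u≢v) u∈)

      member′ : ∀ a → lookup S (proj₁ (lookup o′ a)) ≡ true
      member′ zero    = v∈
      member′ (suc a) = trans (sym (S′-≢ (outside a))) (member a)

      unique′ : ∀ a b → proj₁ (lookup o′ a) ≡ proj₁ (lookup o′ b) → a ≡ b
      unique′ zero    zero    e = refl
      unique′ zero    (suc b) e = ⊥-elim (outside b (sym e))
      unique′ (suc a) zero    e = ⊥-elim (outside a e)
      unique′ (suc a) (suc b) e = cong suc (unique a b e)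

      extended : DegeneracyOrder S (suc m)
      extended = record
        { order = o′ ; ordered = extends few′ (proj₂ colour) , ordered-o
        ; counts = λ p → trans (count-∷ (λ x → p (proj₁ x)) (v , proj₁ colour) o)
            (trans (cong (⟦ p v ⟧ +_) (counts p)) (sym (remove-split S v v∈ p)))
        ; covers = covers′ ; member = member′ ; unique = unique′ }

    degeneracyOrder : ∀ m (S : Subset n) → card (lookup S) ≡ m → DegeneracyOrder S m
    degeneracyOrder zero S card≡ = record
      { order = [] ; ordered = tt
      ; counts = λ p → sym (n≤0⇒n≡0 (≤-trans (card-mono {S = λ u → lookup S u ∧ p u} {lookup S} (λ u e → proj₁ (∧-true e))) (≤-reflexive card≡)))
      ; covers = λ v v∈ → ⊥-elim (<-irrefl refl (≤-trans (card≥1 {S = lookup S} v v∈) (≤-reflexive card≡)))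
      ; member = λ () ; unique = λ () }
    degeneracyOrder (suc m) S card≡ = Extend.extended S v v∈ (proj₂ (proj₂ low)) (degeneracyOrder m (S [ v ]≔ false) smaller)
      where
      some : ∃ λ x → lookup S x ≡ true
      some = card-witness (lookup S) (subst (0 <_) (sym card≡) (s≤s z≤n))
      low : ∃ λ v → v Data.Fin.Subset.∈ S × ∣ S ∩ skelNbhd H v ∣ ≤ d
      low = degenerate S (proj₁ some , Vec.lookup⇒[]= (proj₁ some) S (proj₂ some))
      v : Fin n
      v = proj₁ low
      v∈ : lookup S v ≡ true
      v∈ = Vec.[]=⇒lookup (proj₁ (proj₂ low))
      smaller : card (lookup (S [ v ]≔ false)) ≡ m
      smaller = suc-injective (trans (cong suc (card-cong {S = lookup (S [ v ]≔ false)} (λ u → sym (∧-identityʳ (lookup (S [ v ]≔ false) u)))))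
        (trans (sym (remove-split S v v∈ (λ _ → true)))
          (trans (card-cong {T = lookup S} (λ u → ∧-identityʳ (lookup S u))) card≡)))

    wholeOrder : DegeneracyOrder (replicate n true) n
    wholeOrder = degeneracyOrder n (replicate n true)
      (trans (∑-cong (allFin n) (λ x → cong ⟦_⟧ (Vec.lookup-replicate x true))) (trans (sym (length-∑ (allFin n))) (length-tabulate (λ x → x))))

open Orders

-- From a valid run to a monochromatic copy.

module Copies where

  private variable
    A : Set
    k n m N r t : ℕ

  used-lookup : (h : Vec (Fin N) t) → ∀ a → used h (lookup h a) ≡ true
  used-lookup (y ∷ h) zero rewrite true-⌊⌋ (y ≟ y) refl = refl
  used-lookup (y ∷ h) (suc a) with ⌊ lookup h a ≟ y ⌋
  ... | true  = refl
  ... | false = used-lookup h a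

  Distinct-lookup : (h : Vec (Fin N) t) → Distinct h → ∀ a b → lookup h a ≡ lookup h b → a ≡ b
  Distinct-lookup (y ∷ h) (fresh , dist) zero    zero    e = refl
  Distinct-lookup (y ∷ h) (fresh , dist) zero    (suc b) e with () ← trans (sym fresh) (trans (cong (used h) e) (used-lookup h b))
  Distinct-lookup (y ∷ h) (fresh , dist) (suc a) zero    e with () ← trans (sym fresh) (trans (cong (used h) (sym e)) (used-lookup h a))
  Distinct-lookup (y ∷ h) (fresh , dist) (suc a) (suc b) e = cong suc (Distinct-lookup h dist a b e)

  card-Distinct : (h : Vec (Fin N) t) → Distinct h → card (used h) ≡ t
  card-Distinct {N} []      dist           = ∑-zero (allFin N)
  card-Distinct {N} (z ∷ h) (fresh , dist) = begin
    card (used (z ∷ h))                                       ≡⟨ ∑-cong (allFin N) pointwise ⟩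
    ∑ (allFin N) (λ y → ⟦ ⌊ y ≟ z ⌋ ⟧ + ⟦ used h y ⟧)         ≡⟨ ∑-+ (allFin N) _ _ ⟩
    ∑ (allFin N) (λ y → ⟦ ⌊ y ≟ z ⌋ ⟧) + card (used h)        ≡⟨ cong₂ _+_ (∑-δ N z) (card-Distinct h dist) ⟩
    suc _ ∎
    where
    open ≡-Reasoning
    pointwise : ∀ y → ⟦ ⌊ y ≟ z ⌋ ∨ used h y ⟧ ≡ ⟦ ⌊ y ≟ z ⌋ ⟧ + ⟦ used h y ⟧
    pointwise y with y ≟ z
    ... | yes refl rewrite fresh = refl
    ... | no _     = refl

  anyFin-∈ : {f : Fin m → Bool} (i : Fin m) → f i ≡ true → anyFin f ≡ true
  anyFin-∈ zero e rewrite e = refl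
  anyFin-∈ {f = f} (suc i) e with f zero
  ... | true  = refl
  ... | false = anyFin-∈ i e

  anyFin-witness : (f : Fin m → Bool) → anyFin f ≡ true → ∃ λ i → f i ≡ true
  anyFin-witness {m = suc m} f e with f zero in eq
  ... | true  = zero , eq
  ... | false with anyFin-witness (λ i → f (suc i)) e
  ...   | i , e′ = suc i , e′

  bool-ext : ∀ {a b} → (a ≡ true → b ≡ true) → (b ≡ true → a ≡ true) → a ≡ b
  bool-ext {false} {false} f g = refl
  bool-ext {false} {true}  f g = g refl
  bool-ext {true}  {b}     f g = sym (f refl)

  -- Written as a subsequence of `fill m x`, although no entry of `x` survives, so that
  -- monochromaticity of the filled tuple applies to it.
  justs : (m : Vec (Maybe A) r) → Vec A r → Vec A (count is-just m)
  justs m x = select (filterSel is-just m) (fill m x)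

  justs-used : (m : Vec (Maybe (Fin N)) r) (x : Vec (Fin N) r) → ∀ j {y} → lookup m j ≡ just y → used (justs m x) y ≡ true
  justs-used (just z ∷ m)  (_ ∷ x) zero    {y} refl rewrite true-⌊⌋ (y ≟ y) refl = refl
  justs-used (just z ∷ m)  (_ ∷ x) (suc j) {y} e with ⌊ y ≟ z ⌋
  ... | true  = refl
  ... | false = justs-used m x j e
  justs-used (nothing ∷ m) (_ ∷ x) (suc j) e = justs-used m x j e

  justs-witness : (m : Vec (Maybe (Fin N)) r) (x : Vec (Fin N) r) → ∀ y → used (justs m x) y ≡ true → ∃ λ j → lookup m j ≡ just y
  justs-witness []            []      y ()
  justs-witness (just z ∷ m)  (_ ∷ x) y e with y ≟ z
  ... | yes refl = zero , refl
  ... | no _     with justs-witness m x y e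
  ...   | j , e′ = suc j , e′
  justs-witness (nothing ∷ m) (_ ∷ x) y e with justs-witness m x y e
  ... | j , e′ = suc j , e′

  justs-Distinct : (m : Vec (Maybe (Fin N)) r) (x : Vec (Fin N) r) →
    (∀ i j {y} → lookup m i ≡ just y → lookup m j ≡ just y → i ≡ j) → Distinct (justs m x)
  justs-Distinct []            []      inj = tt
  justs-Distinct (just z ∷ m)  (_ ∷ x) inj = fresh , justs-Distinct m x (λ i j e e′ → Fin.suc-injective (inj (suc i) (suc j) e e′))
    where
    fresh : used (justs m x) z ≡ false
    fresh with used (justs m x) z in eq
    ... | false = refl
    ... | true with justs-witness m x z eq
    ...   | j , e with () ← inj zero (suc j) refl e
  justs-Distinct (nothing ∷ m) (_ ∷ x) inj = justs-Distinct m x (λ i j e e′ → Fin.suc-injective (inj (suc i) (suc j) e e′))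

  module Found {n r d : ℕ} {es : List (Subset n)} where
    open Embedded {n} {r} es

    found-sound : ∀ {V : Set} (q : Vertex → Bool) (o : Vec Vertex t) (h : Vec V t) {y} → found q o h ≡ just y →
      ∃ λ a → lookup h a ≡ y × q (lookup o a) ≡ true
    found-sound q []      []      ()
    found-sound q (x ∷ o) (y ∷ h) e with q x in eq
    found-sound q (x ∷ o) (y ∷ h) refl | true = zero , refl , eq
    ... | false with found-sound q o h e
    ...   | a , e′ , qa = suc a , e′ , qa

    -- Any other hit met first would share the edge `e` and the colour `j`, against properness.
    found-complete : ∀ {V : Set} {e} → e ∈ es → ∀ j (o : Vec Vertex t) (h : Vec V t) → Ordered d o →
      ∀ a → hits e j (lookup o a) ≡ true → found (hits e j) o h ≡ just (lookup h a)
    found-complete e∈ j (x ∷ o) (y ∷ h) ok zero    hit rewrite hit = refl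
    found-complete {e = e} e∈ j (x ∷ o) (y ∷ h) (ext , ok) (suc a) hit with hits e j x in eq
    ... | false = found-complete e∈ j o h ok a hit
    ... | true  = ⊥-elim (All-lookup (proper ext) a
      (anyList-∈ e∈ (true-∧ (proj₁ (∧-true {lookup e (proj₁ (lookup o a))} hit)) (proj₁ (∧-true {lookup e (proj₁ x)} eq))))
      (trans (⌊⌋-true (proj₂ (lookup o a) ≟ j) (proj₂ (∧-true {lookup e (proj₁ (lookup o a))} hit)))
        (sym (⌊⌋-true (proj₂ x ≟ j) (proj₂ (∧-true {lookup e (proj₁ x)} eq))))))

  -- Tuples with repetitions have fewer than `k` distinct entries and receive `default`.
  tupleColouring : ∀ {k q N} → Fin q → Colouring k q N → Vec (Fin N) k → Fin q
  tupleColouring {k} default χ xs with ∣ tabulate (used xs) ∣ Data.Nat.Properties.≟ k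
  ... | yes p = χ (tabulate (used xs)) p
  ... | no _  = default

  tupleColouring-image : ∀ {k q N} (default : Fin q) (χ : Colouring k q N) xs (S : Subset N) → S ≡ tabulate (used xs) →
    (p : ∣ S ∣ ≡ k) → tupleColouring default χ xs ≡ χ S p
  tupleColouring-image {k} default χ xs S refl p with ∣ tabulate (used xs) ∣ Data.Nat.Properties.≟ k
  ... | yes p′ = cong (χ (tabulate (used xs))) (≡-irrelevant p′ p)
  ... | no ¬p  = ⊥-elim (¬p p)

  module Copy {k n d q r N p : ℕ} (H : Hypergraph k n) (degenerate : SkelDegenerate H d) (d<r : d < r)
    (default : Fin q) (χ : Colouring k q N) (c : Fin q) (a₀ : Fin p)
    (T : Vec (Vec (Fin N) p) r) (h : Vec (Fin N) n) (distinct : Distinct h)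
    (valid : Embedded.Valid {n} {r} (edges H) (monoᵇ (tupleColouring default χ) c) T
               (DegeneracyOrder.order (wholeOrder H degenerate d<r)) h) where

    open Embedded {n} {r} (edges H)
    open DegeneracyOrder (wholeOrder H degenerate d<r) renaming (order to o)

    position : ∀ v → ∃ λ a → proj₁ (lookup o a) ≡ v
    position v = covers v (Vec.lookup-replicate v true)

    f : Fin n → Fin N
    f v = lookup h (proj₁ (position v))

    f-injective : ∀ {u v} → f u ≡ f v → u ≡ v
    f-injective {u} {v} e = trans (sym (proj₂ (position u)))
      (trans (cong (λ a → proj₁ (lookup o a)) (Distinct-lookup h distinct _ _ e)) (proj₂ (position v)))

    f-vertex : ∀ a → f (proj₁ (lookup o a)) ≡ lookup h a
    f-vertex a = cong (lookup h) (unique _ _ (proj₂ (position (proj₁ (lookup o a)))))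

    module _ {e : Subset n} (e∈ : e ∈ edges H) where

      occ : Vec (Maybe (Fin N)) r
      occ = occupied e o h

      -- Some transversal to fill the parts not met by `e`; `justs` drops its entries again.
      spare : Vec (Fin N) r
      spare = transversal T (replicate r a₀)

      occ-lookup : ∀ j → lookup occ j ≡ found (hits e j) o h
      occ-lookup j = Vec.lookup∘tabulate (λ j → found (hits e j) o h) j

      image⇒used : ∀ y → anyFin (λ v → lookup e v ∧ ⌊ f v ≟ y ⌋) ≡ true → used (justs occ spare) y ≡ true
      image⇒used y im = justs-used occ spare j (trans (occ-lookup j)
        (trans (Found.found-complete {d = d} {edges H} e∈ j o h ordered a
          (true-∧ (subst (λ u → lookup e u ≡ true) (sym (proj₂ (position v))) (proj₁ (∧-true ev))) (true-⌊⌋ (j ≟ j) refl)))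
        (cong just (⌊⌋-true (f v ≟ y) (proj₂ (∧-true ev))))))
        where
        v : Fin n
        v = proj₁ (anyFin-witness (λ v → lookup e v ∧ ⌊ f v ≟ y ⌋) im)
        ev : lookup e v ∧ ⌊ f v ≟ y ⌋ ≡ true
        ev = proj₂ (anyFin-witness (λ v → lookup e v ∧ ⌊ f v ≟ y ⌋) im)
        a : Fin n
        a = proj₁ (position v)
        j : Fin r
        j = proj₂ (lookup o a)

      occ-sound : ∀ j {y} → lookup occ j ≡ just y → ∃ λ a → lookup h a ≡ y × hits e j (lookup o a) ≡ true
      occ-sound j eq = Found.found-sound {d = d} {edges H} (hits e j) o h (trans (sym (occ-lookup j)) eq)

      used⇒image : ∀ y → used (justs occ spare) y ≡ true → anyFin (λ v → lookup e v ∧ ⌊ f v ≟ y ⌋) ≡ true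
      used⇒image y us = anyFin-∈ (proj₁ (lookup o a)) (true-∧ (proj₁ (∧-true hit)) (true-⌊⌋ (_ ≟ y) (trans (f-vertex a) ha)))
        where
        j : Fin r
        j = proj₁ (justs-witness occ spare y us)
        sound : ∃ λ a → lookup h a ≡ y × hits e j (lookup o a) ≡ true
        sound = occ-sound j (proj₂ (justs-witness occ spare y us))
        a : Fin n
        a = proj₁ sound
        ha : lookup h a ≡ y
        ha = proj₁ (proj₂ sound)
        hit : hits e j (lookup o a) ≡ true
        hit = proj₂ (proj₂ sound)

      image-used : image f e ≡ tabulate (used (justs occ spare))
      image-used = Vec.tabulate-cong (λ y → bool-ext (image⇒used y) (used⇒image y))

      justs-distinct : Distinct (justs occ spare)
      justs-distinct = justs-Distinct occ spare same
        where
        same : ∀ i j {y} → lookup occ i ≡ just y → lookup occ j ≡ just y → i ≡ j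
        same i j ei ej with occ-sound i ei | occ-sound j ej
        ... | a , ha , hit-i | b , hb , hit-j with Distinct-lookup h distinct a b (trans ha (sym hb))
        ...   | refl = trans (sym (⌊⌋-true (proj₂ (lookup o a) ≟ i) (proj₂ (∧-true {lookup e (proj₁ (lookup o a))} hit-i))))
                             (⌊⌋-true (proj₂ (lookup o a) ≟ j) (proj₂ (∧-true {lookup e (proj₁ (lookup o a))} hit-j)))

      size-justs : ∣ image f e ∣ ≡ count is-just occ
      size-justs = trans (cong ∣_∣ image-used) (trans (∣∣≡card (tabulate (used (justs occ spare))))
        (trans (card-cong (λ y → Vec.lookup∘tabulate (used (justs occ spare)) y)) (card-Distinct (justs occ spare) justs-distinct)))

      -- The image has `k` elements, so the occupied parts form a `k`-subsequence of a filled tuple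
      -- that is monochromatic by validity.
      right-colour : (p : ∣ image f e ∣ ≡ k) → χ (image f e) p ≡ c
      right-colour p = finish _ (filterSel is-just occ) (trans (sym size-justs) p) image-used
        where
        -- The number of occupied parts is generalised to `κ` so that its equality with `k` can be
        -- eliminated.
        finish : ∀ κ (σ : Sel r κ) → κ ≡ k → image f e ≡ tabulate (used (select σ (fill occ spare))) → χ (image f e) p ≡ c
        finish κ σ refl im = trans (sym (tupleColouring-image default χ (select σ (fill occ spare)) (image f e) im p))
          (monoᵇ-sound {C = tupleColouring default χ} {c} {fill occ spare} (valid e∈ (replicate r a₀)) σ)

    copy : MonoCopy H χ
    copy = f , f-injective , c , ListAll.tabulate right-colour

open Copies

-- Choice of constants and the linear bound.

private variable
  A : Set

n<2^n : ∀ n → n < 2 ^ n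
n<2^n zero    = s≤s z≤n
n<2^n (suc n) = begin-strict
  1 + n             <⟨ +-mono-≤-< (m^n>0 2 n) (n<2^n n) ⟩
  2 ^ n + 2 ^ n     ≡⟨ cong (2 ^ n +_) (+-identityʳ _) ⟨
  2 ^ suc n ∎
  where open ≤-Reasoning

-- The exponent descends from `N`, which suffices as N < 2^N, until one less would fail; that
-- failure gives the upper bound.
levelOf : ∀ N D → ∃ λ j → (1 ≤ D → N ≤ 2 ^ j * D) × (D ≤ N → 2 ^ j * D ≤ 2 * N)
levelOf N zero      = 0 , (λ ()) , λ _ → z≤n
levelOf N D@(suc _) = search N (≤-trans (<⇒≤ (n<2^n N)) (m≤m*n (2 ^ N) D))
  where
  search : ∀ J → N ≤ 2 ^ J * D → ∃ λ j → (1 ≤ D → N ≤ 2 ^ j * D) × (D ≤ N → 2 ^ j * D ≤ 2 * N)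
  search zero    le = 0 , (λ _ → le) , λ D≤N → ≤-trans (≤-reflexive (*-identityˡ D)) (≤-trans D≤N (m≤m+n N _))
  search (suc J) le with N ≤? 2 ^ J * D
  ... | yes le′ = search J le′
  ... | no  ≰   = suc J , (λ _ → le) , λ _ → ≤-trans (≤-reflexive (*-assoc 2 (2 ^ J) D)) (*-monoʳ-≤ 2 (<⇒≤ (≰⇒> ≰)))

-- With m = l / 4 rounded down, l ≤ 4 (m + 1) ≤ 4 * 2^m, so l^4 ≤ 256 * 2^l; and (16 b)² l² ≤ l^4.
square≤2^ : ∀ b l → 16 * b < l → (b * l) * (b * l) ≤ 2 ^ l
square≤2^ b l big = *-cancelˡ-≤ 256 (begin
  256 * ((b * l) * (b * l))                  ≡⟨ lemma₁ b l ⟩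
  (16 * b) * (16 * b) * (l * l)              ≤⟨ *-monoˡ-≤ (l * l) (*-mono-≤ (<⇒≤ big) (<⇒≤ big)) ⟩
  l * l * (l * l)                            ≤⟨ *-mono-≤ (*-mono-≤ l≤ l≤) (*-mono-≤ l≤ l≤) ⟩
  (4 * P) * (4 * P) * ((4 * P) * (4 * P))    ≡⟨ lemma₂ P ⟩
  256 * (P * (P * (P * (P * 1))))            ≡⟨ cong (256 *_) (^-*-assoc 2 m 4) ⟩
  256 * 2 ^ (m * 4)                          ≤⟨ *-monoʳ-≤ 256 (^-monoʳ-≤ 2 (≤-trans (m≤n+m (m * 4) (l % 4)) (≤-reflexive (sym l≡)))) ⟩
  256 * 2 ^ l ∎)
  where
  open ≤-Reasoning
  m P : ℕ
  m = l / 4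
  P = 2 ^ m
  l≡ : l ≡ l % 4 + m * 4
  l≡ = m≡m%n+[m/n]*n l 4
  l≤ : l ≤ 4 * P
  l≤ = begin
    l               ≡⟨ l≡ ⟩
    l % 4 + m * 4   ≤⟨ +-monoˡ-≤ (m * 4) (<⇒≤ (m%n<n l 4)) ⟩
    4 + m * 4       ≡⟨ *-comm (suc m) 4 ⟩
    4 * suc m       ≤⟨ *-monoʳ-≤ 4 (n<2^n m) ⟩
    4 * P ∎
  lemma₁ : ∀ b l → 256 * ((b * l) * (b * l)) ≡ (16 * b) * (16 * b) * (l * l)
  lemma₁ = solve-∀
  lemma₂ : ∀ P → (4 * P) * (4 * P) * ((4 * P) * (4 * P)) ≡ 256 * (P * (P * (P * (P * 1))))
  lemma₂ = solve-∀

∑-mono-∈ : ∀ (xs : List A) {f g : A → ℕ} → (∀ {x} → x ∈ xs → f x ≤ g x) → ∑ xs f ≤ ∑ xs g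
∑-mono-∈ []       h = z≤n
∑-mono-∈ (x ∷ xs) h = +-mono-≤ (h (here refl)) (∑-mono-∈ xs (λ x∈ → h (there x∈)))

-- Probabilities 1 / m with m ≤ N are written as share N m over the common denominator N !.
share : ℕ → ℕ → ℕ
share N zero    = 0
share N (suc m) = N ! / suc m

share-spec : ∀ N m → 1 ≤ m → m ≤ N → m * share N m ≡ N !
share-spec N (suc m) _ m≤N = m*[n/m]≡n (∣-trans (m∣m*n (m !)) (m≤n⇒m!∣n! m≤N))

module Bound
  (k q d r s R M : ℕ) (d<r : d < r) (6≤s : 6 ≤ s) (3d≤s : 3 * d ≤ s) (default : Fin q) (a₀ : Fin (s + s))
  (ramseyR : RamseyFor k q (r * (s + s)) R)
  (M-large : length (allSel R (r * (s + s))) * (q * (length (patterns r d) * 2 ^ (s + s))) < M)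
  where

  -- `σ` dominates all pattern sizes, and `b` is made for `2 * M₀ ≤ b * l`. `K` is the moment
  -- constant of the greedy process for `c = 8`. In `C₀` the first summand provides the room for
  -- injectivity, the second forces `16 * b < l`.
  a σ b K C₀ : ℕ
  a  = 2 * length (patterns r d)
  σ  = ∑ (patterns r d) size
  b  = 12 * (a + σ)
  K  = 2 * (2 * (8 ^ d * suc d) * M)
  C₀ = K * 8 + 2 ^ suc (16 * b)

  module Arrow (l n : ℕ) (n≥1 : 1 ≤ n) (N-large : C₀ * n ≤ 2 ^ l) (H : Hypergraph k n) (degenerate : SkelDegenerate H d)
               (χ : Colouring k q (2 ^ l)) where

    N : ℕ
    N = 2 ^ l

    N≥1 : 1 ≤ N
    N≥1 = m^n>0 2 l

    length-V : length (allFin N) ≡ N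
    length-V = length-tabulate (λ x → x)

    level : ℕ → ℕ
    level D = proj₁ (levelOf N D)

    C : Vec (Fin N) k → Fin q
    C = tupleColouring default χ

    weight : ℕ → ℕ
    weight D = 2 ^ level D

    weight-bound : ∀ D → D ≤ length (allFin N) → weight D * D ≤ 2 * length (allFin N)
    weight-bound D D≤ = subst (λ z → weight D * D ≤ 2 * z) (sym length-V) (proj₂ (proj₂ (levelOf N D)) (subst (D ≤_) length-V D≤))

    V≥1 : 1 ≤ length (allFin N)
    V≥1 = subst (1 ≤_) (sym length-V) N≥1

    module DRC = DependentRandomChoice k q d r (s + s) R M ramseyR M-large (allFin N) V≥1 weight weight-bound C

    c : Fin q
    c = proj₁ DRC.goodTuple

    T : Vec (Vec (Fin N) (s + s)) r
    T = proj₁ (proj₂ DRC.goodTuple)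

    G : Vec (Fin N) r → Bool
    G = monoᵇ C c

    Index : Set
    Index = Σ (Pattern r) (λ P → Vec (Fin N) (size P))

    index : ∀ P → Vec (Fin N) (size P) → Index
    index P Q = P , Q

    family : List Index
    family = concatMap (λ P → map (index P) (vecs (allFin N) (size P))) (patterns r d)

    ∈-family : ∀ {P} → P ∈ patterns r d → ∀ Q → (P , Q) ∈ family
    ∈-family P∈ Q = ∈-concatMap⁺ _ (Any.map (λ { refl → ∈-map⁺ (index _) (∈-vecs ∈-allFin Q) }) P∈)

    length-family : length family ≤ length (patterns r d) * 2 ^ (l * σ)
    length-family = begin
      length family                                                        ≡⟨ length-∑ family ⟩
      ∑ family (λ _ → 1)                                                   ≡⟨ ∑-concatMap _ (patterns r d) _ ⟩
      ∑ (patterns r d) (λ P → ∑ (map (index P) (vecs (allFin N) (size P))) (λ _ → 1))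
        ≡⟨ ∑-cong (patterns r d) (λ P → trans (∑-map (index P) (vecs (allFin N) (size P)) _)
             (trans (sym (length-∑ (vecs (allFin N) (size P)))) (trans (length-vecs (allFin N) (size P)) (cong (_^ size P) length-V)))) ⟩
      ∑ (patterns r d) (λ P → N ^ size P)                                  ≤⟨ ∑-mono-∈ (patterns r d) (λ P∈ → ^-monoʳ-≤ N {{>-nonZero N≥1}} (term≤∑ size P∈)) ⟩
      ∑ (patterns r d) (λ _ → N ^ σ)                                       ≡⟨ ∑-const (patterns r d) _ ⟩
      length (patterns r d) * N ^ σ                                        ≡⟨ cong (length (patterns r d) *_) (^-*-assoc 2 l σ) ⟩
      length (patterns r d) * 2 ^ (l * σ) ∎
      where open ≤-Reasoning

    -- Logarithmic in N, since there are only polynomially many candidate sets; the 6 matches the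
    -- sixth power in `halve`.
    M₀ : ℕ
    M₀ = (a + l * σ) * 6

    family-small : (2 * length family) ^ 6 < 2 ^ M₀
    family-small = subst ((2 * length family) ^ 6 <_) (^-*-assoc 2 (a + l * σ) 6) (^-monoˡ-< 6 (begin-strict
      2 * length family                            ≤⟨ *-monoʳ-≤ 2 length-family ⟩
      2 * (length (patterns r d) * 2 ^ (l * σ))    ≡⟨ *-assoc 2 (length (patterns r d)) _ ⟨
      a * 2 ^ (l * σ)                              <⟨ *-monoˡ-< (2 ^ (l * σ)) {{m^n≢0 2 (l * σ)}} (n<2^n a) ⟩
      2 ^ a * 2 ^ (l * σ)                          ≡⟨ ^-distribˡ-+-* 2 a (l * σ) ⟨
      2 ^ (a + l * σ) ∎))
      where open ≤-Reasoning

    C₀≤N : C₀ ≤ N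
    C₀≤N = ≤-trans (m≤m*n C₀ n {{>-nonZero n≥1}}) N-large

    16b<l : 16 * b < l
    16b<l = ^-cancelˡ-≤ (≤-trans (m≤n+m (2 ^ suc (16 * b)) (K * 8)) C₀≤N)
      where
      ^-cancelˡ-≤ : ∀ {x y} → 2 ^ x ≤ 2 ^ y → x ≤ y
      ^-cancelˡ-≤ {x} {y} le with x ≤? y
      ... | yes x≤y = x≤y
      ... | no  x≰y = ⊥-elim (<-irrefl refl (<-≤-trans (^-monoʳ-< 2 (s≤s (s≤s z≤n)) (≰⇒> x≰y)) le))

    M₀-small : (2 * M₀) * (2 * M₀) ≤ N
    M₀-small = ≤-trans (*-mono-≤ 2M₀≤ 2M₀≤) (square≤2^ b l 16b<l)
      where
      open ≤-Reasoning
      lemma : ∀ a σ l → 2 * ((a * l + l * σ) * 6) ≡ 12 * (a + σ) * l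
      lemma = solve-∀
      2M₀≤ : 2 * M₀ ≤ b * l
      2M₀≤ = begin
        2 * ((a + l * σ) * 6)     ≤⟨ *-monoʳ-≤ 2 (*-monoˡ-≤ 6 (+-monoˡ-≤ (l * σ) (m≤m*n a l {{>-nonZero (≤-<-trans z≤n 16b<l)}}))) ⟩
        2 * ((a * l + l * σ) * 6) ≡⟨ lemma a σ l ⟩
        b * l ∎

    module Reg = Regions family (λ i → Candidates.candidate G T (proj₁ i) (proj₂ i)) M₀ family-small

    moments : ∀ {P} → P ∈ patterns r d → moment (allFin N) V≥1 weight weight-bound G T P ≤ M * N ^ size P
    moments {P} P∈ = subst (λ z → moment (allFin N) V≥1 weight weight-bound G T P ≤ M * z ^ size P) length-V
      (proj₂ (proj₂ (proj₂ DRC.goodTuple)) P∈)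

    module Order = DegeneracyOrder (wholeOrder H degenerate d<r)

    run : ∃ λ h → Distinct h × Embedded.Valid {n} {r} (edges H) G T Order.order h
    run = Embedding.embedding {n} {r} {d} {s} {N} {M} {M₀} (edges H) G T (proj₁ (proj₂ (proj₂ DRC.goodTuple)))
      level (λ D → proj₁ (proj₂ (levelOf N D))) moments
      Reg.region Reg.region-disjoint (λ P∈ Q j → Reg.region-large j (∈-family P∈ Q))
      (N !) (1≤n! N) (share N) (share-spec N) refl
      N≥1 (≤-<-trans z≤n M-large) 6≤s 3d≤s M₀-small
      Order.order Order.ordered roomy
      where
      lemma : ∀ n K → n * K * 8 ≡ K * 8 * n
      lemma = solve-∀
      roomy : n * K * 8 ≤ N
      roomy = ≤-trans (≤-reflexive (lemma n K)) (≤-trans (*-monoˡ-≤ n (m≤m+n (K * 8) _)) N-large)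

    copy : MonoCopy H χ
    copy = Copy.copy H degenerate d<r default χ c a₀ T (proj₁ run) (proj₁ (proj₂ run)) (proj₂ (proj₂ run))

  ramseyLE : ∀ n → 1 ≤ n → (H : Hypergraph k n) → SkelDegenerate H d → RamseyLE H q (2 * C₀ * n)
  ramseyLE n n≥1 H degenerate = 2 ^ l , m^n>0 2 l ,
    ≤-trans (≤-reflexive (sym (*-identityʳ (2 ^ l)))) (≤-trans (proj₂ (proj₂ power) C₀n≥1) (≤-reflexive (sym (*-assoc 2 C₀ n)))) ,
    Arrow.copy l n n≥1 (≤-trans (proj₁ (proj₂ power) ≤-refl) (≤-reflexive (*-identityʳ (2 ^ l)))) H degenerate
    where
    -- Rounding `C₀ * n` up to a power of two costs the factor 2 in the final constant.
    power : ∃ λ j → (1 ≤ 1 → C₀ * n ≤ 2 ^ j * 1) × (1 ≤ C₀ * n → 2 ^ j * 1 ≤ 2 * (C₀ * n))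
    power = levelOf (C₀ * n) 1
    l : ℕ
    l = proj₁ power
    C₀n≥1 : 1 ≤ C₀ * n
    C₀n≥1 = *-mono-≤ {1} {C₀} (≤-trans (m^n>0 2 (suc (16 * b))) (m≤n+m _ (K * 8))) n≥1

theorem1p5 : (k q d : ℕ) → 1 ≤ k → 1 ≤ q →
    ∃ λ C → ∀ (n : ℕ) → 1 ≤ n → (H : Hypergraph k n) →
    SkelDegeneracy≡ H d → RamseyLE H q (C * n)
theorem1p5 k (suc q) d 1≤k _ = 2 * B.C₀ , λ n n≥1 H deg → B.ramseyLE n n≥1 H (proj₁ deg)
  where
  -- `s` meets both `6 ≤ s` and `3 * d ≤ s`. Blocks have length `s + s` because moments of order 2 s
  -- are used. As k ≥ 1, the `k + d` parts outnumber `d`, which greedy colouring needs.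
  s ℓ : ℕ
  s = 6 + 3 * d
  ℓ = (k + d) * (s + s)
  module B = Bound k (suc q) d (k + d) s (proj₁ (ramsey k (suc q) ℓ)) _ (+-monoˡ-≤ d 1≤k) (m≤m+n 6 (3 * d)) (m≤n+m (3 * d) 6)
    zero zero (proj₂ (ramsey k (suc q) ℓ)) (n<1+n _)
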